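{- Let $f$ be a function of subexponential growth. Let $G$ be an infinite connected graph with $|B_r(x)|\le f(r)$ for every $x\in V(G)$ and $r\ge1$, having uniform patch frequency (UPF), and let $\{G_n\}_{n=1}^\infty$ be a Følner sequence in $G$. Then (a) $\lim_{n\to\infty}\frac{I(G_n)}{|V(G_n)|}$ exists; (b) $\lim_{n\to\infty}\frac{M(G_n)}{|V(G_n)|}$ exists; (c) $\lim_{n\to\infty}\frac{\log \pi^I_{G_n}(\lambda)}{|V(G_n)|}$ exists for all $0<\lambda<\infty$; (d) $\lim_{n\to\infty}\frac{\log \pi^M_{G_n}(\lambda)}{|V(G_n)|}$ exists for all $0<\lambda<\infty$.
   Context: A function $f:\mathbb{N}\to\mathbb{N}$ has subexponential growth if for every $\delta>0$ there is $C_\delta>0$ such that $f(n)\le C_\delta(1+\delta)^n$ for all $n\ge1$. $B_r(x)$ is the ball of radius $r$ around $x$ (the vertices at graph distance at most $r$ from $x$ with the induced graph structure, rooted at $x$). Følner sequence in $G$: a sequence of finite induced subgraphs $\{F_n\}_{n=1}^\infty$ of $G$ with $\bigcup_{n=1}^\infty F_n=G$ and $\lim_{n\to\infty}|\partial F_n|/|V(F_n)|=0$, where $\partial F_n$ is the set of $p\in V(F_n)$ for which there is $q\notin V(F_n)$ with $(p,q)\in E(G)$. Weak convergence: let $d$ bound the vertex degrees. For $r\ge1$, $U^{r,d}$ is the finite set of rooted isomorphism classes of finite simple connected rooted graphs of maximum degree at most $d$ in which every vertex is at distance at most $r$ from the root; for a finite graph $F$ and $\alpha\in U^{r,d}$,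 $p_F(\alpha)$ is the proportion of vertices $x$ of $F$ whose ball $B_r(x)$ in $F$ is rooted isomorphic to $\alpha$. A sequence of finite graphs $\{F_n\}$ with degree bound $d$ and $|V(F_n)|\to\infty$ is weakly convergent if $\lim_n p_{F_n}(\alpha)$ exists for every $r\ge 1$ and $\alpha\in U^{r,d}$. An infinite graph $G$ of subexponential growth has uniform patch frequency (UPF) if all of its Følner subgraph sequences are weakly convergent. For a finite graph $H$: $I(H)$ is the maximal size of an independent subset of $V(H)$; $M(H)$ is the maximal size of a matching in $E(H)$; $\pi_H^I(\lambda)=\sum_{S}\lambda^{|S|}$, the sum over all independent subsets $S\subset V(H)$; $\pi_H^M(\lambda)=\sum_T\lambda^{|T|}$, the sum over all matchings $T\subset E(H)$. (For $\lambda=1$ the limits in (c) and (d) are called the associated entropies.) -}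

module Defs where

open import Level using (0ℓ)
open import Data.Nat as ℕ using (ℕ; zero; suc; _⊔_; _!; NonZero)
import Data.Nat.Properties as ℕₚ
open import Data.Integer.Base using (+_)
open import Data.Rational as ℚ using (ℚ; 0ℚ; 1ℚ)
import Data.Rational.Properties as ℚₚ
open import Data.Rational.Solver using (module +-*-Solver)
open import Algebra.Bundles.Raw using (RawSemiring)
import Algebra.Definitions.RawSemiring
open import Data.Fin as Fin using (Fin)
import Data.Fin.Properties as Finₚ
open import Data.List as List using (List; []; _∷_; _++_; length; map; foldr; filter; allFin; cartesianProduct; upTo)
open import Data.List.Membership.Propositional using (_∈_)
open import Data.List.Relation.Unary.AllPairs using (AllPairs; allPairs?)
open import Data.List.Relation.Unary.Unique.Propositional using (Unique)
open import Data.Product using (Σ; _×_; _,_; ∃; ∃-syntax; proj₁; proj₂)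
open import Function.Base using (_∘_; _on_)
open import Function.Bundles using (_⇔_)
open import Function.Definitions using (Injective)
open import Relation.Binary.Core using (Rel)
open import Relation.Binary.Definitions using (Symmetric; Irreflexive; Decidable)
open import Relation.Binary.PropositionalEquality using (_≡_; _≢_; refl; sym; cong; subst; subst₂)
open import Relation.Nullary using (¬_; yes; no; ¬?; _×-dec_)
open import Relation.Unary using (Pred; U)

-- Reals are Cauchy sequences of rationals with a modulus, identified up
-- to _≃ᴿ_ below.

IsCauchy : (ℕ → ℚ) → Set
IsCauchy s = ∀ (ε : ℚ) → 0ℚ ℚ.< ε →
  ∃[ N ] ∀ m n → N ℕ.≤ m → N ℕ.≤ n → ℚ.∣ s m ℚ.- s n ∣ ℚ.< ε

record ℝ : Set where
  constructor mkℝ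
  field
    seq    : ℕ → ℚ
    cauchy : IsCauchy seq
open ℝ public

private
  module Estimates where
    open +-*-Solver

    half : ℚ → ℚ
    half ε = ℚ.½ ℚ.* ε

    half-pos : ∀ {ε} → 0ℚ ℚ.< ε → 0ℚ ℚ.< half ε
    half-pos {ε} p = subst (ℚ._< half ε) (ℚₚ.*-zeroʳ ℚ.½) (ℚₚ.*-monoʳ-<-pos ℚ.½ p)

    half+half : ∀ ε → half ε ℚ.+ half ε ≡ ε
    half+half ε = solve 1 (λ e → con ℚ.½ :* e :+ con ℚ.½ :* e := e) refl ε

    +-rearrange : ∀ a b c d → (a ℚ.- c) ℚ.+ (b ℚ.- d) ≡ (a ℚ.+ b) ℚ.- (c ℚ.+ d)
    +-rearrange = solve 4 (λ a b c d → (a :- c) :+ (b :- d) := (a :+ b) :- (c :+ d)) refl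

    neg-rearrange : ∀ a b → ℚ.- (a ℚ.- b) ≡ ℚ.- a ℚ.- ℚ.- b
    neg-rearrange = solve 2 (λ a b → :- (a :- b) := :- a :- :- b) refl

    *-rearrange : ∀ a b c d → a ℚ.* (b ℚ.- d) ℚ.+ d ℚ.* (a ℚ.- c) ≡ a ℚ.* b ℚ.- c ℚ.* d
    *-rearrange = solve 4 (λ a b c d → a :* (b :- d) :+ d :* (a :- c) := a :* b :- c :* d) refl

    split : ∀ a b → a ≡ (a ℚ.- b) ℚ.+ b
    split = solve 2 (λ a b → a := (a :- b) :+ b) refl

    bounded : (x : ℝ) → ∃[ B ] (0ℚ ℚ.< B × ∃[ N ] ∀ n → N ℕ.≤ n → ℚ.∣ seq x n ∣ ℚ.≤ B)
    bounded x with cauchy x 1ℚ (ℚₚ.positive⁻¹ 1ℚ)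
    ... | N , close =
      1ℚ ℚ.+ a , ℚₚ.+-mono-<-≤ (ℚₚ.positive⁻¹ 1ℚ) (ℚₚ.0≤∣p∣ (seq x N)) , N , bound
      where
      a = ℚ.∣ seq x N ∣
      open ℚₚ.≤-Reasoning
      bound : ∀ n → N ℕ.≤ n → ℚ.∣ seq x n ∣ ℚ.≤ 1ℚ ℚ.+ a
      bound n N≤n = begin
        ℚ.∣ seq x n ∣                               ≡⟨ cong ℚ.∣_∣ (split (seq x n) (seq x N)) ⟩
        ℚ.∣ (seq x n ℚ.- seq x N) ℚ.+ seq x N ∣     ≤⟨ ℚₚ.∣p+q∣≤∣p∣+∣q∣ (seq x n ℚ.- seq x N) (seq x N) ⟩
        ℚ.∣ seq x n ℚ.- seq x N ∣ ℚ.+ a             ≤⟨ ℚₚ.+-monoˡ-≤ a (ℚₚ.<⇒≤ (close n N N≤n ℕₚ.≤-refl)) ⟩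
        1ℚ ℚ.+ a                                    ∎

    shrink : ∀ {B ε} → 0ℚ ℚ.< B → 0ℚ ℚ.< ε → ∃[ η ] (0ℚ ℚ.< η × B ℚ.* η ≡ half ε)
    shrink {B} {ε} 0<B 0<ε = η , 0<η , B*η
      where
      instance
        B-pos = ℚ.positive 0<B
        B-nz  = ℚₚ.pos⇒nonZero B
        B⁻¹-pos = ℚₚ.1/pos⇒pos B
      η = ℚ.1/ B ℚ.* half ε
      0<η : 0ℚ ℚ.< η
      0<η = subst (ℚ._< η) (ℚₚ.*-zeroʳ (ℚ.1/ B)) (ℚₚ.*-monoʳ-<-pos (ℚ.1/ B) (half-pos 0<ε))
      open Relation.Binary.PropositionalEquality.≡-Reasoning
      B*η : B ℚ.* η ≡ half ε
      B*η = begin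
        B ℚ.* (ℚ.1/ B ℚ.* half ε)  ≡⟨ ℚₚ.*-assoc B (ℚ.1/ B) (half ε) ⟨
        (B ℚ.* ℚ.1/ B) ℚ.* half ε  ≡⟨ cong (ℚ._* half ε) (ℚₚ.*-inverseʳ B) ⟩
        1ℚ ℚ.* half ε              ≡⟨ ℚₚ.*-identityˡ (half ε) ⟩
        half ε                     ∎

    *-bound : ∀ {p d B η δ} → ℚ.∣ p ∣ ℚ.≤ B → 0ℚ ℚ.< B → ℚ.∣ d ∣ ℚ.< η → B ℚ.* η ≡ δ →
              ℚ.∣ p ℚ.* d ∣ ℚ.< δ
    *-bound {p} {d} {B} {η} {δ} p≤B 0<B d<η Bη = begin-strict
      ℚ.∣ p ℚ.* d ∣          ≡⟨ ℚₚ.∣p*q∣≡∣p∣*∣q∣ p d ⟩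
      ℚ.∣ p ∣ ℚ.* ℚ.∣ d ∣    ≤⟨ ℚₚ.*-monoʳ-≤-nonNeg ℚ.∣ d ∣ {{ℚₚ.∣-∣-nonNeg d}} p≤B ⟩
      B ℚ.* ℚ.∣ d ∣          <⟨ ℚₚ.*-monoʳ-<-pos B {{ℚ.positive 0<B}} d<η ⟩
      B ℚ.* η                ≡⟨ Bη ⟩
      δ                      ∎
      where open ℚₚ.≤-Reasoning

    sum-bound : ∀ {a b c ε} → a ℚ.+ b ≡ c → ℚ.∣ a ∣ ℚ.< half ε → ℚ.∣ b ∣ ℚ.< half ε → ℚ.∣ c ∣ ℚ.< ε
    sum-bound {a} {b} {c} {ε} a+b a< b< = begin-strict
      ℚ.∣ c ∣                 ≡⟨ cong ℚ.∣_∣ a+b ⟨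
      ℚ.∣ a ℚ.+ b ∣           ≤⟨ ℚₚ.∣p+q∣≤∣p∣+∣q∣ a b ⟩
      ℚ.∣ a ∣ ℚ.+ ℚ.∣ b ∣     <⟨ ℚₚ.+-mono-< a< b< ⟩
      half ε ℚ.+ half ε       ≡⟨ half+half ε ⟩
      ε                       ∎
      where open ℚₚ.≤-Reasoning

    +-close : ∀ a b c d {ε} → ℚ.∣ a ℚ.- c ∣ ℚ.< half ε → ℚ.∣ b ℚ.- d ∣ ℚ.< half ε →
              ℚ.∣ (a ℚ.+ b) ℚ.- (c ℚ.+ d) ∣ ℚ.< ε
    +-close a b c d {ε} p q =
      sum-bound {a ℚ.- c} {b ℚ.- d} {(a ℚ.+ b) ℚ.- (c ℚ.+ d)} {ε} (+-rearrange a b c d) p q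

    neg-close : ∀ a b {ε} → ℚ.∣ a ℚ.- b ∣ ℚ.< ε → ℚ.∣ ℚ.- a ℚ.- ℚ.- b ∣ ℚ.< ε
    neg-close a b {ε} p = begin-strict
      ℚ.∣ ℚ.- a ℚ.- ℚ.- b ∣    ≡⟨ cong ℚ.∣_∣ (neg-rearrange a b) ⟨
      ℚ.∣ ℚ.- (a ℚ.- b) ∣      ≡⟨ ℚₚ.∣-p∣≡∣p∣ (a ℚ.- b) ⟩
      ℚ.∣ a ℚ.- b ∣            <⟨ p ⟩
      ε                        ∎
      where open ℚₚ.≤-Reasoning

    *-close : ∀ a b c d {A D η θ ε} →
              ℚ.∣ a ∣ ℚ.≤ A → 0ℚ ℚ.< A → ℚ.∣ b ℚ.- d ∣ ℚ.< η → A ℚ.* η ≡ half ε →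
              ℚ.∣ d ∣ ℚ.≤ D → 0ℚ ℚ.< D → ℚ.∣ a ℚ.- c ∣ ℚ.< θ → D ℚ.* θ ≡ half ε →
              ℚ.∣ a ℚ.* b ℚ.- c ℚ.* d ∣ ℚ.< ε
    *-close a b c d {A} {D} {η} {θ} {ε} a≤A 0<A bd Aη d≤D 0<D ac Dθ =
      sum-bound {a ℚ.* (b ℚ.- d)} {d ℚ.* (a ℚ.- c)} {a ℚ.* b ℚ.- c ℚ.* d} {ε} (*-rearrange a b c d)
        (*-bound {a} {b ℚ.- d} {A} {η} {half ε} a≤A 0<A bd Aη)
        (*-bound {d} {a ℚ.- c} {D} {θ} {half ε} d≤D 0<D ac Dθ)

fromℚ : ℚ → ℝ
fromℚ q = mkℝ (λ _ → q) λ ε 0<ε → 0 , λ _ _ _ _ →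
  subst (ℚ._< ε) (sym (cong ℚ.∣_∣ (ℚₚ.+-inverseʳ q))) 0<ε

infixl 6 _+ᴿ_ _-ᴿ_
infixl 7 _*ᴿ_
infix  8 -ᴿ_
infix  4 _<ᴿ_ _≃ᴿ_

_+ᴿ_ : ℝ → ℝ → ℝ
x +ᴿ y = mkℝ (λ n → seq x n ℚ.+ seq y n) c
  where
  open Estimates
  c : IsCauchy (λ n → seq x n ℚ.+ seq y n)
  c ε 0<ε =
    let N₁ , c₁ = cauchy x (half ε) (half-pos {ε} 0<ε)
        N₂ , c₂ = cauchy y (half ε) (half-pos {ε} 0<ε)
    in N₁ ⊔ N₂ , λ m n N≤m N≤n →
      +-close (seq x m) (seq y m) (seq x n) (seq y n) {ε}
        (c₁ m n (ℕₚ.m⊔n≤o⇒m≤o N₁ N₂ N≤m) (ℕₚ.m⊔n≤o⇒m≤o N₁ N₂ N≤n))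
        (c₂ m n (ℕₚ.m⊔n≤o⇒n≤o N₁ N₂ N≤m) (ℕₚ.m⊔n≤o⇒n≤o N₁ N₂ N≤n))

-ᴿ_ : ℝ → ℝ
-ᴿ x = mkℝ (λ n → ℚ.- seq x n) λ ε 0<ε →
  let N , c = cauchy x ε 0<ε in
  N , λ m n N≤m N≤n → Estimates.neg-close (seq x m) (seq x n) {ε} (c m n N≤m N≤n)

_-ᴿ_ : ℝ → ℝ → ℝ
x -ᴿ y = x +ᴿ -ᴿ y

_*ᴿ_ : ℝ → ℝ → ℝ
x *ᴿ y = mkℝ (λ n → seq x n ℚ.* seq y n) c
  where
  open Estimates
  c : IsCauchy (λ n → seq x n ℚ.* seq y n)
  c ε 0<ε =
    let A , 0<A , M₁ , b₁ = bounded x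
        D , 0<D , M₂ , b₂ = bounded y
        η , 0<η , Aη      = shrink {A} {ε} 0<A 0<ε
        θ , 0<θ , Dθ      = shrink {D} {ε} 0<D 0<ε
        N₁ , c₁           = cauchy y η 0<η
        N₂ , c₂           = cauchy x θ 0<θ
        M = M₁ ⊔ M₂
        N = N₁ ⊔ N₂
        M₁≤ = λ {k} (p : M ⊔ N ℕ.≤ k) → ℕₚ.m⊔n≤o⇒m≤o M₁ M₂ (ℕₚ.m⊔n≤o⇒m≤o M N p)
        M₂≤ = λ {k} (p : M ⊔ N ℕ.≤ k) → ℕₚ.m⊔n≤o⇒n≤o M₁ M₂ (ℕₚ.m⊔n≤o⇒m≤o M N p)
        N₁≤ = λ {k} (p : M ⊔ N ℕ.≤ k) → ℕₚ.m⊔n≤o⇒m≤o N₁ N₂ (ℕₚ.m⊔n≤o⇒n≤o M N p)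
        N₂≤ = λ {k} (p : M ⊔ N ℕ.≤ k) → ℕₚ.m⊔n≤o⇒n≤o N₁ N₂ (ℕₚ.m⊔n≤o⇒n≤o M N p)
    in M ⊔ N , λ m n p q →
      *-close (seq x m) (seq y m) (seq x n) (seq y n) {A} {D} {η} {θ} {ε}
        (b₁ m (M₁≤ p)) 0<A (c₁ m n (N₁≤ p) (N₁≤ q)) Aη
        (b₂ n (M₂≤ q)) 0<D (c₂ m n (N₂≤ p) (N₂≤ q)) Dθ

_<ᴿ_ : Rel ℝ 0ℓ
x <ᴿ y = ∃[ ε ] (0ℚ ℚ.< ε × ∃[ N ] ∀ n → N ℕ.≤ n → seq x n ℚ.+ ε ℚ.< seq y n)

_≃ᴿ_ : Rel ℝ 0ℓ
x ≃ᴿ y = ∀ (ε : ℚ) → 0ℚ ℚ.< ε → ∃[ N ] ∀ n → N ℕ.≤ n → ℚ.∣ seq x n ℚ.- seq y n ∣ ℚ.< ε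

ℝ-rawSemiring : RawSemiring 0ℓ 0ℓ
ℝ-rawSemiring = record
  { Carrier = ℝ ; _≈_ = _≃ᴿ_ ; _+_ = _+ᴿ_ ; _*_ = _*ᴿ_ ; 0# = fromℚ 0ℚ ; 1# = fromℚ 1ℚ }

open Algebra.Definitions.RawSemiring ℝ-rawSemiring public
  using () renaming (_^_ to _^ᴿ_)
open Algebra.Definitions.RawSemiring ℚ.+-*-rawSemiring public
  using () renaming (_^_ to _^ℚ_)

sumᴿ : List ℝ → ℝ
sumᴿ = foldr _+ᴿ_ (fromℚ 0ℚ)

infix 4 _⟶_

_⟶_ : (ℕ → ℝ) → ℝ → Set
a ⟶ L = ∀ (ε : ℚ) → 0ℚ ℚ.< ε →
  ∃[ N ] ∀ n → N ℕ.≤ n → (L -ᴿ fromℚ ε <ᴿ a n) × (a n <ᴿ L +ᴿ fromℚ ε)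

LimitExists : (ℕ → ℝ) → Set
LimitExists a = ∃[ L ] (a ⟶ L)

expPartialSum : ℝ → ℕ → ℝ
expPartialSum y n = sumᴿ (map (λ k → fromℚ (ℚ._/_ (+ 1) (k !) {{k ℕₚ.!≢0}}) *ᴿ (y ^ᴿ k)) (upTo n))

-- log is the inverse of exp y = Σₖ yᵏ/k!.
_IsLogOf_ : ℝ → ℝ → Set
y IsLogOf x = expPartialSum y ⟶ x

-- Rational δ and C suffice: ℚ is cofinal in ℝ and dense below any δ > 0.
SubexponentialGrowth : (ℕ → ℕ) → Set
SubexponentialGrowth f = ∀ (δ : ℚ) → 0ℚ ℚ.< δ → ∃[ C ] (0ℚ ℚ.< C ×
  (∀ n → 1 ℕ.≤ n → ℚ._/_ (+ f n) 1 ℚ.≤ C ℚ.* ((1ℚ ℚ.+ δ) ^ℚ n)))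

-- A relation rather than a function, so that P need not be decidable.

HasCardinality : {A : Set} → Pred A 0ℓ → ℕ → Set
HasCardinality {A} P m =
  Σ (List A) λ xs → Unique xs × (∀ x → (x ∈ xs) ⇔ P x) × length xs ≡ m

CardinalityAtMost : {A : Set} → Pred A 0ℓ → ℕ → Set
CardinalityAtMost P k = ∃[ m ] (HasCardinality P m × m ℕ.≤ k)

-- Simple graphs.  Decidability of adjacency is no restriction
-- classically; it makes I, M, π computable on finite induced subgraphs.
record Graph (V : Set) : Set₁ where
  field
    _~_    : Rel V 0ℓ
    _~?_   : Decidable _~_
    symm   : Symmetric _~_
    irrefl : Irreflexive _≡_ _~_

module _ {V : Set} (G : Graph V) where
  open Graph G

  -- Dist≤ r x y: there is a walk of length at most r from x to y.
  data Dist≤ : ℕ → V → V → Set where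
    here : ∀ {r x} → Dist≤ r x x
    step : ∀ {r x y z} → x ~ y → Dist≤ r y z → Dist≤ (suc r) x z

  Ball : ℕ → V → Pred V 0ℓ
  Ball r x y = Dist≤ r x y

  Connected : Set
  Connected = ∀ x y → ∃[ r ] Dist≤ r x y

  MaxDegree≤ : ℕ → Set
  MaxDegree≤ d = ∀ x → CardinalityAtMost (x ~_) d

  Growth≤ : (ℕ → ℕ) → Set
  Growth≤ f = ∀ x r → 1 ℕ.≤ r → CardinalityAtMost (Ball r x) (f r)

Infinite : Set → Set
Infinite V = ¬ (∃[ m ] HasCardinality {V} U m)

-- Finite graphs are nonempty, as they occur with |V| in a denominator.
record FiniteGraph : Set₁ where
  field
    order        : ℕ
    {{nonempty}} : NonZero order
    graph        : Graph (Fin order)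
  open Graph graph public
open FiniteGraph public using (order; graph)

_/∣_∣ : ℕ → FiniteGraph → ℚ
k /∣ H ∣ = ℚ._/_ (+ k) (order H) {{FiniteGraph.nonempty H}}

record FiniteVertexSet (V : Set) : Set where
  field
    size         : ℕ
    {{nonempty}} : NonZero size
    vertex       : Fin size → V
    injective    : Injective _≡_ _≡_ vertex

_∈ᵥ_ : {V : Set} → V → FiniteVertexSet V → Set
v ∈ᵥ S = ∃[ i ] (FiniteVertexSet.vertex S i ≡ v)

induced : {V : Set} → Graph V → FiniteVertexSet V → FiniteGraph
induced G S = record
  { order = size
  ; graph = record
    { _~_    = _~_ on vertex
    ; _~?_   = λ i j → vertex i ~? vertex j
    ; symm   = symm
    ; irrefl = λ i≡j → irrefl (cong vertex i≡j)
    }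
  }
  where
  open Graph G
  open FiniteVertexSet S

Boundary : {V : Set} → Graph V → FiniteVertexSet V → Pred V 0ℓ
Boundary G S p = (p ∈ᵥ S) × ∃[ q ] (¬ (q ∈ᵥ S) × Graph._~_ G p q)

-- The union of the induced subgraphs is G: it contains all vertices and
-- all edges.
record Følner {V : Set} (G : Graph V) (F : ℕ → FiniteVertexSet V) : Set where
  field
    vertices : ∀ v → ∃[ n ] (v ∈ᵥ F n)
    edges    : ∀ u v → Graph._~_ G u v → ∃[ n ] ((u ∈ᵥ F n) × (v ∈ᵥ F n))
    ∣∂∣      : ℕ → ℕ
    ∣∂∣-card : ∀ n → HasCardinality (Boundary G (F n)) (∣∂∣ n)
    ratio    : (λ n → fromℚ (∣∂∣ n /∣ induced G (F n) ∣)) ⟶ fromℚ 0ℚ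

-- Representatives of the rooted isomorphism classes in U^{r,d}.
record Patch (r d : ℕ) : Set₁ where
  field
    size      : ℕ
    pgraph    : Graph (Fin size)
    root      : Fin size
    connected : Connected pgraph
    degree    : MaxDegree≤ pgraph d
    radius    : ∀ a → Dist≤ pgraph r root a

-- A rooted isomorphism from α to the ball B_r(x), given as an embedding
-- into V whose image is the ball.
record BallIso {V : Set} (G : Graph V) {r d : ℕ} (α : Patch r d) (x : V) : Set where
  open Patch α
  field
    to        : Fin size → V
    injective : Injective _≡_ _≡_ to
    image     : ∀ y → Ball G r x y ⇔ (∃[ a ] (to a ≡ y))
    root-pres : to root ≡ x
    adj-pres  : ∀ a b → Graph._~_ pgraph a b ⇔ Graph._~_ G (to a) (to b)

-- The limit of p_{F n}(α) exists; c n counts the vertices of F n whose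
-- r-ball is of type α, so that p_{F n}(α) = c n / |V(F n)|.
PatchFrequencyConverges : (ℕ → FiniteGraph) → {r d : ℕ} → Patch r d → Set
PatchFrequencyConverges F α = Σ (ℕ → ℕ) λ c →
  (∀ n → HasCardinality (BallIso (graph (F n)) α) (c n)) ×
  LimitExists (λ n → fromℚ (c n /∣ F n ∣))

record WeaklyConvergent (d : ℕ) (F : ℕ → FiniteGraph) : Set₁ where
  field
    degree      : ∀ n → MaxDegree≤ (graph (F n)) d
    unbounded   : ∀ K → ∃[ N ] ∀ n → N ℕ.≤ n → K ℕ.≤ order (F n)
    frequencies : ∀ r → 1 ℕ.≤ r → (α : Patch r d) → PatchFrequencyConverges F α

UPF : {V : Set} → ℕ → Graph V → Set₁
UPF d G = ∀ F → Følner G F → WeaklyConvergent d (induced G ∘ F)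

-- On a duplicate-free list the sublists enumerate the subsets, each once.
sublists : {A : Set} → List A → List (List A)
sublists []       = [] ∷ []
sublists (x ∷ xs) = sublists xs ++ map (x ∷_) (sublists xs)

maximum : List ℕ → ℕ
maximum = foldr _⊔_ 0

module _ (H : FiniteGraph) where
  open FiniteGraph H using (_~_; _~?_)

  Vertex : Set
  Vertex = Fin (order H)

  -- Each undirected edge is listed once, as (i , j) with i < j.
  edgeList : List (Vertex × Vertex)
  edgeList = filter (λ (i , j) → (i Fin.<? j) ×-dec (i ~? j))
                    (cartesianProduct (allFin (order H)) (allFin (order H)))

  Disjoint : Rel (Vertex × Vertex) 0ℓ
  Disjoint (i , j) (k , l) = (i ≢ k × i ≢ l) × (j ≢ k × j ≢ l)

  disjoint? : Decidable Disjoint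
  disjoint? (i , j) (k , l) =
    (¬? (i Fin.≟ k) ×-dec ¬? (i Fin.≟ l)) ×-dec (¬? (j Fin.≟ k) ×-dec ¬? (j Fin.≟ l))

  independentSets : List (List Vertex)
  independentSets = filter (allPairs? (λ i j → ¬? (i ~? j))) (sublists (allFin (order H)))

  matchings : List (List (Vertex × Vertex))
  matchings = filter (allPairs? disjoint?) (sublists edgeList)

  I : ℕ
  I = maximum (map length independentSets)

  M : ℕ
  M = maximum (map length matchings)

  πᴵ : ℝ → ℝ
  πᴵ z = sumᴿ (map (λ S → z ^ᴿ length S) independentSets)

  πᴹ : ℝ → ℝ
  πᴹ z = sumᴿ (map (λ T → z ^ᴿ length T) matchings)

-- Existence of lim log (x n) / |V(F n)|.  As exp is injective, ℓ n is
-- determined up to _≃ᴿ_ by x n; that it exists is part of the claim.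
LogDensityLimitExists : (ℕ → FiniteGraph) → (ℕ → ℝ) → Set
LogDensityLimitExists F x = Σ (ℕ → ℝ) λ ℓ →
  (∀ n → ℓ n IsLogOf x n) × LimitExists (λ n → fromℚ (1 /∣ F n ∣) *ᴿ ℓ n)

{-# OPTIONS --safe #-}
module Submission where

-- Each of the four quantities is, up to a logarithm, the value of a set function h on vertex
-- sets that is monotone, changes by a bounded amount per vertex, is additive on sets without
-- edges between them, and depends only on the induced subgraph.
--
-- Subexponential growth is used twice.  Deterministically and locally, every vertex y spreads a
-- fixed mass D over a ball of bounded radius, almost in the same way as its neighbours do; the
-- level sets of the mass received by a vertex x are clusters around x, which together cover
-- every vertex D times.  Globally, ball carving cuts the graph into pieces of bounded radius at
-- the cost of few vertices, and a piece lies inside or outside of nearly every cluster.  Hence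
-- D h(V) differs from the sum of h over all clusters by a small multiple of |V|.  But that sum
-- is a sum over x of quantities determined by the isomorphism type of a ball around x, so after
-- division by |V| it converges with the patch frequencies.
--
-- For the generating functions h takes values in the multiplicative monoid of rationals ≥ 1, at
-- the rational approximations of λ, and logarithms are read off from discrete logarithms to the
-- base 1 + 1/(k+1).

open import Defs
import Algebra.Properties.CommutativeMonoid.Mult as Mult
import Algebra.Properties.CommutativeSemigroup as CommSemigroup
open import Data.Bool using (Bool; _xor_; _∧_; _∨_; false; if_then_else_; not; true)
import Data.Bool.Properties as Boolₚ
open import Data.Nat as ℕ using (suc; s≤s; zero; z≤n; ℕ)
import Data.Nat.Properties as ℕₚ
open import Data.Nat.Tactic.RingSolver using (solve-∀)
import Data.Integer as ℤ
import Data.Integer.Properties as ℤₚ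
open import Data.Rational as ℚ using (0ℚ; 1ℚ; ℚ)
import Data.Rational.Properties as ℚₚ
open import Data.Rational.Solver using (module +-*-Solver)
import Data.Rational.Unnormalised as ℚᵘ
import Data.Rational.Unnormalised.Properties as ℚᵘₚ
open import Data.Fin as Fin using (Fin)
import Data.Fin.Properties as Finₚ
import Data.Vec as Vec
import Data.Vec.Properties as Vecₚ
open import Data.List as List
  using (List; []; _++_; _∷_; allFin; cartesianProduct; filter; length; lookup; map; upTo)
import Data.List.Membership.DecPropositional as DecMembership
open import Data.List.Membership.Propositional using (_∈_)
open import Data.List.Membership.Propositional.Properties
  using (∈-allFin; ∈-filter⁺; ∈-filter⁻; ∈-lookup; ∈-map⁻)
import Data.List.Properties as Listₚ
open import Data.List.Relation.Binary.Permutation.Propositional as Perm using (_↭_)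
open import Data.List.Relation.Unary.All as All using (All; []; _∷_)
import Data.List.Relation.Unary.All.Properties as Allₚ
open import Data.List.Relation.Unary.AllPairs using ([]; _∷_)
open import Data.List.Relation.Unary.Any as Any using (Any; here; there)
import Data.List.Relation.Unary.Any.Properties as Anyₚ
open import Data.List.Relation.Unary.Unique.Propositional using (Unique)
import Data.List.Relation.Unary.Unique.Propositional.Properties as Uniqueₚ
open import Data.Product using (_,_; _×_; proj₁; proj₂; uncurry; ∃; ∃-syntax)
open import Data.Sum using (inj₁; inj₂)
open import Function.Base using (_∘_)
open import Function.Bundles using (Equivalence; _⇔_; mk⇔)
open import Function.Definitions using (Injective)
open import Level using (0ℓ)
open import Relation.Binary.Definitions using (tri<; tri>; tri≈)
import Relation.Binary.Reasoning.Preorder as PreorderReasoning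
open import Relation.Nullary using (Dec; _×-dec_; contradiction; does; no; yes; ¬?; ¬_)
open import Relation.Nullary.Decidable using (dec-false; dec-true; does-⇔; map′)
open import Relation.Unary as Unary using (Pred)
open import Relation.Binary.PropositionalEquality hiding (preorder)

-- Neither decomposition would do alone. A carving results from successive choices, so its pieces
-- are not determined by balls of bounded radius and cannot be read off patch frequencies; the
-- clusters are determined locally, but they overlap and edges run between them, so that additivity
-- does not apply to them. Hence limits are taken with the clusters, and the carving serves only to
-- prove the inequalities between `D · h` and the sum over clusters. The scales are chosen in this
-- order: the carving radius `R` for the precision `1 / q`; the decay rate `p = 4 * R * q`, so that
-- along `R` steps at most a fraction `1 / q` of the mass `D` is rearranged; and the radius `s`, at
-- which the truncation of the decay, `p ^ s` for every vertex of a ball, amounts to no more than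
-- the value at its centre. Taking `D` to be a factorial keeps the normalised masses integral. An
-- ordered monoid has no subtraction, so every approximate equality is a pair of inequalities with
-- an explicit multiple of `unit` on the right.

module OrderedMonoids where

  -- Ordered commutative monoids and finite sums in them.

  open import Algebra.Bundles using (CommutativeMonoid)
  open import Algebra.Structures using (IsCommutativeMonoid)
  open import Data.Nat using (_+_; _*_; _≤_)
  open import Relation.Binary.Bundles using (Preorder)

  -- Instantiated by (ℕ, +) for the sizes and (ℚ≥1, *) for the values of the generating functions.
  record OrderedMonoid : Set₁ where
    infix  4 _⊑_
    infixl 6 _∙_
    field
      Carrier             : Set
      _⊑_                 : Carrier → Carrier → Set
      _∙_                 : Carrier → Carrier → Carrier
      ε                   : Carrier
      isCommutativeMonoid : IsCommutativeMonoid _≡_ _∙_ ε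
      ⊑-refl              : ∀ {a} → a ⊑ a
      ⊑-trans             : ∀ {a b c} → a ⊑ b → b ⊑ c → a ⊑ c
      ∙-mono              : ∀ {a b c d} → a ⊑ b → c ⊑ d → (a ∙ c) ⊑ (b ∙ d)
      ε-least             : ∀ a → ε ⊑ a

    commutativeMonoid : CommutativeMonoid _ _
    commutativeMonoid = record { isCommutativeMonoid = isCommutativeMonoid }

    open CommutativeMonoid commutativeMonoid public
      using (assoc; comm; identityˡ; identityʳ; commutativeSemigroup)
    open CommSemigroup commutativeSemigroup public using (interchange; x∙yz≈y∙xz)
    open Mult commutativeMonoid public
      using (×-homo-+; ×-assocˡ; ×-distrib-+) renaming (_×_ to infixr 8 _·_)

    ⊑-reflexive : ∀ {a b} → a ≡ b → a ⊑ b
    ⊑-reflexive refl = ⊑-refl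

    preorder : Preorder _ _ _
    preorder = record
      { Carrier = Carrier ; _≈_ = _≡_ ; _≲_ = _⊑_
      ; isPreorder = record { isEquivalence = isEquivalence ; reflexive = ⊑-reflexive ; trans = ⊑-trans } }

    module ⊑-Reasoning = PreorderReasoning preorder

    ⊑-∙ʳ : ∀ a b → a ⊑ a ∙ b
    ⊑-∙ʳ a b = ⊑-trans (⊑-reflexive (sym (identityʳ a))) (∙-mono ⊑-refl (ε-least b))

    ·-monoʳ : ∀ n {a b} → a ⊑ b → n · a ⊑ n · b
    ·-monoʳ zero    a⊑b = ⊑-refl
    ·-monoʳ (suc n) a⊑b = ∙-mono a⊑b (·-monoʳ n a⊑b)

    ·-monoˡ : ∀ {m n} a → m ≤ n → m · a ⊑ n · a
    ·-monoˡ a z≤n       = ε-least _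
    ·-monoˡ a (s≤s m≤n) = ∙-mono ⊑-refl (·-monoˡ a m≤n)

    ·-ε : ∀ n → n · ε ≡ ε
    ·-ε zero    = refl
    ·-ε (suc n) = trans (identityˡ _) (·-ε n)

    ∑ : ∀ {ℓ} {X : Set ℓ} → List X → (X → Carrier) → Carrier
    ∑ []       f = ε
    ∑ (x ∷ xs) f = f x ∙ ∑ xs f

    module _ {ℓ} {X : Set ℓ} where

      ∑-mono-∈ : ∀ (xs : List X) {f g} → (∀ x → x ∈ xs → f x ⊑ g x) → ∑ xs f ⊑ ∑ xs g
      ∑-mono-∈ []       f⊑g = ⊑-refl
      ∑-mono-∈ (x ∷ xs) f⊑g = ∙-mono (f⊑g x (here refl)) (∑-mono-∈ xs (λ y → f⊑g y ∘ there))

      ∑-mono : ∀ (xs : List X) {f g} → (∀ x → f x ⊑ g x) → ∑ xs f ⊑ ∑ xs g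
      ∑-mono xs f⊑g = ∑-mono-∈ xs λ x _ → f⊑g x

      ∑-cong-∈ : ∀ (xs : List X) {f g} → (∀ x → x ∈ xs → f x ≡ g x) → ∑ xs f ≡ ∑ xs g
      ∑-cong-∈ []       f≡g = refl
      ∑-cong-∈ (x ∷ xs) f≡g = cong₂ _∙_ (f≡g x (here refl)) (∑-cong-∈ xs (λ y → f≡g y ∘ there))

      ∑-cong : ∀ (xs : List X) {f g} → (∀ x → f x ≡ g x) → ∑ xs f ≡ ∑ xs g
      ∑-cong xs f≡g = ∑-cong-∈ xs λ x _ → f≡g x

      ∑-∙ : ∀ (xs : List X) f g → ∑ xs (λ x → f x ∙ g x) ≡ ∑ xs f ∙ ∑ xs g
      ∑-∙ []       f g = sym (identityˡ ε)
      ∑-∙ (x ∷ xs) f g = trans (cong (f x ∙ g x ∙_) (∑-∙ xs f g)) (interchange (f x) (g x) (∑ xs f) (∑ xs g))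

      ∑-ε : ∀ (xs : List X) → ∑ xs (λ _ → ε) ≡ ε
      ∑-ε []       = refl
      ∑-ε (x ∷ xs) = trans (identityˡ _) (∑-ε xs)

      ∑-const : ∀ (xs : List X) a → ∑ xs (λ _ → a) ≡ length xs · a
      ∑-const []       a = refl
      ∑-const (x ∷ xs) a = cong (a ∙_) (∑-const xs a)

      ∑-++ : ∀ (xs ys : List X) f → ∑ (xs ++ ys) f ≡ ∑ xs f ∙ ∑ ys f
      ∑-++ []       ys f = sym (identityˡ _)
      ∑-++ (x ∷ xs) ys f = trans (cong (f x ∙_) (∑-++ xs ys f)) (sym (assoc (f x) (∑ xs f) (∑ ys f)))

      ∑-↭ : ∀ {xs ys : List X} f → xs ↭ ys → ∑ xs f ≡ ∑ ys f
      ∑-↭ f Perm.refl          = refl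
      ∑-↭ f (Perm.prep x p)    = cong (f x ∙_) (∑-↭ f p)
      ∑-↭ f (Perm.swap x y p)  = trans (cong (λ a → f x ∙ (f y ∙ a)) (∑-↭ f p)) (x∙yz≈y∙xz (f x) (f y) _)
      ∑-↭ f (Perm.trans p p′)  = trans (∑-↭ f p) (∑-↭ f p′)

    ∑-swap : ∀ {ℓ ℓ′} {X : Set ℓ} {Y : Set ℓ′} (xs : List X) (ys : List Y) (f : X → Y → Carrier) →
             ∑ xs (λ x → ∑ ys (f x)) ≡ ∑ ys (λ y → ∑ xs (λ x → f x y))
    ∑-swap []       ys f = sym (∑-ε ys)
    ∑-swap (x ∷ xs) ys f = trans (cong (∑ ys (f x) ∙_) (∑-swap xs ys f)) (sym (∑-∙ ys (f x) _))

    ∑-map : ∀ {ℓ ℓ′} {X : Set ℓ} {Y : Set ℓ′} (φ : X → Y) xs f → ∑ (map φ xs) f ≡ ∑ xs (f ∘ φ)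
    ∑-map φ []       f = refl
    ∑-map φ (x ∷ xs) f = cong (f (φ x) ∙_) (∑-map φ xs f)

    ∑-cartesianProduct : ∀ {X Y : Set} (xs : List X) (ys : List Y) f →
                         ∑ (cartesianProduct xs ys) f ≡ ∑ xs λ x → ∑ ys λ y → f (x , y)
    ∑-cartesianProduct []       ys f = refl
    ∑-cartesianProduct (x ∷ xs) ys f =
      trans (∑-++ (map (x ,_) ys) (cartesianProduct xs ys) f)
            (cong₂ _∙_ (∑-map (x ,_) ys f) (∑-cartesianProduct xs ys f))

  ℕ-orderedMonoid : OrderedMonoid
  ℕ-orderedMonoid = record
    { Carrier = ℕ ; _⊑_ = _≤_ ; _∙_ = _+_ ; ε = 0
    ; isCommutativeMonoid = ℕₚ.+-0-isCommutativeMonoid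
    ; ⊑-refl = ℕₚ.≤-refl ; ⊑-trans = ℕₚ.≤-trans ; ∙-mono = ℕₚ.+-mono-≤ ; ε-least = λ _ → z≤n }

  module Σℕ = OrderedMonoid ℕ-orderedMonoid

  module _ {ℓ} {X : Set ℓ} where
    open Σℕ using (∑)

    ∑-*ˡ : ∀ n (xs : List X) f → n * ∑ xs f ≡ ∑ xs (λ x → n * f x)
    ∑-*ˡ n []       f = ℕₚ.*-zeroʳ n
    ∑-*ˡ n (x ∷ xs) f = trans (ℕₚ.*-distribˡ-+ n (f x) (∑ xs f)) (cong (n * f x +_) (∑-*ˡ n xs f))

    ∑-*ʳ : ∀ n (xs : List X) f → ∑ xs f * n ≡ ∑ xs (λ x → f x * n)
    ∑-*ʳ n xs f = trans (ℕₚ.*-comm (∑ xs f) n) (trans (∑-*ˡ n xs f) (Σℕ.∑-cong xs λ x → ℕₚ.*-comm n (f x)))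

    ∑-∈ : ∀ {xs : List X} {x} f → x ∈ xs → f x ≤ ∑ xs f
    ∑-∈ f (here refl) = ℕₚ.m≤m+n _ _
    ∑-∈ f (there x∈)  = ℕₚ.≤-trans (∑-∈ f x∈) (ℕₚ.m≤n+m _ _)

    module _ (A : OrderedMonoid) where
      open OrderedMonoid A using (Carrier; _·_; ×-homo-+) renaming (∑ to ∑ᴬ; _∙_ to _∙ᴬ_)

      ∑-·ˡ : ∀ (xs : List X) f (a : Carrier) → ∑ᴬ xs (λ x → f x · a) ≡ ∑ xs f · a
      ∑-·ˡ []       f a = refl
      ∑-·ˡ (x ∷ xs) f a = trans (cong (f x · a ∙ᴬ_) (∑-·ˡ xs f a)) (sym (×-homo-+ a (f x) (∑ xs f)))

  𝟙 : Bool → ℕ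
  𝟙 b = if b then 1 else 0

  ∧-true⁻ : ∀ a {b} → (a ∧ b) ≡ true → a ≡ true × b ≡ true
  ∧-true⁻ true eq = refl , eq

-- Weighted sums over pairwise compatible subsets.

module PartitionFunctions where

  open OrderedMonoids
  open import Data.Nat using (_+_; _≤_)
  open import Data.Bool.Properties using (∧-comm; ∧-assoc; ∧-identityʳ; ∨-identityʳ)
  open import Relation.Unary using (Decidable)

  -- a ⋆ b stands for a ⊕ (z ⊗ b): it is max a (1 + b) for the sizes and a + z b for the
  -- generating functions.
  record Weight (A : OrderedMonoid) : Set₁ where
    open OrderedMonoid A
    infixl 5 _⋆_
    field
      _⋆_          : Carrier → Carrier → Carrier
      cost         : Carrier
      ⋆-mono       : ∀ {a b c d} → a ⊑ b → c ⊑ d → (a ⋆ c) ⊑ (b ⋆ d)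
      ⋆-increasing : ∀ a b → a ⊑ (a ⋆ b)
      ⋆-bound      : ∀ {a b} → b ⊑ a → (a ⋆ b) ⊑ (a ∙ cost)
      ⋆-distrib    : ∀ a b c → ((a ⋆ b) ∙ c) ≡ ((a ∙ c) ⋆ (b ∙ c))
      ⋆-medial     : ∀ a b c d → ((a ⋆ b) ⋆ (c ⋆ d)) ≡ ((a ⋆ c) ⋆ (b ⋆ d))
      ⋆-right-comm : ∀ a b c → ((a ⋆ b) ⋆ c) ≡ ((a ⋆ c) ⋆ b)

  module PartitionFunction {A : OrderedMonoid} (W : Weight A) where
    open OrderedMonoid A
    open Weight W

    -- The sum of z^|S| over the pairwise compatible sublists S of xs whose members satisfy P.
    Z : ∀ {X : Set} → (X → X → Bool) → (X → Bool) → List X → Carrier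
    Z _∥_ P []       = ε
    Z _∥_ P (x ∷ xs) = if P x then Z _∥_ P xs ⋆ Z _∥_ (λ y → P y ∧ (x ∥ y)) xs else Z _∥_ P xs

    module _ {X : Set} (_∥_ : X → X → Bool) where

      Z-cong : ∀ xs {P Q : X → Bool} → (∀ {x} → x ∈ xs → P x ≡ Q x) → Z _∥_ P xs ≡ Z _∥_ Q xs
      Z-cong []       P≡Q = refl
      Z-cong (x ∷ xs) {P} {Q} P≡Q rewrite P≡Q (here refl) with Q x
      ... | true  = cong₂ _⋆_ (Z-cong xs (P≡Q ∘ there)) (Z-cong xs λ {y} y∈ → cong (_∧ (x ∥ y)) (P≡Q (there y∈)))
      ... | false = Z-cong xs (P≡Q ∘ there)

      Z-mono : ∀ xs {P Q : X → Bool} → (∀ {x} → x ∈ xs → P x ≡ true → Q x ≡ true) → Z _∥_ P xs ⊑ Z _∥_ Q xs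
      Z-mono []       P⊆Q = ⊑-refl
      Z-mono (x ∷ xs) {P} {Q} P⊆Q with P x in Px | Q x in Qx
      ... | true  | true  = ⋆-mono (Z-mono xs (P⊆Q ∘ there)) (Z-mono xs restricted)
        where
        restricted : ∀ {y} → y ∈ xs → (P y ∧ (x ∥ y)) ≡ true → (Q y ∧ (x ∥ y)) ≡ true
        restricted {y} y∈ eq with P y in Py
        ... | true rewrite P⊆Q (there y∈) Py = eq
      ... | true  | false with () ← trans (sym Qx) (P⊆Q (here refl) Px)
      ... | false | true  = ⊑-trans (Z-mono xs (P⊆Q ∘ there)) (⋆-increasing _ _)
      ... | false | false = Z-mono xs (P⊆Q ∘ there)

      Z-restrict : ∀ xs P (Q : X → Bool) → Z _∥_ (λ x → P x ∧ Q x) xs ⊑ Z _∥_ P xs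
      Z-restrict xs P Q = Z-mono xs λ {x} _ → proj₁ ∘ ∧-true⁻ (P x)

      Z-∅ : ∀ xs {P : X → Bool} → (∀ {x} → x ∈ xs → P x ≡ false) → Z _∥_ P xs ≡ ε
      Z-∅ []       P≡∅ = refl
      Z-∅ (x ∷ xs) P≡∅ rewrite P≡∅ (here refl) = Z-∅ xs (P≡∅ ∘ there)

      excess : (P Q : X → Bool) → List X → ℕ
      excess P Q xs = Σℕ.∑ xs λ x → 𝟙 (Q x ∧ not (P x))

      -- The branch that chooses `x` is never larger than the one that skips it (`Z-restrict`), so
      -- by `⋆-bound` each element allowed by `Q` alone costs one `cost`. For an element allowed by
      -- both, the two branches carry a common error, which `⋆-distrib` factors out.
      Z-lipschitz : ∀ xs P Q → Z _∥_ Q xs ⊑ Z _∥_ P xs ∙ excess P Q xs · cost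
      Z-lipschitz []       P Q = ⊑-∙ʳ _ _
      Z-lipschitz (x ∷ xs) P Q with P x | Q x
      ... | true  | true  = begin
          Z _∥_ Q xs ⋆ Z _∥_ Q′ xs
            ≲⟨ ⋆-mono (Z-lipschitz xs P Q)
                      (⊑-trans (Z-lipschitz xs P′ Q′)
                        (∙-mono ⊑-refl (·-monoˡ cost (Σℕ.∑-mono xs λ y → shrink (P y) (Q y) (x ∥ y))))) ⟩
          (Z _∥_ P xs ∙ k) ⋆ (Z _∥_ P′ xs ∙ k) ≡⟨ sym (⋆-distrib _ _ _) ⟩
          (Z _∥_ P xs ⋆ Z _∥_ P′ xs) ∙ k ∎
        where
        open ⊑-Reasoning
        P′ Q′ : X → Bool
        P′ y = P y ∧ (x ∥ y)
        Q′ y = Q y ∧ (x ∥ y)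
        k = excess P Q xs · cost
        shrink : ∀ a b c → 𝟙 ((b ∧ c) ∧ not (a ∧ c)) ≤ 𝟙 (b ∧ not a)
        shrink a b true rewrite ∧-identityʳ a | ∧-identityʳ b = ℕₚ.≤-refl
        shrink a true  false = z≤n
        shrink a false false = z≤n
      ... | true  | false = ⊑-trans (Z-lipschitz xs P Q) (∙-mono (⋆-increasing _ _) ⊑-refl)
      ... | false | true  = begin
          Z _∥_ Q xs ⋆ _ ≲⟨ ⋆-bound (Z-restrict xs Q _) ⟩
          Z _∥_ Q xs ∙ cost ≲⟨ ∙-mono (Z-lipschitz xs P Q) ⊑-refl ⟩
          Z _∥_ P xs ∙ k ∙ cost ≡⟨ assoc _ _ _ ⟩
          Z _∥_ P xs ∙ (k ∙ cost) ≡⟨ cong (Z _∥_ P xs ∙_) (comm _ _) ⟩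
          Z _∥_ P xs ∙ (cost ∙ k) ∎
        where
        open ⊑-Reasoning
        k = excess P Q xs · cost
      ... | false | false = Z-lipschitz xs P Q

      -- Choosing `x` from one side restricts that side only, since all elements of the other are
      -- compatible with it. The factor of the other side is therefore the same in both branches and
      -- comes out by `⋆-distrib`.
      Z-∪ : ∀ xs {P Q : X → Bool} →
            (∀ {x} → x ∈ xs → P x ≡ true → Q x ≡ false) →
            (∀ {x y} → x ∈ xs → y ∈ xs → P x ≡ true → Q y ≡ true → (x ∥ y) ≡ true × (y ∥ x) ≡ true) →
            Z _∥_ (λ x → P x ∨ Q x) xs ≡ Z _∥_ P xs ∙ Z _∥_ Q xs
      Z-∪ []       disjoint compatible = sym (identityˡ ε)
      Z-∪ (x ∷ xs) {P} {Q} disjoint compatible with P x in Px | Q x in Qx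
      ... | true  | true  with () ← trans (sym Qx) (disjoint (here refl) Px)
      ... | true  | false = begin
          Z _∥_ (λ y → P y ∨ Q y) xs ⋆ Z _∥_ (λ y → (P y ∨ Q y) ∧ (x ∥ y)) xs
            ≡⟨ cong₂ _⋆_ (Z-∪ xs (disjoint ∘ there) (λ u v → compatible (there u) (there v)))
                         (trans (Z-cong xs absorb) (Z-∪ xs disjoint′ compatible′)) ⟩
          (Z _∥_ P xs ∙ Z _∥_ Q xs) ⋆ (Z _∥_ P′ xs ∙ Z _∥_ Q xs)
            ≡⟨ ⋆-distrib _ _ _ ⟨
          (Z _∥_ P xs ⋆ Z _∥_ P′ xs) ∙ Z _∥_ Q xs ∎
        where
        open ≡-Reasoning
        P′ : X → Bool
        P′ y = P y ∧ (x ∥ y)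
        absorb : ∀ {y} → y ∈ xs → ((P y ∨ Q y) ∧ (x ∥ y)) ≡ (P′ y ∨ Q y)
        absorb {y} y∈ with P y | Q y in Qy
        ... | true  | true  rewrite proj₁ (compatible (here refl) (there y∈) Px Qy) = refl
        ... | true  | false = sym (∨-identityʳ _)
        ... | false | true  = proj₁ (compatible (here refl) (there y∈) Px Qy)
        ... | false | false = refl
        P′⊆P : ∀ {y} → P′ y ≡ true → P y ≡ true
        P′⊆P {y} eq with P y
        ... | true = refl
        disjoint′ : ∀ {y} → y ∈ xs → P′ y ≡ true → Q y ≡ false
        disjoint′ y∈ eq = disjoint (there y∈) (P′⊆P eq)
        compatible′ : ∀ {u v} → u ∈ xs → v ∈ xs → P′ u ≡ true → Q v ≡ true → (u ∥ v) ≡ true × (v ∥ u) ≡ true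
        compatible′ u∈ v∈ eq = compatible (there u∈) (there v∈) (P′⊆P eq)
      ... | false | true  = begin
          Z _∥_ (λ y → P y ∨ Q y) xs ⋆ Z _∥_ (λ y → (P y ∨ Q y) ∧ (x ∥ y)) xs
            ≡⟨ cong₂ _⋆_ (Z-∪ xs (disjoint ∘ there) (λ u v → compatible (there u) (there v)))
                         (trans (Z-cong xs absorb) (Z-∪ xs disjoint′ compatible′)) ⟩
          (Z _∥_ P xs ∙ Z _∥_ Q xs) ⋆ (Z _∥_ P xs ∙ Z _∥_ Q′ xs)
            ≡⟨ cong₂ _⋆_ (comm _ _) (comm _ _) ⟩
          (Z _∥_ Q xs ∙ Z _∥_ P xs) ⋆ (Z _∥_ Q′ xs ∙ Z _∥_ P xs)
            ≡⟨ ⋆-distrib _ _ _ ⟨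
          (Z _∥_ Q xs ⋆ Z _∥_ Q′ xs) ∙ Z _∥_ P xs
            ≡⟨ comm _ _ ⟩
          Z _∥_ P xs ∙ (Z _∥_ Q xs ⋆ Z _∥_ Q′ xs) ∎
        where
        open ≡-Reasoning
        Q′ : X → Bool
        Q′ y = Q y ∧ (x ∥ y)
        absorb : ∀ {y} → y ∈ xs → ((P y ∨ Q y) ∧ (x ∥ y)) ≡ (P y ∨ Q′ y)
        absorb {y} y∈ with P y in Py
        ... | true  = proj₂ (compatible (there y∈) (here refl) Py Qx)
        ... | false = refl
        Q′⊆Q : ∀ {y} → Q′ y ≡ true → Q y ≡ true
        Q′⊆Q {y} eq with Q y
        ... | true = refl
        disjoint′ : ∀ {y} → y ∈ xs → P y ≡ true → Q′ y ≡ false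
        disjoint′ y∈ Py rewrite disjoint (there y∈) Py = refl
        compatible′ : ∀ {u v} → u ∈ xs → v ∈ xs → P u ≡ true → Q′ v ≡ true → (u ∥ v) ≡ true × (v ∥ u) ≡ true
        compatible′ u∈ v∈ Pu eq = compatible (there u∈) (there v∈) Pu (Q′⊆Q eq)
      ... | false | false = Z-∪ xs (disjoint ∘ there) (λ u v → compatible (there u) (there v))

      Z-filter : ∀ {ℓ} {p : Pred X ℓ} (p? : Decidable p) xs {P : X → Bool} →
                 (∀ {x} → x ∈ xs → P x ≡ true → p x) → Z _∥_ P xs ≡ Z _∥_ P (filter p? xs)
      Z-filter p? []       P⇒p = refl
      Z-filter p? (x ∷ xs) {P} P⇒p with P x in Px | p? x
      ... | true  | yes _ rewrite Px =
        cong₂ _⋆_ (Z-filter p? xs (P⇒p ∘ there)) (Z-filter p? xs λ y∈ → P⇒p (there y∈) ∘ proj₁ ∘ ∧-true⁻ _)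
      ... | true  | no ¬p with () ← ¬p (P⇒p (here refl) Px)
      ... | false | yes _ rewrite Px = Z-filter p? xs (P⇒p ∘ there)
      ... | false | no  _ = Z-filter p? xs (P⇒p ∘ there)

      module _ (∥-sym : ∀ x y → (x ∥ y) ≡ (y ∥ x)) where

        -- The point is a transposition of two allowed elements. If they are compatible there are
        -- four branches, rearranged by `⋆-medial`; otherwise the branch choosing both is missing
        -- and `⋆-right-comm` exchanges the remaining two choices.
        Z-↭ : ∀ {xs ys} → xs ↭ ys → ∀ P → Z _∥_ P xs ≡ Z _∥_ P ys
        Z-↭ Perm.refl         P = refl
        Z-↭ (Perm.trans p q)  P = trans (Z-↭ p P) (Z-↭ q P)
        Z-↭ (Perm.prep x p)   P with P x
        ... | true  = cong₂ _⋆_ (Z-↭ p P) (Z-↭ p _)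
        ... | false = Z-↭ p P
        Z-↭ (Perm.swap {xs} {ys} x y p) P rewrite ∥-sym y x with P x | P y
        ... | false | false = Z-↭ p P
        ... | true  | false = cong₂ _⋆_ (Z-↭ p P) (Z-↭ p _)
        ... | false | true  = cong₂ _⋆_ (Z-↭ p P) (Z-↭ p _)
        ... | true  | true  with x ∥ y
        ...   | false = trans (⋆-right-comm _ _ _) (cong₂ _⋆_ (cong₂ _⋆_ (Z-↭ p P) (Z-↭ p _)) (Z-↭ p _))
        ...   | true  = trans (⋆-medial _ _ _ _)
          (cong₂ _⋆_ (cong₂ _⋆_ (Z-↭ p P) (Z-↭ p _))
                     (cong₂ _⋆_ (Z-↭ p _) (trans (Z-↭ p _) (Z-cong ys λ {z} _ → exchange (P z) (x ∥ z) (y ∥ z)))))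
          where
          exchange : ∀ a b c → ((a ∧ b) ∧ c) ≡ ((a ∧ c) ∧ b)
          exchange a b c = trans (∧-assoc a b c) (trans (cong (a ∧_) (∧-comm b c)) (sym (∧-assoc a c b)))

    Z-map : ∀ {X Y : Set} (_∥ˣ_ : X → X → Bool) (_∥ʸ_ : Y → Y → Bool) (φ : X → Y) xs {P Q} →
            (∀ {x} → x ∈ xs → P x ≡ Q (φ x)) →
            (∀ {x y} → x ∈ xs → y ∈ xs → (x ∥ˣ y) ≡ (φ x ∥ʸ φ y)) →
            Z _∥ˣ_ P xs ≡ Z _∥ʸ_ Q (map φ xs)
    Z-map _∥ˣ_ _∥ʸ_ φ []       P≡Q same = refl
    Z-map _∥ˣ_ _∥ʸ_ φ (x ∷ xs) {P} {Q} P≡Q same rewrite P≡Q (here refl) with Q (φ x)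
    ... | true  = cong₂ _⋆_ (Z-map _∥ˣ_ _∥ʸ_ φ xs (P≡Q ∘ there) (λ u v → same (there u) (there v)))
                            (Z-map _∥ˣ_ _∥ʸ_ φ xs (λ y∈ → cong₂ _∧_ (P≡Q (there y∈)) (same (here refl) (there y∈)))
                                                  (λ u v → same (there u) (there v)))
    ... | false = Z-map _∥ˣ_ _∥ʸ_ φ xs (P≡Q ∘ there) (λ u v → same (there u) (there v))

-- Independent sets and matchings as set functions on the vertices of a finite graph.

module GraphParameters where

  open OrderedMonoids
  open PartitionFunctions
  open import Data.Nat using (_+_; _*_; _≤_)
  open import Data.List.Membership.Propositional.Properties using (∈-map⁺; ∈-cartesianProduct⁺)
  open import Data.List.Membership.Propositional.Properties.WithK using (unique∧set⇒bag)
  open import Data.List.Relation.Binary.BagAndSetEquality using (∼bag⇒↭)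
  open import Data.List.Relation.Binary.Permutation.Propositional.Properties using (↭-length)
  open import Function.Base using (case_of_)
  open import Relation.Unary using (Decidable)

  open Σℕ using (∑)

  from-does : ∀ {ℓ} {P : Set ℓ} (P? : Dec P) → does P? ≡ true → P
  from-does (yes p) _ = p

  from-¬does : ∀ {ℓ} {P : Set ℓ} (P? : Dec P) → does P? ≡ false → ¬ P
  from-¬does (no ¬p) _ = ¬p

  module _ {X : Set} where

    unique-↭ : ∀ {xs ys : List X} → Unique xs → Unique ys → (∀ {x} → (x ∈ xs) ⇔ (x ∈ ys)) → xs ↭ ys
    unique-↭ xs! ys! same = ∼bag⇒↭ (unique∧set⇒bag xs! ys! same)

    ∑-filter : ∀ {ℓ} {P : Pred X ℓ} (P? : Decidable P) xs f →
               ∑ (filter P? xs) f ≡ ∑ xs λ x → if does (P? x) then f x else 0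
    ∑-filter P? []       f = refl
    ∑-filter P? (x ∷ xs) f with does (P? x)
    ... | true  = cong (f x +_) (∑-filter P? xs f)
    ... | false = ∑-filter P? xs f

    length-∑ : ∀ (xs : List X) → length xs ≡ ∑ xs λ _ → 1
    length-∑ []       = refl
    length-∑ (x ∷ xs) = cong suc (length-∑ xs)

  Subset : ℕ → Set
  Subset n = Fin n → Bool

  ‖_‖ : ∀ {n} → Subset n → ℕ
  ‖ χ ‖ = ∑ (allFin _) (𝟙 ∘ χ)

  _∖_ : ∀ {n} → Subset n → Subset n → Subset n
  (χ ∖ χ′) v = χ v ∧ not (χ′ v)

  module _ {n : ℕ} {P : Pred (Fin n) 0ℓ} (P? : Decidable P) where

    -- Turns relational cardinalities into sums of indicators: duplicate-free lists with the same
    -- members are permutations of each other.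
    cardinality-unique : ∀ {m} → HasCardinality P m → m ≡ ‖ does ∘ P? ‖
    cardinality-unique (xs , xs! , xs⇔P , refl) = begin
      length xs ≡⟨ ↭-length xs↭ ⟩
      length (filter P? (allFin n)) ≡⟨ length-∑ (filter P? (allFin n)) ⟩
      (∑ (filter P? (allFin n)) λ _ → 1) ≡⟨ ∑-filter P? (allFin n) (λ _ → 1) ⟩
      ‖ does ∘ P? ‖ ∎
      where
      open ≡-Reasoning
      xs↭ : xs ↭ filter P? (allFin n)
      xs↭ = unique-↭ xs! (Uniqueₚ.filter⁺ P? (Uniqueₚ.allFin⁺ n))
        (mk⇔ (λ x∈ → ∈-filter⁺ P? (∈-allFin _) (Equivalence.to (xs⇔P _) x∈))
             (λ x∈ → Equivalence.from (xs⇔P _) (proj₂ (∈-filter⁻ P? {xs = allFin n} x∈))))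

    filter-cardinality : HasCardinality P ‖ does ∘ P? ‖
    filter-cardinality =
      filter P? (allFin n) , Uniqueₚ.filter⁺ P? (Uniqueₚ.allFin⁺ n) ,
      (λ x → mk⇔ (λ x∈ → proj₂ (∈-filter⁻ P? {xs = allFin n} x∈)) (∈-filter⁺ P? (∈-allFin x))) ,
      trans (length-∑ (filter P? (allFin n))) (∑-filter P? (allFin n) (λ _ → 1))

  module _ {m n : ℕ} {to : Fin m → Fin n} (to-injective : Injective _≡_ _≡_ to) where

    image? : Decidable λ v → ∃ λ a → to a ≡ v
    image? v = Finₚ.any? λ a → to a Fin.≟ v

    image-↭ : filter image? (allFin n) ↭ map to (allFin m)
    image-↭ = unique-↭ (Uniqueₚ.filter⁺ image? (Uniqueₚ.allFin⁺ n))
                       (Uniqueₚ.map⁺ to-injective (Uniqueₚ.allFin⁺ m))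
      (mk⇔ (λ v∈ → case proj₂ (∈-filter⁻ image? {xs = allFin n} v∈) of λ where
                     (a , refl) → ∈-map⁺ to (∈-allFin a))
           (λ v∈ → case ∈-map⁻ to {xs = allFin m} v∈ of λ where
                     (a , _ , refl) → ∈-filter⁺ image? (∈-allFin _) (a , refl)))

    ∑-reindex : ∀ {f : Fin n → ℕ} → (∀ v → ¬ (∃ λ a → to a ≡ v) → f v ≡ 0) →
                ∑ (allFin n) f ≡ ∑ (allFin m) (f ∘ to)
    ∑-reindex {f} vanish = begin
      ∑ (allFin n) f ≡⟨ Σℕ.∑-cong (allFin n) restrict ⟩
      ∑ (allFin n) (λ v → if does (image? v) then f v else 0) ≡⟨ ∑-filter image? (allFin n) f ⟨
      ∑ (filter image? (allFin n)) f ≡⟨ Σℕ.∑-↭ f image-↭ ⟩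
      ∑ (map to (allFin m)) f ≡⟨ Σℕ.∑-map to (allFin m) f ⟩
      ∑ (allFin m) (f ∘ to) ∎
      where
      open ≡-Reasoning
      restrict : ∀ v → f v ≡ (if does (image? v) then f v else 0)
      restrict v with image? v
      ... | yes _     = refl
      ... | no  v∉    = vanish v v∉

    ∑-injective : ∀ f → ∑ (allFin m) (f ∘ to) ≤ ∑ (allFin n) f
    ∑-injective f = begin
      ∑ (allFin m) (f ∘ to) ≡⟨ Σℕ.∑-cong (allFin m) (λ a → cong (λ b → if b then f (to a) else 0)
                                         (sym (dec-true (image? (to a)) (a , refl)))) ⟩
      ∑ (allFin m) (g ∘ to) ≡⟨ ∑-reindex (λ v v∉ → cong (λ b → if b then f v else 0) (dec-false (image? v) v∉)) ⟨
      ∑ (allFin n) g ≤⟨ Σℕ.∑-mono (allFin n) restricted ⟩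
      ∑ (allFin n) f ∎
      where
      open ℕₚ.≤-Reasoning
      g : Fin n → ℕ
      g v = if does (image? v) then f v else 0
      restricted : ∀ v → g v ≤ f v
      restricted v with does (image? v)
      ... | true  = ℕₚ.≤-refl
      ... | false = z≤n

  record Embedding (K H : FiniteGraph) : Set where
    field
      to        : Vertex K → Vertex H
      injective : Injective _≡_ _≡_ to
      adjacent  : ∀ a b → FiniteGraph._~_ K a b ⇔ FiniteGraph._~_ H (to a) (to b)

  -- The properties of `h` that the comparison relies on. In `lipschitz` the sets are arbitrary, so
  -- it bounds the effect of adding and of removing vertices alike; the degree bound enters there
  -- through matchings, where a new vertex brings up to `d` new edges. By `restriction` the value
  -- can be computed inside any induced subgraph that contains the set, which is what makes it
  -- visible in a patch.
  record GraphParameter (A : OrderedMonoid) (d : ℕ) : Set₁ where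
    open OrderedMonoid A
    field
      value       : (H : FiniteGraph) → (Vertex H → Bool) → Carrier
      unit        : Carrier
      monotone    : ∀ H {χ χ′} → (∀ v → χ v ≡ true → χ′ v ≡ true) → value H χ ⊑ value H χ′
      extensional : ∀ H {χ χ′} → (∀ v → χ v ≡ χ′ v) → value H χ ≡ value H χ′
      empty       : ∀ H {χ} → (∀ v → χ v ≡ false) → value H χ ≡ ε
      lipschitz   : ∀ H → MaxDegree≤ (graph H) d → ∀ χ χ′ → value H χ′ ⊑ value H χ ∙ ‖ χ′ ∖ χ ‖ · unit
      additive    : ∀ H {χ χ′} →
                    (∀ u v → χ u ≡ true → χ′ v ≡ true → u ≢ v × ¬ FiniteGraph._~_ H u v) →
                    value H (λ v → χ v ∨ χ′ v) ≡ value H χ ∙ value H χ′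
      restriction : ∀ {K H} (e : Embedding K H) {χ} →
                    (∀ v → χ v ≡ true → ∃ λ a → Embedding.to e a ≡ v) →
                    value H χ ≡ value K (χ ∘ Embedding.to e)

  nonAdjacent : (H : FiniteGraph) → Vertex H → Vertex H → Bool
  nonAdjacent H i j = not (does (FiniteGraph._~?_ H i j))

  nonAdjacent-sym : ∀ H i j → nonAdjacent H i j ≡ nonAdjacent H j i
  nonAdjacent-sym H i j = cong not (does-⇔ (mk⇔ symm symm) (i ~? j) (j ~? i))
    where open FiniteGraph H

  disjoint : (H : FiniteGraph) → Vertex H × Vertex H → Vertex H × Vertex H → Bool
  disjoint H e e′ = does (disjoint? H e e′)

  disjoint-sym : ∀ H e e′ → disjoint H e e′ ≡ disjoint H e′ e
  disjoint-sym H e e′ = does-⇔ (mk⇔ (swap e e′) (swap e′ e)) (disjoint? H e e′) (disjoint? H e′ e)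
    where
    swap : ∀ e e′ → Disjoint H e e′ → Disjoint H e′ e
    swap _ _ ((p , q) , (r , s)) = (p ∘ sym , r ∘ sym) , (q ∘ sym , s ∘ sym)

  within : ∀ {n} → Subset n → Fin n × Fin n → Bool
  within χ (i , j) = χ i ∧ χ j

  edge⁻ : ∀ H {i j} → (i , j) ∈ edgeList H → i Fin.< j × FiniteGraph._~_ H i j
  edge⁻ H e∈ = proj₂ (∈-filter⁻ _ {xs = cartesianProduct (allFin (order H)) (allFin (order H))} e∈)

  edge⁺ : ∀ H {i j} → i Fin.< j → FiniteGraph._~_ H i j → (i , j) ∈ edgeList H
  edge⁺ H i<j i~j = ∈-filter⁺ _ (∈-cartesianProduct⁺ (∈-allFin _) (∈-allFin _)) (i<j , i~j)

  edgeList! : ∀ H → Unique (edgeList H)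
  edgeList! H = Uniqueₚ.filter⁺ _ (Uniqueₚ.cartesianProduct⁺ (Uniqueₚ.allFin⁺ _) (Uniqueₚ.allFin⁺ _))

  -- Double counting. Exchanging the summations in the second half charges both halves to `i`. An
  -- edge is listed only with its smaller endpoint first, so for each `j` at most one of `(i , j)`
  -- and `(j , i)` is charged, and `i` is charged no more often than its degree.
  incidence-bound : ∀ {d} H → MaxDegree≤ (graph H) d → (f : Vertex H → ℕ) →
                    (∑ (edgeList H) λ (i , j) → f i + f j) ≤ ∑ (allFin (order H)) f * d
  incidence-bound {d} H degree f = begin
    ∑ (edgeList H) g
      ≡⟨ ∑-filter edge? (cartesianProduct V V) g ⟩
    (∑ (cartesianProduct V V) λ e → if does (edge? e) then g e else 0)
      ≡⟨ Σℕ.∑-cartesianProduct V V _ ⟩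
    (∑ V λ i → ∑ V λ j → if does (edge? (i , j)) then f i + f j else 0)
      ≡⟨ Σℕ.∑-cong V (λ i → Σℕ.∑-cong V λ j → split (does (edge? (i , j))) (f i) (f j)) ⟩
    (∑ V λ i → ∑ V λ j → 𝟙 (does (edge? (i , j))) * f i + 𝟙 (does (edge? (i , j))) * f j)
      ≡⟨ Σℕ.∑-cong V (λ i → Σℕ.∑-∙ V _ _) ⟩
    (∑ V λ i → (∑ V λ j → 𝟙 (does (edge? (i , j))) * f i) + ∑ V λ j → 𝟙 (does (edge? (i , j))) * f j)
      ≡⟨ Σℕ.∑-∙ V _ _ ⟩
    (∑ V λ i → ∑ V λ j → 𝟙 (does (edge? (i , j))) * f i) + (∑ V λ i → ∑ V λ j → 𝟙 (does (edge? (i , j))) * f j)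
      ≡⟨ cong ((∑ V λ i → ∑ V λ j → 𝟙 (does (edge? (i , j))) * f i) +_) (Σℕ.∑-swap V V _) ⟩
    (∑ V λ i → ∑ V λ j → 𝟙 (does (edge? (i , j))) * f i) + (∑ V λ i → ∑ V λ j → 𝟙 (does (edge? (j , i))) * f i)
      ≡⟨ Σℕ.∑-∙ V _ _ ⟨
    (∑ V λ i → (∑ V λ j → 𝟙 (does (edge? (i , j))) * f i) + ∑ V λ j → 𝟙 (does (edge? (j , i))) * f i)
      ≡⟨ Σℕ.∑-cong V (λ i → Σℕ.∑-∙ V _ _) ⟨
    (∑ V λ i → ∑ V λ j → 𝟙 (does (edge? (i , j))) * f i + 𝟙 (does (edge? (j , i))) * f i)
      ≤⟨ Σℕ.∑-mono V (λ i → Σℕ.∑-mono V λ j → both i j) ⟩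
    (∑ V λ i → ∑ V λ j → 𝟙 (does (i ~? j)) * f i)
      ≡⟨ Σℕ.∑-cong V (λ i → ∑-*ʳ (f i) V _) ⟨
    (∑ V λ i → ‖ (λ j → does (i ~? j)) ‖ * f i)
      ≤⟨ Σℕ.∑-mono V (λ i → ℕₚ.*-monoˡ-≤ (f i) (degree′ i)) ⟩
    (∑ V λ i → d * f i)
      ≡⟨ ∑-*ˡ d V f ⟨
    d * ∑ V f
      ≡⟨ ℕₚ.*-comm d _ ⟩
    ∑ V f * d ∎
    where
    open ℕₚ.≤-Reasoning
    open FiniteGraph H using (_~_; _~?_; symm)
    V = allFin (order H)
    g : Vertex H × Vertex H → ℕ
    g (i , j) = f i + f j
    edge? : Decidable λ (i , j) → i Fin.< j × i ~ j
    edge? (i , j) = (i Fin.<? j) ×-dec (i ~? j)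
    split : ∀ b m n → (if b then m + n else 0) ≡ 𝟙 b * m + 𝟙 b * n
    split true  m n = sym (cong₂ _+_ (ℕₚ.*-identityˡ m) (ℕₚ.*-identityˡ n))
    split false m n = refl
    atMostOne : ∀ i j → 𝟙 (does (edge? (i , j))) + 𝟙 (does (edge? (j , i))) ≤ 𝟙 (does (i ~? j))
    atMostOne i j = bound (i Fin.<? j) (j Fin.<? i) (i ~? j) (j ~? i)
      where
      bound : (p? : Dec (i Fin.< j)) (q? : Dec (j Fin.< i)) (r? : Dec (i ~ j)) (s? : Dec (j ~ i)) →
              𝟙 (does (p? ×-dec r?)) + 𝟙 (does (q? ×-dec s?)) ≤ 𝟙 (does r?)
      bound (yes i<j) (yes j<i) _         _         = contradiction j<i (Finₚ.<-asym i<j)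
      bound (yes _)   (no _)    (yes _)   _         = ℕₚ.≤-refl
      bound (yes _)   (no _)    (no _)    _         = ℕₚ.≤-refl
      bound (no _)    (yes _)   (yes _)   (yes _)   = ℕₚ.≤-refl
      bound (no _)    (yes _)   (no i≁j)  (yes j~i) = contradiction (symm j~i) i≁j
      bound (no _)    (yes _)   _         (no _)    = z≤n
      bound (no _)    (no _)    _         _         = z≤n
    both : ∀ i j → 𝟙 (does (edge? (i , j))) * f i + 𝟙 (does (edge? (j , i))) * f i ≤ 𝟙 (does (i ~? j)) * f i
    both i j = ℕₚ.≤-trans
      (ℕₚ.≤-reflexive (sym (ℕₚ.*-distribʳ-+ (f i) (𝟙 (does (edge? (i , j)))) (𝟙 (does (edge? (j , i)))))))
      (ℕₚ.*-monoˡ-≤ (f i) (atMostOne i j))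
    degree′ : ∀ i → ‖ (λ j → does (i ~? j)) ‖ ≤ d
    degree′ i with m , card , m≤d ← degree i = subst (_≤ d) (cardinality-unique (i ~?_) card) m≤d

  -- Embeddings need not respect the numbering of the vertices, whereas `edgeList` has the smaller
  -- endpoint first; images of edges have to be turned accordingly.
  orient : ∀ {n} → Fin n × Fin n → Fin n × Fin n
  orient (u , v) = if does (u Fin.<? v) then (u , v) else (v , u)

  module _ {A : OrderedMonoid} (W : Weight A) where
    open OrderedMonoid A using (_⊑_; _∙_; ε; _·_; ⊑-refl; ⊑-trans; ∙-mono; ·-monoˡ; ×-assocˡ)
    open Weight W using (cost)
    open PartitionFunction W

    independence : ∀ d → GraphParameter A d
    independence d = record
      { value       = λ H χ → Z (nonAdjacent H) χ (allFin (order H))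
      ; unit        = cost
      ; monotone    = λ H χ⊆χ′ → Z-mono (nonAdjacent H) (allFin (order H)) λ {v} _ → χ⊆χ′ v
      ; extensional = λ H χ≡χ′ → Z-cong (nonAdjacent H) (allFin (order H)) λ {v} _ → χ≡χ′ v
      ; empty       = λ H χ≡∅ → Z-∅ (nonAdjacent H) (allFin (order H)) λ {v} _ → χ≡∅ v
      ; lipschitz   = λ H _ χ χ′ → Z-lipschitz (nonAdjacent H) (allFin (order H)) χ χ′
      ; additive    = additive
      ; restriction = restriction
      }
      where
      additive : ∀ H {χ χ′ : Vertex H → Bool} →
                 (∀ u v → χ u ≡ true → χ′ v ≡ true → u ≢ v × ¬ FiniteGraph._~_ H u v) →
                 Z (nonAdjacent H) (λ v → χ v ∨ χ′ v) (allFin (order H)) ≡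
                 Z (nonAdjacent H) χ (allFin (order H)) ∙ Z (nonAdjacent H) χ′ (allFin (order H))
      additive H {χ} {χ′} sep = Z-∪ (nonAdjacent H) (allFin (order H))
        (λ {v} _ χv → Boolₚ.¬-not λ χ′v → proj₁ (sep v v χv χ′v) refl)
        (λ {u} {v} _ _ χu χ′v →
          let u≁v = cong not (dec-false (FiniteGraph._~?_ H u v) (proj₂ (sep u v χu χ′v)))
          in u≁v , trans (nonAdjacent-sym H v u) u≁v)

      restriction : ∀ {K H} (e : Embedding K H) {χ} →
                    (∀ v → χ v ≡ true → ∃ λ a → Embedding.to e a ≡ v) →
                    Z (nonAdjacent H) χ (allFin (order H)) ≡
                    Z (nonAdjacent K) (χ ∘ Embedding.to e) (allFin (order K))
      restriction {K} {H} e {χ} supported = begin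
        Z (nonAdjacent H) χ (allFin (order H))
          ≡⟨ Z-filter (nonAdjacent H) (image? injective) (allFin (order H)) (λ {v} _ → supported v) ⟩
        Z (nonAdjacent H) χ (filter (image? injective) (allFin (order H)))
          ≡⟨ Z-↭ (nonAdjacent H) (nonAdjacent-sym H) (image-↭ injective) χ ⟩
        Z (nonAdjacent H) χ (map to (allFin (order K)))
          ≡⟨ Z-map (nonAdjacent K) (nonAdjacent H) to (allFin (order K)) (λ _ → refl)
                   (λ {a} {b} _ _ → cong not (does-⇔ (adjacent a b) (FiniteGraph._~?_ K a b) (FiniteGraph._~?_ H (to a) (to b)))) ⟨
        Z (nonAdjacent K) (χ ∘ to) (allFin (order K)) ∎
        where
        open ≡-Reasoning
        open Embedding e

    matching : ∀ d → GraphParameter A d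
    matching d = record
      { value       = λ H χ → Z (disjoint H) (within χ) (edgeList H)
      -- One vertex is incident to at most `d` edges, each worth one `cost`.
      ; unit        = d · cost
      ; monotone    = λ H χ⊆χ′ → Z-mono (disjoint H) (edgeList H) λ {(i , j)} _ → within-⊆ χ⊆χ′ i j
      ; extensional = λ H χ≡χ′ → Z-cong (disjoint H) (edgeList H) λ {(i , j)} _ → cong₂ _∧_ (χ≡χ′ i) (χ≡χ′ j)
      ; empty       = λ H {χ} χ≡∅ → Z-∅ (disjoint H) (edgeList H) λ {(i , j)} _ → cong (_∧ χ j) (χ≡∅ i)
      ; lipschitz   = lipschitz
      ; additive    = additive
      ; restriction = restriction
      }
      where
      within-⊆ : ∀ {n} {χ χ′ : Subset n} → (∀ v → χ v ≡ true → χ′ v ≡ true) →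
                 ∀ i j → within χ (i , j) ≡ true → within χ′ (i , j) ≡ true
      within-⊆ χ⊆χ′ i j eq with χi , χj ← ∧-true⁻ _ eq = cong₂ _∧_ (χ⊆χ′ i χi) (χ⊆χ′ j χj)

      lipschitz : ∀ H → MaxDegree≤ (graph H) d → ∀ χ χ′ →
                  Z (disjoint H) (within χ′) (edgeList H) ⊑
                  Z (disjoint H) (within χ) (edgeList H) ∙ ‖ χ′ ∖ χ ‖ · d · cost
      lipschitz H degree χ χ′ =
        ⊑-trans (Z-lipschitz (disjoint H) (edgeList H) (within χ) (within χ′))
        (∙-mono ⊑-refl (subst (excess (disjoint H) (within χ) (within χ′) (edgeList H) · cost ⊑_)
                              (sym (×-assocˡ cost ‖ χ′ ∖ χ ‖ d))
          (·-monoˡ cost (ℕₚ.≤-trans (Σℕ.∑-mono (edgeList H) λ (i , j) → endpoint (χ i) (χ j) (χ′ i) (χ′ j))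
                                    (incidence-bound H degree (𝟙 ∘ (χ′ ∖ χ)))))))
        where
        endpoint : ∀ a b a′ b′ → 𝟙 ((a′ ∧ b′) ∧ not (a ∧ b)) ≤ 𝟙 (a′ ∧ not a) + 𝟙 (b′ ∧ not b)
        endpoint a     b     false b′    = z≤n
        endpoint a     b     true  false = z≤n
        endpoint false b     true  true  = s≤s z≤n
        endpoint true  false true  true  = s≤s z≤n
        endpoint true  true  true  true  = z≤n

      additive : ∀ H {χ χ′ : Vertex H → Bool} →
                 (∀ u v → χ u ≡ true → χ′ v ≡ true → u ≢ v × ¬ FiniteGraph._~_ H u v) →
                 Z (disjoint H) (within (λ v → χ v ∨ χ′ v)) (edgeList H) ≡
                 Z (disjoint H) (within χ) (edgeList H) ∙ Z (disjoint H) (within χ′) (edgeList H)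
      additive H {χ} {χ′} sep = trans
        (Z-cong (disjoint H) (edgeList H) λ {(i , j)} e∈ → oneSide i j (proj₂ (edge⁻ H e∈)))
        (Z-∪ (disjoint H) (edgeList H) (λ {(i , j)} _ → exclusive i j)
          (λ {(i , j)} {(k , l)} _ _ in-χ in-χ′ →
            let dis = dec-true (disjoint? H (i , j) (k , l)) (apart i j k l in-χ in-χ′)
            in dis , trans (disjoint-sym H (k , l) (i , j)) dis))
        where
        open FiniteGraph H using (_~_; symm)
        -- An edge with one endpoint in each set would contradict the separation of the sets.
        oneSide : ∀ i j → i ~ j → within (λ v → χ v ∨ χ′ v) (i , j) ≡ within χ (i , j) ∨ within χ′ (i , j)
        oneSide i j i~j with χ i in χi | χ′ i in χ′i | χ j in χj | χ′ j in χ′j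
        ... | true  | true  | _     | _     = contradiction refl (proj₁ (sep i i χi χ′i))
        ... | _     | _     | true  | true  = contradiction refl (proj₁ (sep j j χj χ′j))
        ... | true  | false | false | true  = contradiction i~j (proj₂ (sep i j χi χ′j))
        ... | false | true  | true  | false = contradiction (symm i~j) (proj₂ (sep j i χj χ′i))
        ... | true  | false | true  | false = refl
        ... | true  | false | false | false = refl
        ... | false | true  | false | true  = refl
        ... | false | true  | false | false = refl
        ... | false | false | true  | false = refl
        ... | false | false | false | true  = refl
        ... | false | false | false | false = refl
        exclusive : ∀ i j → within χ (i , j) ≡ true → within χ′ (i , j) ≡ false
        exclusive i j eq = cong (_∧ χ′ j) (Boolₚ.¬-not λ χ′i → proj₁ (sep i i (proj₁ (∧-true⁻ (χ i) eq)) χ′i) refl)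
        apart : ∀ i j k l → within χ (i , j) ≡ true → within χ′ (k , l) ≡ true → Disjoint H (i , j) (k , l)
        apart i j k l eq eq′ with ∧-true⁻ (χ i) eq | ∧-true⁻ (χ′ k) eq′
        ... | χi , χj | χ′k , χ′l = (proj₁ (sep i k χi χ′k) , proj₁ (sep i l χi χ′l)) ,
                                    (proj₁ (sep j k χj χ′k) , proj₁ (sep j l χj χ′l))

      restriction : ∀ {K H} (e : Embedding K H) {χ} →
                    (∀ v → χ v ≡ true → ∃ λ a → Embedding.to e a ≡ v) →
                    Z (disjoint H) (within χ) (edgeList H) ≡
                    Z (disjoint K) (within (χ ∘ Embedding.to e)) (edgeList K)
      restriction {K} {H} e {χ} supported = begin
        Z (disjoint H) (within χ) (edgeList H)
          ≡⟨ Z-filter (disjoint H) inside? (edgeList H)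
               (λ {(u , v)} _ eq → let χu , χv = ∧-true⁻ (χ u) eq in supported u χu , supported v χv) ⟩
        Z (disjoint H) (within χ) (filter inside? (edgeList H))
          ≡⟨ Z-↭ (disjoint H) (disjoint-sym H) image↭ (within χ) ⟩
        Z (disjoint H) (within χ) (map φ (edgeList K))
          ≡⟨ Z-map (disjoint K) (disjoint H) φ (edgeList K) (λ {e} _ → within-φ e)
               (λ {e} {e′} _ _ → does-⇔ (disjoint-φ e e′) (disjoint? K e e′) (disjoint? H (φ e) (φ e′))) ⟨
        Z (disjoint K) (within (χ ∘ to)) (edgeList K) ∎
        where
        open ≡-Reasoning
        open Embedding e
        φ : Vertex K × Vertex K → Vertex H × Vertex H
        φ (a , b) = orient (to a , to b)
        inside? : Decidable λ (u , v) → (∃ λ a → to a ≡ u) × (∃ λ b → to b ≡ v)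
        inside? (u , v) = Finₚ.any? (λ a → to a Fin.≟ u) ×-dec Finₚ.any? (λ b → to b Fin.≟ v)
        within-φ : ∀ e → within (χ ∘ to) e ≡ within χ (φ e)
        within-φ (a , b) with does (to a Fin.<? to b)
        ... | true  = refl
        ... | false = Boolₚ.∧-comm (χ (to a)) (χ (to b))
        disjoint-to : ∀ a b c d → Disjoint K (a , b) (c , d) ⇔ Disjoint H (to a , to b) (to c , to d)
        disjoint-to a b c d = mk⇔
          (λ ((p , q) , (r , s)) → (p ∘ injective , q ∘ injective) , (r ∘ injective , s ∘ injective))
          (λ ((p , q) , (r , s)) → (p ∘ cong to , q ∘ cong to) , (r ∘ cong to , s ∘ cong to))
        disjoint-φ : ∀ e e′ → Disjoint K e e′ ⇔ Disjoint H (φ e) (φ e′)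
        disjoint-φ (a , b) (c , d) with disjoint-to a b c d | does (to a Fin.<? to b) | does (to c Fin.<? to d)
        ... | D⇔ | true  | true  = D⇔
        ... | D⇔ | true  | false = mk⇔
          (λ D → let (p , q) , (r , s) = Equivalence.to D⇔ D in (q , p) , (s , r))
          (λ ((p , q) , (r , s)) → Equivalence.from D⇔ ((q , p) , (s , r)))
        ... | D⇔ | false | true  = mk⇔
          (λ D → let p , q = Equivalence.to D⇔ D in q , p)
          (λ (p , q) → Equivalence.from D⇔ (q , p))
        ... | D⇔ | false | false = mk⇔
          (λ D → let (p , q) , (r , s) = Equivalence.to D⇔ D in (s , r) , (q , p))
          (λ ((p , q) , (r , s)) → Equivalence.from D⇔ ((s , r) , (q , p)))
        φ-injective : ∀ {e e′} → proj₁ e Fin.< proj₂ e → proj₁ e′ Fin.< proj₂ e′ → φ e ≡ φ e′ → e ≡ e′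
        φ-injective {a , b} {c , d} a<b c<d eq with does (to a Fin.<? to b) | does (to c Fin.<? to d)
        ... | true  | true  = cong₂ _,_ (injective (cong proj₁ eq)) (injective (cong proj₂ eq))
        ... | false | false = cong₂ _,_ (injective (cong proj₂ eq)) (injective (cong proj₁ eq))
        -- Opposite turns would identify `a` with `d` and `b` with `c`, although both pairs are
        -- increasing.
        ... | true  | false with refl ← injective (cong proj₁ eq) | refl ← injective (cong proj₂ eq) =
          contradiction c<d (Finₚ.<-asym a<b)
        ... | false | true  with refl ← injective (cong proj₁ eq) | refl ← injective (cong proj₂ eq) =
          contradiction c<d (Finₚ.<-asym a<b)
        map-φ! : ∀ {es} → All (uncurry Fin._<_) es → Unique es → Unique (map φ es)
        map-φ! []            []           = []
        map-φ! (a<b ∷ below) (e∉ ∷ es!) =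
          Allₚ.map⁺ (All.zipWith (λ (c<d , e≢) → e≢ ∘ φ-injective a<b c<d) (below , e∉)) ∷ map-φ! below es!
        φ-edge : ∀ {a b} → (a , b) ∈ edgeList K → φ (a , b) ∈ filter inside? (edgeList H)
        φ-edge {a} {b} e∈ with a<b , a~b ← edge⁻ K e∈ | Finₚ.<-cmp (to a) (to b)
        ... | tri< u<v _ _ rewrite dec-true (to a Fin.<? to b) u<v =
          ∈-filter⁺ inside? (edge⁺ H u<v (Equivalence.to (adjacent a b) a~b)) ((a , refl) , (b , refl))
        ... | tri≈ _ u≡v _ = contradiction (injective u≡v) (Finₚ.<⇒≢ a<b)
        ... | tri> ¬u<v _ v<u rewrite dec-false (to a Fin.<? to b) ¬u<v =
          ∈-filter⁺ inside? (edge⁺ H v<u (FiniteGraph.symm H (Equivalence.to (adjacent a b) a~b)))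
                            ((b , refl) , (a , refl))
        edge-φ : ∀ {u v} → (u , v) ∈ filter inside? (edgeList H) → (u , v) ∈ map φ (edgeList K)
        edge-φ {u} {v} e∈ with ∈-filter⁻ inside? {xs = edgeList H} e∈
        ... | e∈H , ((a , refl) , (b , refl)) with u<v , u~v ← edge⁻ H e∈H | Finₚ.<-cmp a b
        ... | tri< a<b _ _ = subst (_∈ map φ (edgeList K)) φ≡ (∈-map⁺ φ (edge⁺ K a<b (Equivalence.from (adjacent a b) u~v)))
          where
          φ≡ : φ (a , b) ≡ (to a , to b)
          φ≡ rewrite dec-true (to a Fin.<? to b) u<v = refl
        ... | tri≈ _ refl _ = contradiction refl (Finₚ.<⇒≢ u<v)
        ... | tri> _ _ b<a = subst (_∈ map φ (edgeList K)) φ≡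
            (∈-map⁺ φ (edge⁺ K b<a (FiniteGraph.symm K (Equivalence.from (adjacent a b) u~v))))
          where
          φ≡ : φ (b , a) ≡ (to a , to b)
          φ≡ rewrite dec-false (to b Fin.<? to a) (Finₚ.<-asym u<v) = refl
        image↭ : filter inside? (edgeList H) ↭ map φ (edgeList K)
        image↭ = unique-↭ (Uniqueₚ.filter⁺ inside? (edgeList! H))
          (map-φ! (All.tabulate λ {(a , b)} e∈ → proj₁ (edge⁻ K e∈)) (edgeList! K))
          (mk⇔ edge-φ (λ v∈ → case ∈-map⁻ φ v∈ of λ where (_ , e∈ , refl) → φ-edge e∈))

-- Distances, and carving a finite graph into balls with thin boundaries.

module Decomposition where

  open OrderedMonoids
  open GraphParameters
  open import Data.Nat using (_+_; _*_; _^_; _≤_; _<_)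
  open import Data.Sum using (_⊎_)

  open Σℕ using (∑)

  module _ {n : ℕ} (G : Graph (Fin n)) where
    open Graph G

    dist? : ∀ r x y → Dec (Dist≤ G r x y)
    dist? zero    x y = map′ (λ { refl → here }) (λ { here → refl }) (x Fin.≟ y)
    dist? (suc r) x y with x Fin.≟ y
    ... | yes refl = yes here
    ... | no  x≢y  = map′ (λ (z , x~z , zy) → step x~z zy)
                          (λ { here → contradiction refl x≢y ; (step x~z zy) → _ , x~z , zy })
                          (Finₚ.any? λ z → (x ~? z) ×-dec dist? r z y)

    ball : ℕ → Fin n → Subset n
    ball r x y = does (dist? r x y)

  module _ {V : Set} {G : Graph V} where
    open Graph G

    dist-suc : ∀ {r x y} → Dist≤ G r x y → Dist≤ G (suc r) x y
    dist-suc here         = here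
    dist-suc (step x~z p) = step x~z (dist-suc p)

    dist-snoc : ∀ {r x y z} → Dist≤ G r x y → y ~ z → Dist≤ G (suc r) x z
    dist-snoc here         y~z = step y~z here
    dist-snoc (step x~w p) y~z = step x~w (dist-snoc p y~z)

    dist-sym : ∀ {r x y} → Dist≤ G r x y → Dist≤ G r y x
    dist-sym here         = here
    dist-sym (step x~z p) = dist-snoc (dist-sym p) (symm x~z)

    dist-mono : ∀ {r s x y} → r ≤ s → Dist≤ G r x y → Dist≤ G s x y
    dist-mono r≤s       here         = here
    dist-mono (s≤s r≤s) (step x~z p) = step x~z (dist-mono r≤s p)

    dist-trans : ∀ {r s x y z} → Dist≤ G r x y → Dist≤ G s y z → Dist≤ G (r + s) x z
    dist-trans {r} here         q = dist-mono (ℕₚ.m≤n+m _ r) q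
    dist-trans     (step x~w p) q = step x~w (dist-trans p q)

  module _ {n : ℕ} where

    ‖‖-mono : {χ χ′ : Subset n} → (∀ v → χ v ≡ true → χ′ v ≡ true) → ‖ χ ‖ ≤ ‖ χ′ ‖
    ‖‖-mono {χ} {χ′} χ⊆χ′ = Σℕ.∑-mono (allFin n) λ v → pointwise (χ v) (χ′ v) (χ⊆χ′ v)
      where
      pointwise : ∀ a b → (a ≡ true → b ≡ true) → 𝟙 a ≤ 𝟙 b
      pointwise false b a⇒b = z≤n
      pointwise true  b a⇒b rewrite a⇒b refl = ℕₚ.≤-refl

    ‖‖-split : (χ ψ : Subset n) → ‖ χ ‖ ≡ ‖ (λ v → χ v ∧ ψ v) ‖ + ‖ χ ∖ ψ ‖
    ‖‖-split χ ψ = trans (Σℕ.∑-cong (allFin n) λ v → pointwise (χ v) (ψ v)) (Σℕ.∑-∙ (allFin n) _ _)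
      where
      pointwise : ∀ a b → 𝟙 a ≡ 𝟙 (a ∧ b) + 𝟙 (a ∧ not b)
      pointwise false b     = refl
      pointwise true  true  = refl
      pointwise true  false = refl

    ‖‖-positive : ∀ {χ : Subset n} {v} → χ v ≡ true → 1 ≤ ‖ χ ‖
    ‖‖-positive {χ} {v} χv = subst (λ b → 𝟙 b ≤ ‖ χ ‖) χv (∑-∈ (𝟙 ∘ χ) (∈-allFin v))

  -- Otherwise each of the `R` steps multiplies `w` by more than `(q + 1) / q`, and `w R` reaches
  -- the `R`-th power of this ratio.
  slow-growth : ∀ q R (w : ℕ → ℕ) → 1 ≤ w 0 → w R * q ^ R < suc q ^ R →
                ∃[ r ] r < R × q * w (suc r) ≤ suc q * w r
  slow-growth q R w 1≤w₀ w<  with search R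
    where
    search : ∀ R → (∃[ r ] r < R × q * w (suc r) ≤ suc q * w r) ⊎ (suc q ^ R ≤ w R * q ^ R)
    search zero    = inj₂ (ℕₚ.≤-trans 1≤w₀ (ℕₚ.≤-reflexive (sym (ℕₚ.*-identityʳ (w 0)))))
    search (suc R) with search R
    ... | inj₁ (r , r<R , slow) = inj₁ (r , ℕₚ.m<n⇒m<1+n r<R , slow)
    ... | inj₂ fast with q * w (suc R) ℕₚ.≤? suc q * w R
    ...   | yes slow = inj₁ (R , ℕₚ.n<1+n R , slow)
    ...   | no ¬slow = inj₂ (begin
      suc q * suc q ^ R ≤⟨ ℕₚ.*-monoʳ-≤ (suc q) fast ⟩
      suc q * (w R * q ^ R) ≡⟨ ℕₚ.*-assoc (suc q) (w R) (q ^ R) ⟨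
      suc q * w R * q ^ R ≤⟨ ℕₚ.*-monoˡ-≤ (q ^ R) (ℕₚ.<⇒≤ (ℕₚ.≰⇒> ¬slow)) ⟩
      q * w (suc R) * q ^ R ≡⟨ cong (_* q ^ R) (ℕₚ.*-comm q (w (suc R))) ⟩
      w (suc R) * q * q ^ R ≡⟨ ℕₚ.*-assoc (w (suc R)) q (q ^ R) ⟩
      w (suc R) * (q * q ^ R) ∎)
      where open ℕₚ.≤-Reasoning
  ... | inj₁ found = found
  ... | inj₂ fast  = contradiction w< (ℕₚ.≤⇒≯ fast)

  -- Exhaust the graph by balls P whose outer boundary Q is a small fraction of P; deleting the
  -- boundaries separates the balls.  On a single P nearly every cluster is everything or nothing.
  module Exhaustion
    {A : OrderedMonoid} {d : ℕ} (θ : GraphParameter A d) (H : FiniteGraph) (degree : MaxDegree≤ (graph H) d)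
    (q R D : ℕ) (clusters : List (Vertex H → Bool))
    (covering : ∀ y → ∑ clusters (λ C → 𝟙 (C y)) ≡ D)
    (coherent : ∀ x y → Dist≤ (graph H) R x y → q * ∑ clusters (λ C → 𝟙 (C x xor C y)) ≤ D)
    (growth : ∀ x → ‖ ball (graph H) R x ‖ * q ^ R < suc q ^ R)
    where

    open OrderedMonoid A hiding (∑)
    open OrderedMonoid A using () renaming (∑ to ∑ᴬ)
    open GraphParameter θ using (unit)
    open FiniteGraph H using (_~_; symm)

    private
      h : (Vertex H → Bool) → Carrier
      h = GraphParameter.value θ H

      vertices : List (Vertex H)
      vertices = allFin (order H)

      infixr 7 _∩_
      _∩_ : (Vertex H → Bool) → (Vertex H → Bool) → Vertex H → Bool
      (χ ∩ ψ) v = χ v ∧ ψ v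

      S : (Vertex H → Bool) → Carrier
      S W = ∑ᴬ clusters λ C → h (C ∩ W)

      collect : ∀ a b c k l m → (a ∙ k · c) ∙ (b ∙ l · c) ∙ m · c ≡ (a ∙ b) ∙ (k + l + m) · c
      collect a b c k l m = begin
        (a ∙ k · c) ∙ (b ∙ l · c) ∙ m · c ≡⟨ cong (_∙ m · c) (interchange a (k · c) b (l · c)) ⟩
        (a ∙ b) ∙ (k · c ∙ l · c) ∙ m · c ≡⟨ assoc (a ∙ b) (k · c ∙ l · c) (m · c) ⟩
        (a ∙ b) ∙ (k · c ∙ l · c ∙ m · c) ≡⟨ cong (λ t → (a ∙ b) ∙ (t ∙ m · c)) (×-homo-+ c k l) ⟨
        (a ∙ b) ∙ ((k + l) · c ∙ m · c) ≡⟨ cong ((a ∙ b) ∙_) (×-homo-+ c (k + l) m) ⟨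
        (a ∙ b) ∙ (k + l + m) · c ∎
        where open ≡-Reasoning

    module Step (W : Vertex H → Bool) (x : Vertex H) (r : ℕ) where

      inner outer P Q W′ : Vertex H → Bool
      inner = ball (graph H) r x
      outer = ball (graph H) (suc r) x
      P  = W ∩ inner
      Q  = (W ∩ outer) ∖ inner
      W′ = W ∖ outer

      inner⊆outer : ∀ {v} → inner v ≡ true → outer v ≡ true
      inner⊆outer {v} in-r = dec-true (dist? (graph H) (suc r) x v) (dist-suc (from-does (dist? (graph H) r x v) in-r))

      -- Neighbours of the inner ball lie in the outer ball, which has been removed from `W′`.
      separated : ∀ C u v → (C ∩ W′) u ≡ true → (C ∩ P) v ≡ true → u ≢ v × ¬ u ~ v
      separated C u v u∈ v∈ = (λ { refl → apart (inner⊆outer v∈r) }) ,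
        λ u~v → apart (dec-true (dist? (graph H) (suc r) x u)
                                (dist-snoc (from-does (dist? (graph H) r x v) v∈r) (symm u~v)))
        where
        v∈r : inner v ≡ true
        v∈r = proj₂ (∧-true⁻ (W v) (proj₂ (∧-true⁻ (C v) v∈)))
        apart : ¬ outer u ≡ true
        apart eq with () ← trans (sym (proj₂ (∧-true⁻ (W u) (proj₂ (∧-true⁻ (C u) u∈))))) (cong not eq)

      pieces : ∀ C → h (λ v → (C ∩ W′) v ∨ (C ∩ P) v) ≡ h (C ∩ W′) ∙ h (C ∩ P)
      pieces C = GraphParameter.additive θ H (separated C)

      upper : ∀ C → h (C ∩ W) ⊑ h (C ∩ W′) ∙ h (C ∩ P) ∙ ‖ C ∩ Q ‖ · unit
      upper C = begin
        h (C ∩ W) ≲⟨ GraphParameter.lipschitz θ H degree kept (C ∩ W) ⟩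
        h kept ∙ ‖ (C ∩ W) ∖ kept ‖ · unit ≲⟨ ∙-mono (⊑-reflexive (pieces C)) (·-monoˡ unit (‖‖-mono lost)) ⟩
        h (C ∩ W′) ∙ h (C ∩ P) ∙ ‖ C ∩ Q ‖ · unit ∎
        where
        open ⊑-Reasoning
        kept : Vertex H → Bool
        kept v = (C ∩ W′) v ∨ (C ∩ P) v
        lost : ∀ v → ((C ∩ W) ∖ kept) v ≡ true → (C ∩ Q) v ≡ true
        lost v eq with C v | W v | outer v | inner v
        ... | true | true | true | false = refl

      lower : ∀ C → h (C ∩ W′) ∙ h (C ∩ P) ⊑ h (C ∩ W)
      lower C = ⊑-trans (⊑-reflexive (sym (pieces C))) (GraphParameter.monotone θ H kept⊆)
        where
        kept⊆ : ∀ v → ((C ∩ W′) v ∨ (C ∩ P) v) ≡ true → (C ∩ W) v ≡ true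
        kept⊆ v eq with C v | W v
        ... | true | true = refl

      -- How far `C` is from containing all or nothing of `P`, the centre `x` deciding which of the
      -- two is meant.
      defect : (Vertex H → Bool) → ℕ
      defect C = ‖ (λ v → P v ∧ (C x xor C v)) ‖

      -- If `x` is in `C`, monotonicity suffices; if not, `C ∩ P` consists of defects only and is
      -- compared with the empty set. In `piece-lower` the roles are reversed.
      piece-upper : ∀ C → h (C ∩ P) ⊑ 𝟙 (C x) · h P ∙ defect C · unit
      piece-upper C with C x
      ... | true  = begin
        h (C ∩ P) ≲⟨ GraphParameter.monotone θ H (λ v → proj₂ ∘ ∧-true⁻ (C v)) ⟩
        h P ≡⟨ identityʳ (h P) ⟨
        1 · h P ≲⟨ ⊑-∙ʳ _ _ ⟩
        1 · h P ∙ _ ∎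
        where open ⊑-Reasoning
      ... | false = begin
        h (C ∩ P)
          ≲⟨ GraphParameter.lipschitz θ H degree (λ _ → false) (C ∩ P) ⟩
        h (λ _ → false) ∙ ‖ (C ∩ P) ∖ (λ _ → false) ‖ · unit
          ≲⟨ ∙-mono (⊑-reflexive (GraphParameter.empty θ H λ _ → refl)) (·-monoˡ unit (‖‖-mono exchange)) ⟩
        ε ∙ ‖ (λ v → P v ∧ C v) ‖ · unit ∎
        where
        open ⊑-Reasoning
        exchange : ∀ v → ((C ∩ P) ∖ (λ _ → false)) v ≡ true → (P v ∧ C v) ≡ true
        exchange v eq = trans (Boolₚ.∧-comm (P v) (C v)) (proj₁ (∧-true⁻ _ eq))

      piece-lower : ∀ C → 𝟙 (C x) · h P ⊑ h (C ∩ P) ∙ defect C · unit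
      piece-lower C with C x
      ... | false = ε-least _
      ... | true  = begin
        1 · h P ≡⟨ identityʳ (h P) ⟩
        h P ≲⟨ GraphParameter.lipschitz θ H degree (C ∩ P) P ⟩
        h (C ∩ P) ∙ ‖ P ∖ (C ∩ P) ‖ · unit ≲⟨ ∙-mono ⊑-refl (·-monoˡ unit (‖‖-mono exchange)) ⟩
        h (C ∩ P) ∙ ‖ (λ v → P v ∧ not (C v)) ‖ · unit ∎
        where
        open ⊑-Reasoning
        exchange : ∀ v → (P ∖ (C ∩ P)) v ≡ true → (P v ∧ not (C v)) ≡ true
        exchange v eq with C v | P v
        ... | false | true = refl

      totalDefect : ℕ
      totalDefect = ∑ clusters defect

      -- Counted by vertices instead of clusters: each `v` in `P` is within `R` of `x`, so by
      -- coherence at most `D / q` clusters separate the two.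
      totalDefect-bound : r < R → q * totalDefect ≤ D * ‖ P ‖
      totalDefect-bound r<R = begin
        q * totalDefect
          ≡⟨ cong (q *_) (Σℕ.∑-swap clusters vertices _) ⟩
        q * ∑ vertices (λ v → ∑ clusters λ C → 𝟙 (P v ∧ (C x xor C v)))
          ≡⟨ ∑-*ˡ q vertices _ ⟩
        ∑ vertices (λ v → q * ∑ clusters λ C → 𝟙 (P v ∧ (C x xor C v)))
          ≤⟨ Σℕ.∑-mono vertices (pointwise r<R) ⟩
        ∑ vertices (λ v → D * 𝟙 (P v))
          ≡⟨ ∑-*ˡ D vertices _ ⟨
        D * ‖ P ‖ ∎
        where
        open ℕₚ.≤-Reasoning
        pointwise : r < R → ∀ v → q * (∑ clusters λ C → 𝟙 (P v ∧ (C x xor C v))) ≤ D * 𝟙 (P v)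
        pointwise r<R v with P v in Pv
        ... | false = ℕₚ.≤-reflexive (trans (cong (q *_) (Σℕ.∑-ε clusters)) (trans (ℕₚ.*-zeroʳ q) (sym (ℕₚ.*-zeroʳ D))))
        ... | true  = ℕₚ.≤-trans
          (coherent x v (dist-mono (ℕₚ.<⇒≤ r<R) (from-does (dist? (graph H) r x v) (proj₂ (∧-true⁻ (W v) Pv)))))
          (ℕₚ.≤-reflexive (sym (ℕₚ.*-identityʳ D)))

      covered : ∀ χ → ∑ clusters (λ C → ‖ C ∩ χ ‖) ≡ D * ‖ χ ‖
      covered χ = begin
        ∑ clusters (λ C → ‖ C ∩ χ ‖) ≡⟨ Σℕ.∑-swap clusters vertices _ ⟩
        ∑ vertices (λ v → ∑ clusters λ C → 𝟙 (C v ∧ χ v)) ≡⟨ Σℕ.∑-cong vertices pointwise ⟩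
        ∑ vertices (λ v → D * 𝟙 (χ v)) ≡⟨ ∑-*ˡ D vertices _ ⟨
        D * ‖ χ ‖ ∎
        where
        open ≡-Reasoning
        pointwise : ∀ v → ∑ clusters (λ C → 𝟙 (C v ∧ χ v)) ≡ D * 𝟙 (χ v)
        pointwise v with χ v
        ... | false = trans (Σℕ.∑-cong clusters λ C → cong 𝟙 (Boolₚ.∧-zeroʳ (C v)))
                            (trans (Σℕ.∑-ε clusters) (sym (ℕₚ.*-zeroʳ D)))
        ... | true  = trans (Σℕ.∑-cong clusters λ C → cong 𝟙 (Boolₚ.∧-identityʳ (C v)))
                            (trans (covering v) (sym (ℕₚ.*-identityʳ D)))

      -- The error of the remaining set, the clusters cut by `P`, and the dropped shell `Q`, each of
      -- whose vertices lies in `D` clusters.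
      loss : ℕ → ℕ
      loss K = K + totalDefect + D * ‖ Q ‖

      sum-upper : ∀ K → S W′ ⊑ D · h W′ ∙ K · unit → S W ⊑ D · h W ∙ loss K · unit
      sum-upper K rec = begin
        S W
          ≲⟨ ∑-mono clusters upper ⟩
        ∑ᴬ clusters (λ C → h (C ∩ W′) ∙ h (C ∩ P) ∙ ‖ C ∩ Q ‖ · unit)
          ≡⟨ trans (∑-∙ clusters _ _) (cong (_∙ ∑ᴬ clusters (λ C → ‖ C ∩ Q ‖ · unit)) (∑-∙ clusters _ _)) ⟩
        S W′ ∙ S P ∙ ∑ᴬ clusters (λ C → ‖ C ∩ Q ‖ · unit)
          ≡⟨ cong (S W′ ∙ S P ∙_) (trans (∑-·ˡ A clusters (λ C → ‖ C ∩ Q ‖) unit) (cong (_· unit) (covered Q))) ⟩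
        S W′ ∙ S P ∙ (D * ‖ Q ‖) · unit
          ≲⟨ ∙-mono (∙-mono rec S-P) ⊑-refl ⟩
        (D · h W′ ∙ K · unit) ∙ (D · h P ∙ totalDefect · unit) ∙ (D * ‖ Q ‖) · unit
          ≡⟨ collect (D · h W′) (D · h P) unit K totalDefect (D * ‖ Q ‖) ⟩
        (D · h W′ ∙ D · h P) ∙ loss K · unit
          ≡⟨ cong (_∙ loss K · unit) (×-distrib-+ (h W′) (h P) D) ⟨
        D · (h W′ ∙ h P) ∙ loss K · unit
          -- With everything as the cluster, the comparison of pieces becomes one for `W` itself.
          ≲⟨ ∙-mono (·-monoʳ D (lower λ _ → true)) ⊑-refl ⟩
        D · h W ∙ loss K · unit ∎
        where
        open ⊑-Reasoning
        S-P : S P ⊑ D · h P ∙ totalDefect · unit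
        S-P = begin
          S P
            ≲⟨ ∑-mono clusters piece-upper ⟩
          ∑ᴬ clusters (λ C → 𝟙 (C x) · h P ∙ defect C · unit)
            ≡⟨ ∑-∙ clusters _ _ ⟩
          ∑ᴬ clusters (λ C → 𝟙 (C x) · h P) ∙ ∑ᴬ clusters (λ C → defect C · unit)
            ≡⟨ cong₂ _∙_ (trans (∑-·ˡ A clusters _ (h P)) (cong (_· h P) (covering x))) (∑-·ˡ A clusters defect unit) ⟩
          D · h P ∙ totalDefect · unit ∎

      sum-lower : ∀ K → D · h W′ ⊑ S W′ ∙ K · unit → D · h W ⊑ S W ∙ loss K · unit
      sum-lower K rec = begin
        D · h W
          ≲⟨ ·-monoʳ D (upper λ _ → true) ⟩
        D · (h W′ ∙ h P ∙ ‖ Q ‖ · unit)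
          ≡⟨ trans (×-distrib-+ _ _ D) (cong₂ _∙_ (×-distrib-+ (h W′) (h P) D) (×-assocˡ unit D ‖ Q ‖)) ⟩
        D · h W′ ∙ D · h P ∙ (D * ‖ Q ‖) · unit
          ≲⟨ ∙-mono (∙-mono rec S-P) ⊑-refl ⟩
        (S W′ ∙ K · unit) ∙ (S P ∙ totalDefect · unit) ∙ (D * ‖ Q ‖) · unit
          ≡⟨ collect (S W′) (S P) unit K totalDefect (D * ‖ Q ‖) ⟩
        (S W′ ∙ S P) ∙ loss K · unit
          ≡⟨ cong (_∙ loss K · unit) (∑-∙ clusters _ _) ⟨
        ∑ᴬ clusters (λ C → h (C ∩ W′) ∙ h (C ∩ P)) ∙ loss K · unit
          ≲⟨ ∙-mono (∑-mono clusters lower) ⊑-refl ⟩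
        S W ∙ loss K · unit ∎
        where
        open ⊑-Reasoning
        S-P : D · h P ⊑ S P ∙ totalDefect · unit
        S-P = begin
          D · h P
            ≡⟨ trans (∑-·ˡ A clusters _ (h P)) (cong (_· h P) (covering x)) ⟨
          ∑ᴬ clusters (λ C → 𝟙 (C x) · h P)
            ≲⟨ ∑-mono clusters piece-lower ⟩
          ∑ᴬ clusters (λ C → h (C ∩ P) ∙ defect C · unit)
            ≡⟨ ∑-∙ clusters _ _ ⟩
          S P ∙ ∑ᴬ clusters (λ C → defect C · unit)
            ≡⟨ cong (S P ∙_) (∑-·ˡ A clusters defect unit) ⟩
          S P ∙ totalDefect · unit ∎

      outer-size : ‖ W ∩ outer ‖ ≡ ‖ P ‖ + ‖ Q ‖
      outer-size = begin
        ‖ W ∩ outer ‖ ≡⟨ ‖‖-split (W ∩ outer) inner ⟩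
        ‖ (W ∩ outer) ∩ inner ‖ + ‖ Q ‖ ≡⟨ cong (_+ ‖ Q ‖) (Σℕ.∑-cong vertices λ v → cong 𝟙 (absorb v)) ⟩
        ‖ P ‖ + ‖ Q ‖ ∎
        where
        open ≡-Reasoning
        absorb : ∀ v → ((W ∩ outer) ∩ inner) v ≡ P v
        absorb v with inner v in v∈ | W v
        ... | false | w     = trans (Boolₚ.∧-zeroʳ (w ∧ outer v)) (sym (Boolₚ.∧-zeroʳ w))
        ... | true  | false = refl
        ... | true  | true  rewrite inner⊆outer v∈ = refl

      size-split : ‖ W ‖ ≡ ‖ P ‖ + ‖ Q ‖ + ‖ W′ ‖
      size-split = trans (‖‖-split W outer) (cong (_+ ‖ W′ ‖) outer-size)

    -- The factor 2 pays for two errors per ball `P`, each at most `D * ‖ P ‖ / q`: one for the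
    -- clusters cut by `P` and one for its shell.
    Approximation : (Vertex H → Bool) → Set
    Approximation W = ∃[ K ] q * K ≤ 2 * D * ‖ W ‖ × S W ⊑ D · h W ∙ K · unit × D · h W ⊑ S W ∙ K · unit

    -- Each step removes a ball around some `x` of `W`, and with it at least `x`; hence the
    -- induction on a bound for the size of `W`. Its radius is one at which the part of the ball
    -- inside `W` grows slowly, so the boundary is thin relative to what is still left.
    approximation : ∀ n W → ‖ W ‖ ≤ n → Approximation W
    approximation n W ‖W‖≤n with Finₚ.any? (λ v → W v Boolₚ.≟ true)
    ... | no none = 0 , ℕₚ.≤-trans (ℕₚ.≤-reflexive (ℕₚ.*-zeroʳ q)) z≤n ,
        (begin
          S W ≡⟨ trans (∑-cong clusters λ C → GraphParameter.empty θ H (C∩W≡∅ C)) (∑-ε clusters) ⟩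
          ε ≲⟨ ε-least _ ⟩
          D · h W ∙ 0 · unit ∎) ,
        (begin
          D · h W ≡⟨ trans (cong (D ·_) (GraphParameter.empty θ H W≡∅)) (·-ε D) ⟩
          ε ≲⟨ ε-least _ ⟩
          S W ∙ 0 · unit ∎)
      where
      open ⊑-Reasoning
      W≡∅ : ∀ v → W v ≡ false
      W≡∅ v = Boolₚ.¬-not λ Wv → none (v , Wv)
      C∩W≡∅ : ∀ C v → (C ∩ W) v ≡ false
      C∩W≡∅ C v = trans (cong (C v ∧_) (W≡∅ v)) (Boolₚ.∧-zeroʳ (C v))
    approximation zero    W ‖W‖≤0 | yes (x , Wx) = contradiction (ℕₚ.≤-trans (‖‖-positive {χ = W} Wx) ‖W‖≤0) (ℕₚ.<-irrefl refl)
    approximation (suc n) W ‖W‖≤n | yes (x , Wx) = extend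
      (slow-growth q R (λ r → ‖ W ∩ ball (graph H) r x ‖)
        (‖‖-positive {χ = W ∩ ball (graph H) 0 x} (cong₂ _∧_ Wx (dec-true (dist? (graph H) 0 x x) here)))
        (ℕₚ.≤-<-trans (ℕₚ.*-monoˡ-≤ (q ^ R) (‖‖-mono {χ′ = ball (graph H) R x} λ v → proj₂ ∘ ∧-true⁻ (W v))) (growth x)))
      where
      extend : (∃[ r ] r < R × q * ‖ W ∩ ball (graph H) (suc r) x ‖ ≤ suc q * ‖ W ∩ ball (graph H) r x ‖) → Approximation W
      extend (r , r<R , slow) with approximation n W′ ‖W′‖≤n
        where
        open Step W x r
        ‖W′‖≤n : ‖ W′ ‖ ≤ n
        ‖W′‖≤n = ℕₚ.≤-pred (begin
          1 + ‖ W′ ‖ ≤⟨ ℕₚ.+-monoˡ-≤ ‖ W′ ‖ (ℕₚ.≤-trans (‖‖-positive {χ = P} x∈P) (ℕₚ.m≤m+n ‖ P ‖ ‖ Q ‖)) ⟩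
          ‖ P ‖ + ‖ Q ‖ + ‖ W′ ‖ ≡⟨ size-split ⟨
          ‖ W ‖ ≤⟨ ‖W‖≤n ⟩
          suc n ∎)
          where
          open ℕₚ.≤-Reasoning
          x∈P : P x ≡ true
          x∈P = cong₂ _∧_ Wx (dec-true (dist? (graph H) r x x) here)
      ... | K , K-bound , up , low = loss K , loss-bound , sum-upper K up , sum-lower K low
        where
        open Step W x r
        -- The ball of radius `r + 1` meets `W` in `P` and `Q`, so slow growth reads
        -- `q * (‖ P ‖ + ‖ Q ‖) ≤ (q + 1) * ‖ P ‖`.
        thin : q * ‖ Q ‖ ≤ ‖ P ‖
        thin = ℕₚ.+-cancelˡ-≤ (q * ‖ P ‖) (q * ‖ Q ‖) ‖ P ‖ (begin
          q * ‖ P ‖ + q * ‖ Q ‖ ≡⟨ ℕₚ.*-distribˡ-+ q ‖ P ‖ ‖ Q ‖ ⟨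
          q * (‖ P ‖ + ‖ Q ‖) ≡⟨ cong (q *_) outer-size ⟨
          q * ‖ W ∩ outer ‖ ≤⟨ slow ⟩
          ‖ P ‖ + q * ‖ P ‖ ≡⟨ ℕₚ.+-comm ‖ P ‖ _ ⟩
          q * ‖ P ‖ + ‖ P ‖ ∎)
          where open ℕₚ.≤-Reasoning
        loss-bound : q * loss K ≤ 2 * D * ‖ W ‖
        loss-bound = begin
          q * (K + totalDefect + D * ‖ Q ‖)
            ≡⟨ distribute q K totalDefect D ‖ Q ‖ ⟩
          q * K + q * totalDefect + D * (q * ‖ Q ‖)
            ≤⟨ ℕₚ.+-mono-≤ (ℕₚ.+-mono-≤ K-bound (totalDefect-bound r<R)) (ℕₚ.*-monoʳ-≤ D thin) ⟩
          2 * D * ‖ W′ ‖ + D * ‖ P ‖ + D * ‖ P ‖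
            ≤⟨ ℕₚ.m≤m+n _ (2 * D * ‖ Q ‖) ⟩
          2 * D * ‖ W′ ‖ + D * ‖ P ‖ + D * ‖ P ‖ + 2 * D * ‖ Q ‖
            ≡⟨ regroup D (‖ P ‖) (‖ Q ‖) (‖ W′ ‖) ⟩
          2 * D * (‖ P ‖ + ‖ Q ‖ + ‖ W′ ‖)
            ≡⟨ cong (2 * D *_) size-split ⟨
          2 * D * ‖ W ‖ ∎
          where
          open ℕₚ.≤-Reasoning
          distribute : ∀ q K t D s → q * (K + t + D * s) ≡ q * K + q * t + D * (q * s)
          distribute = solve-∀
          regroup : ∀ D p s w → 2 * D * w + D * p + D * p + 2 * D * s ≡ 2 * D * (p + s + w)
          regroup = solve-∀

-- Local clusters from a truncated exponential decay.

module Spreading where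

  open OrderedMonoids
  open GraphParameters
  open Decomposition
  open import Data.Nat using (_+_; _*_; _∸_; _^_; _!; _≤_; _<_; _<ᵇ_; _⊓_; ∣_-_∣)
  open import Data.Nat.Divisibility using (_∣_; ∣-trans; m∣m*n; m≤n⇒m!∣n!)
  open import Data.Nat.DivMod using (_/_; m/n*n≡m)

  open Σℕ using (∑)

  ∑-upTo-suc : ∀ n (g : ℕ → ℕ) → ∑ (upTo (suc n)) g ≡ g 0 + ∑ (upTo n) (g ∘ suc)
  ∑-upTo-suc n g = cong (g 0 +_) (trans (cong (λ ts → ∑ ts g) (sym (Listₚ.map-upTo suc n))) (Σℕ.∑-map suc (upTo n) g))

  count-below : ∀ n a → ∑ (upTo n) (λ t → 𝟙 (t <ᵇ a)) ≡ n ⊓ a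
  count-below zero    a       = refl
  count-below (suc n) zero    = Σℕ.∑-ε (upTo (suc n))
  count-below (suc n) (suc a) = trans (∑-upTo-suc n (λ t → 𝟙 (t <ᵇ suc a))) (cong suc (count-below n a))

  -- Layer-cake counting: a level separates `a` from `b` only if it lies between them. Thus
  -- differences of masses become numbers of clusters.
  count-xor : ∀ n a b → ∑ (upTo n) (λ t → 𝟙 ((t <ᵇ a) xor (t <ᵇ b))) ≤ ∣ a - b ∣
  count-xor n       zero    b       = ℕₚ.≤-trans (ℕₚ.≤-reflexive (count-below n b)) (ℕₚ.m⊓n≤n n b)
  count-xor n       (suc a) zero    = ℕₚ.≤-trans
    (ℕₚ.≤-reflexive (trans (Σℕ.∑-cong (upTo n) λ t → cong 𝟙 (xor-false (t <ᵇ suc a))) (count-below n (suc a))))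
    (ℕₚ.m⊓n≤n n (suc a))
    where
    xor-false : ∀ b → (b xor false) ≡ b
    xor-false true  = refl
    xor-false false = refl
  count-xor zero    (suc a) (suc b) = z≤n
  count-xor (suc n) (suc a) (suc b) = ℕₚ.≤-trans (ℕₚ.≤-reflexive (∑-upTo-suc n (λ t → 𝟙 ((t <ᵇ suc a) xor (t <ᵇ suc b))))) (count-xor n a b)

  ∣m+n-n∣≡m : ∀ m n → ∣ m + n - n ∣ ≡ m
  ∣m+n-n∣≡m m n = trans (cong (∣_- n ∣) (ℕₚ.+-comm m n)) (trans (ℕₚ.∣-∣-comm (n + m) n) (ℕₚ.∣m-m+n∣≡n n m))

  m∣m! : ∀ {m} → 1 ≤ m → m ∣ m !
  m∣m! {suc m} _ = m∣m*n (m !)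

  -- j is a distance capped at s.
  decay : ℕ → ℕ → ℕ → ℕ
  decay p s j = p ^ j * suc p ^ (s ∸ j)

  decay-suc : ∀ p s j → j < s → suc p * decay p s (suc j) ≡ p * decay p s j
  decay-suc p s j j<s = begin
    suc p * (p * p ^ j * suc p ^ (s ∸ suc j)) ≡⟨ rearrange (suc p) p (p ^ j) (suc p ^ (s ∸ suc j)) ⟩
    p * (p ^ j * suc p ^ suc (s ∸ suc j)) ≡⟨ cong (λ e → p * (p ^ j * suc p ^ e)) (ℕₚ.+-∸-assoc 1 j<s) ⟨
    p * (p ^ j * suc p ^ (s ∸ j)) ∎
    where
    open ≡-Reasoning
    rearrange : ∀ q p a b → q * (p * a * b) ≡ p * (a * (q * b))
    rearrange = solve-∀

  decay-≥ : ∀ p s j → j ≤ s → p ^ s ≤ decay p s j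
  decay-≥ p s j j≤s = begin
    p ^ s ≡⟨ cong (p ^_) (ℕₚ.m+[n∸m]≡n j≤s) ⟨
    p ^ (j + (s ∸ j)) ≡⟨ ℕₚ.^-distribˡ-+-* p j (s ∸ j) ⟩
    p ^ j * p ^ (s ∸ j) ≤⟨ ℕₚ.*-monoʳ-≤ (p ^ j) (ℕₚ.^-monoˡ-≤ (s ∸ j) (ℕₚ.n≤1+n p)) ⟩
    decay p s j ∎
    where open ℕₚ.≤-Reasoning

  decay-≤ : ∀ p s j → j ≤ s → decay p s j ≤ suc p ^ s
  decay-≤ p s j j≤s = begin
    p ^ j * suc p ^ (s ∸ j) ≤⟨ ℕₚ.*-monoˡ-≤ (suc p ^ (s ∸ j)) (ℕₚ.^-monoˡ-≤ j (ℕₚ.n≤1+n p)) ⟩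
    suc p ^ j * suc p ^ (s ∸ j) ≡⟨ ℕₚ.^-distribˡ-+-* (suc p) j (s ∸ j) ⟨
    suc p ^ (j + (s ∸ j)) ≡⟨ cong (suc p ^_) (ℕₚ.m+[n∸m]≡n j≤s) ⟩
    suc p ^ s ∎
    where open ℕₚ.≤-Reasoning

  -- The decay is geometric with ratio `p / (p + 1)`, so consecutive values differ by a `p`-th part
  -- of the smaller one.
  decay-close : ∀ p s j k → j ≤ s → k ≤ s → j ≤ suc k → k ≤ suc j →
                p * ∣ decay p s j - decay p s k ∣ ≤ decay p s j
  decay-close p s j k j≤s k≤s j≤1+k k≤1+j with ℕₚ.<-cmp j k
  ... | tri≈ _ refl _ = ℕₚ.≤-trans (ℕₚ.≤-reflexive (trans (cong (p *_) (ℕₚ.∣n-n∣≡0 (decay p s j))) (ℕₚ.*-zeroʳ p))) z≤n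
  ... | tri< j<k _ _ with refl ← ℕₚ.≤-antisym k≤1+j j<k = begin
    p * ∣ a - b ∣ ≡⟨ ℕₚ.*-distribˡ-∣-∣ p a b ⟩
    ∣ p * a - p * b ∣ ≡⟨ cong (∣_- p * b ∣) (decay-suc p s j k≤s) ⟨
    ∣ b + p * b - p * b ∣ ≡⟨ ∣m+n-n∣≡m b (p * b) ⟩
    b ≤⟨ ℕₚ.*-cancelˡ-≤ (suc p) (ℕₚ.≤-trans (ℕₚ.≤-reflexive (decay-suc p s j k≤s)) (ℕₚ.m≤n+m (p * a) a)) ⟩
    a ∎
    where
    open ℕₚ.≤-Reasoning
    a = decay p s j
    b = decay p s (suc j)
  ... | tri> _ _ k<j with refl ← ℕₚ.≤-antisym j≤1+k k<j = begin
    p * ∣ a - b ∣ ≡⟨ ℕₚ.*-distribˡ-∣-∣ p a b ⟩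
    ∣ p * a - p * b ∣ ≡⟨ cong (∣ p * a -_∣) (decay-suc p s k j≤s) ⟨
    ∣ p * a - a + p * a ∣ ≡⟨ trans (ℕₚ.∣-∣-comm (p * a) (a + p * a)) (∣m+n-n∣≡m a (p * a)) ⟩
    a ∎
    where
    open ℕₚ.≤-Reasoning
    a = decay p s (suc k)
    b = decay p s k

  ∣∑-∑∣ : ∀ {X : Set} (xs : List X) (f g : X → ℕ) → ∣ ∑ xs f - ∑ xs g ∣ ≤ ∑ xs (λ x → ∣ f x - g x ∣)
  ∣∑-∑∣ []       f g = z≤n
  ∣∑-∑∣ (x ∷ xs) f g = begin
    ∣ f x + ∑ xs f - g x + ∑ xs g ∣
      ≤⟨ ℕₚ.∣-∣-triangle (f x + ∑ xs f) (f x + ∑ xs g) (g x + ∑ xs g) ⟩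
    ∣ f x + ∑ xs f - f x + ∑ xs g ∣ + ∣ f x + ∑ xs g - g x + ∑ xs g ∣
      ≡⟨ cong₂ _+_ (ℕₚ.∣m+n-m+o∣≡∣n-o∣ (f x) (∑ xs f) (∑ xs g))
                   (trans (cong₂ ∣_-_∣ (ℕₚ.+-comm (f x) (∑ xs g)) (ℕₚ.+-comm (g x) (∑ xs g)))
                          (ℕₚ.∣m+n-m+o∣≡∣n-o∣ (∑ xs g) (f x) (g x))) ⟩
    ∣ ∑ xs f - ∑ xs g ∣ + ∣ f x - g x ∣
      ≤⟨ ℕₚ.+-monoˡ-≤ ∣ f x - g x ∣ (∣∑-∑∣ xs f g) ⟩
    ∑ xs (λ y → ∣ f y - g y ∣) + ∣ f x - g x ∣
      ≡⟨ ℕₚ.+-comm _ ∣ f x - g x ∣ ⟩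
    ∣ f x - g x ∣ + ∑ xs (λ y → ∣ f y - g y ∣) ∎
    where open ℕₚ.≤-Reasoning

  𝟙≤1 : ∀ b → 𝟙 b ≤ 1
  𝟙≤1 true  = ℕₚ.≤-refl
  𝟙≤1 false = z≤n

  -- Every vertex y spreads the mass D over its s-ball, proportionally to the truncated decay;
  -- the level sets of the mass received by x, as a function of y, are the clusters around x.
  module Kernel {n : ℕ} (G : Graph (Fin n)) (p s D : ℕ) where

    open Graph G

    -- The minimum of `i` and the distance, as the number of radii below `i` at which the ball
    -- around `y` misses `x`. In this form it is total even without a connecting walk, and its
    -- locality reduces to that of balls.
    cappedDist : ℕ → Fin n → Fin n → ℕ
    cappedDist zero    y x = 0
    cappedDist (suc i) y x = cappedDist i y x + 𝟙 (not (ball G i y x))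

    -- At capped distance `s` the decay is exactly `p ^ s`; the subtraction makes the kernel vanish
    -- off the `s`-ball and leaves differences of values unchanged.
    kernel : Fin n → Fin n → ℕ
    kernel y x = decay p s (cappedDist s y x) ∸ p ^ s

    total : Fin n → ℕ
    total y = ∑ (allFin n) (kernel y)

    -- suc (pred _) is total y, which is positive in all cases of interest.
    scale : Fin n → ℕ
    scale y = D / suc (ℕ.pred (total y))

    mass : Fin n → Fin n → ℕ
    mass x y = kernel y x * scale y

    cluster : Fin n → ℕ → Subset n
    cluster x t y = t <ᵇ mass x y

    clusters : List (Subset n)
    clusters = map (uncurry cluster) (cartesianProduct (allFin n) (upTo D))

    ball-false : ∀ {i y x} → ball G (suc i) y x ≡ false → ball G i y x ≡ false
    ball-false {i} {y} {x} far =
      dec-false (dist? G i y x) λ near → from-¬does (dist? G (suc i) y x) far (dist-suc near)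

    cappedDist-≤ : ∀ i y x → cappedDist i y x ≤ i
    cappedDist-≤ zero    y x = z≤n
    cappedDist-≤ (suc i) y x =
      ℕₚ.≤-trans (ℕₚ.+-mono-≤ (cappedDist-≤ i y x) (𝟙≤1 (not (ball G i y x)))) (ℕₚ.≤-reflexive (ℕₚ.+-comm i 1))

    cappedDist-far : ∀ i {y x} → ball G i y x ≡ false → cappedDist i y x ≡ i
    cappedDist-far zero    far = refl
    cappedDist-far (suc i) {y} {x} far =
      trans (cong₂ (λ a b → a + 𝟙 (not b)) (cappedDist-far i near) near) (ℕₚ.+-comm i 1)
      where
      near : ball G i y x ≡ false
      near = ball-false {i} {y} {x} far

    cappedDist-self : ∀ i y → cappedDist i y y ≡ 0
    cappedDist-self zero    y = refl
    cappedDist-self (suc i) y = cong₂ (λ a b → a + 𝟙 (not b)) (cappedDist-self i y) (dec-true (dist? G i y y) here)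

    ball-step : ∀ {i y y′ x} → y ~ y′ → ball G (suc i) y x ≡ false → ball G i y′ x ≡ false
    ball-step {i} {y} {y′} {x} y~y′ far =
      dec-false (dist? G i y′ x) λ near → from-¬does (dist? G (suc i) y x) far (step y~y′ near)

    -- The ball around `y′` is contained in the ball around `y` of radius one larger. Matching the
    -- radii with this shift leaves only radius 0 for `y` unpaired.
    cappedDist-lipschitz : ∀ i {y y′} → y ~ y′ → ∀ x → cappedDist i y x ≤ suc (cappedDist i y′ x)
    cappedDist-lipschitz zero    y~y′ x = z≤n
    cappedDist-lipschitz (suc i) {y} {y′} y~y′ x = ℕₚ.≤-trans (shifted i) (s≤s (ℕₚ.m≤m+n _ _))
      where
      𝟙-not-mono : ∀ i → 𝟙 (not (ball G (suc i) y x)) ≤ 𝟙 (not (ball G i y′ x))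
      𝟙-not-mono i with ball G (suc i) y x in eq
      ... | true  = z≤n
      ... | false = ℕₚ.≤-reflexive (cong (𝟙 ∘ not) (sym (ball-step {i} {x = x} y~y′ eq)))
      shifted : ∀ i → cappedDist (suc i) y x ≤ suc (cappedDist i y′ x)
      shifted zero    = 𝟙≤1 (not (ball G 0 y x))
      shifted (suc i) = ℕₚ.+-mono-≤ (shifted i) (𝟙-not-mono i)

    decay-kernel : ∀ y x → decay p s (cappedDist s y x) ≡ kernel y x + p ^ s
    decay-kernel y x = sym (ℕₚ.m∸n+n≡m (decay-≥ p s (cappedDist s y x) (cappedDist-≤ s y x)))

    kernel-far : ∀ {y x} → ball G s y x ≡ false → kernel y x ≡ 0
    kernel-far {y} {x} far rewrite cappedDist-far s far | ℕₚ.n∸n≡0 s | ℕₚ.*-identityʳ (p ^ s) = ℕₚ.n∸n≡0 (p ^ s)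

    -- The closeness of the decay is relative to its full value, and the subtracted `p ^ s`
    -- reappears as an error for each vertex of the ball. The size of the ball thus enters, and
    -- growth has to beat it.
    kernel-close : ∀ {y y′} → y ~ y′ → ∀ x →
                   p * ∣ kernel y x - kernel y′ x ∣ ≤ kernel y x + p ^ s * 𝟙 (ball G s y x)
    kernel-close {y} {y′} y~y′ x with ball G s y x in near
    ... | true  = begin
      p * ∣ kernel y x - kernel y′ x ∣
        ≡⟨ cong (p *_) shift ⟨
      p * ∣ decay p s (cappedDist s y x) - decay p s (cappedDist s y′ x) ∣
        ≤⟨ decay-close p s _ _ (cappedDist-≤ s y x) (cappedDist-≤ s y′ x)
             (cappedDist-lipschitz s y~y′ x) (cappedDist-lipschitz s (symm y~y′) x) ⟩
      decay p s (cappedDist s y x)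
        ≡⟨ decay-kernel y x ⟩
      kernel y x + p ^ s
        ≡⟨ cong (kernel y x +_) (ℕₚ.*-identityʳ (p ^ s)) ⟨
      kernel y x + p ^ s * 1 ∎
      where
      open ℕₚ.≤-Reasoning
      shift : ∣ decay p s (cappedDist s y x) - decay p s (cappedDist s y′ x) ∣ ≡ ∣ kernel y x - kernel y′ x ∣
      shift = trans
        (cong₂ ∣_-_∣ (trans (decay-kernel y x) (ℕₚ.+-comm _ (p ^ s))) (trans (decay-kernel y′ x) (ℕₚ.+-comm _ (p ^ s))))
        (ℕₚ.∣m+n-m+o∣≡∣n-o∣ (p ^ s) (kernel y x) (kernel y′ x))
    ... | false = ℕₚ.≤-trans (ℕₚ.≤-reflexive vanish) z≤n
      where
      -- From `y′` the vertex `x` can still be reached, but not in fewer than `i` steps; at distance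
      -- `s` the kernel is already zero.
      far′ : ∀ i → ball G i y x ≡ false → cappedDist i y′ x ≡ i
      far′ zero    far = refl
      far′ (suc i) far = trans (cong₂ (λ a b → a + 𝟙 (not b)) (far′ i (ball-false {i} {y} {x} far))
                                                              (ball-step {i} {x = x} y~y′ far)) (ℕₚ.+-comm i 1)
      vanish : p * ∣ kernel y x - kernel y′ x ∣ ≡ 0
      vanish rewrite cappedDist-far s near | far′ s near =
        trans (cong (p *_) (ℕₚ.∣n-n∣≡0 (decay p s s ∸ p ^ s))) (ℕₚ.*-zeroʳ p)

    -- `decays` ensures that truncation over a whole ball of `φ` vertices costs no more than the
    -- kernel at its centre. `φ * suc p ^ s` bounds every `total`, so its factorial is a common
    -- multiple of all of them.
    module Properties (φ : ℕ) (growth : ∀ y → ‖ ball G s y ‖ ≤ φ)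
                      (decays : p ^ s * suc φ ≤ suc p ^ s)
                      (D-def : D ≡ (φ * suc p ^ s) !) (0<p : 1 ≤ p) where

      private
        V = allFin n

      -- The term at `y` itself, `suc p ^ s ∸ p ^ s`, is large enough.
      total-≥ : ∀ y → p ^ s * φ ≤ total y
      total-≥ y = begin
        p ^ s * φ ≡⟨ ℕₚ.m+n∸m≡n (p ^ s) (p ^ s * φ) ⟨
        p ^ s + p ^ s * φ ∸ p ^ s ≤⟨ ℕₚ.∸-monoˡ-≤ (p ^ s) (ℕₚ.≤-trans (ℕₚ.≤-reflexive (sym (ℕₚ.*-suc (p ^ s) φ))) decays) ⟩
        suc p ^ s ∸ p ^ s ≡⟨ cong (_∸ p ^ s) (ℕₚ.+-identityʳ (suc p ^ s)) ⟨
        decay p s 0 ∸ p ^ s ≡⟨ cong (λ j → decay p s j ∸ p ^ s) (cappedDist-self s y) ⟨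
        kernel y y ≤⟨ ∑-∈ (kernel y) (∈-allFin y) ⟩
        total y ∎
        where open ℕₚ.≤-Reasoning

      kernel-≤ : ∀ y x → kernel y x ≤ 𝟙 (ball G s y x) * suc p ^ s
      kernel-≤ y x with ball G s y x in near
      ... | true  = ℕₚ.≤-trans (ℕₚ.m∸n≤m _ (p ^ s))
        (ℕₚ.≤-trans (decay-≤ p s _ (cappedDist-≤ s y x)) (ℕₚ.≤-reflexive (sym (ℕₚ.+-identityʳ _))))
      ... | false = ℕₚ.≤-reflexive (kernel-far near)

      total-≤ : ∀ y → total y ≤ φ * suc p ^ s
      total-≤ y = begin
        total y ≤⟨ Σℕ.∑-mono V (kernel-≤ y) ⟩
        ∑ V (λ x → 𝟙 (ball G s y x) * suc p ^ s) ≡⟨ ∑-*ʳ (suc p ^ s) V _ ⟨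
        ‖ ball G s y ‖ * suc p ^ s ≤⟨ ℕₚ.*-monoˡ-≤ (suc p ^ s) (growth y) ⟩
        φ * suc p ^ s ∎
        where open ℕₚ.≤-Reasoning

      total-positive : ∀ y → 1 ≤ total y
      total-positive y = ℕₚ.≤-trans
        (ℕₚ.*-mono-≤ (ℕₚ.m^n>0 p {{ℕ.>-nonZero 0<p}} s)
          (ℕₚ.≤-trans (‖‖-positive {χ = ball G s y} (dec-true (dist? G s y y) here)) (growth y)))
        (total-≥ y)

      -- The division in `scale` is exact because `total y` is a factor of the factorial. The
      -- exactness matters: all vertices spread the same mass.
      scaled : ∀ y → total y * scale y ≡ D
      scaled y with total y | total-positive y | total-≤ y
      ... | suc k | _ | k<b = trans (ℕₚ.*-comm (suc k) (D / suc k)) (m/n*n≡m divisible)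
        where
        divisible : suc k ∣ D
        divisible rewrite D-def = ∣-trans (m∣m! {suc k} (s≤s z≤n)) (m≤n⇒m!∣n! k<b)

      mass-total : ∀ y → ∑ V (λ x → mass x y) ≡ D
      mass-total y = trans (sym (∑-*ʳ (scale y) V (kernel y))) (scaled y)

      mass-≤ : ∀ x y → mass x y ≤ D
      mass-≤ x y = ℕₚ.≤-trans (∑-∈ (λ x → mass x y) (∈-allFin x)) (ℕₚ.≤-reflexive (mass-total y))

      covering : ∀ y → ∑ clusters (λ C → 𝟙 (C y)) ≡ D
      covering y = begin
        ∑ clusters (λ C → 𝟙 (C y)) ≡⟨ Σℕ.∑-map (uncurry cluster) (cartesianProduct V (upTo D)) (λ C → 𝟙 (C y)) ⟩
        _ ≡⟨ Σℕ.∑-cartesianProduct V (upTo D) (λ (x , t) → 𝟙 (t <ᵇ mass x y)) ⟩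
        ∑ V (λ x → ∑ (upTo D) λ t → 𝟙 (t <ᵇ mass x y)) ≡⟨ Σℕ.∑-cong V (λ x → trans (count-below D (mass x y)) (ℕₚ.m≥n⇒m⊓n≡n (mass-≤ x y))) ⟩
        ∑ V (λ x → mass x y) ≡⟨ mass-total y ⟩
        D ∎
        where open ≡-Reasoning

      variation : Fin n → Fin n → ℕ
      variation y y′ = ∑ V λ x → ∣ mass x y - mass x y′ ∣

      -- The kernel and the scale both change. Since `total y * scale y` is the same for both
      -- vertices, the change of scale costs `∣ total y - total y′ ∣ * scale y`, again at most the
      -- change of kernels. Each contributes at most `2 * D`: one `D` from the kernel, one from its
      -- truncation.
      variation-adjacent : ∀ {y y′} → y ~ y′ → p * variation y y′ ≤ 4 * D
      variation-adjacent {y} {y′} y~y′ = begin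
        p * variation y y′
          ≤⟨ ℕₚ.*-monoʳ-≤ p (Σℕ.∑-mono V pointwise) ⟩
        p * ∑ V (λ x → ∣ kernel y x - kernel y′ x ∣ * a + kernel y′ x * ∣ a - a′ ∣)
          ≡⟨ cong (p *_) (trans (Σℕ.∑-∙ V _ _) (sym (cong₂ _+_ (∑-*ʳ a V _) (∑-*ʳ ∣ a - a′ ∣ V _)))) ⟩
        p * (ν * a + total y′ * ∣ a - a′ ∣)
          ≤⟨ ℕₚ.*-monoʳ-≤ p (ℕₚ.+-monoʳ-≤ (ν * a) rescale) ⟩
        p * (ν * a + ν * a)
          ≡⟨ regroup p ν a ⟩
        2 * (p * ν) * a
          ≤⟨ ℕₚ.*-monoˡ-≤ a (ℕₚ.*-monoʳ-≤ 2 p*ν≤) ⟩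
        2 * (2 * total y) * a
          ≡⟨ regroup′ (total y) a ⟩
        4 * (total y * a)
          ≡⟨ cong (4 *_) (scaled y) ⟩
        4 * D ∎
        where
        open ℕₚ.≤-Reasoning
        a  = scale y
        a′ = scale y′
        ν  = ∑ V λ x → ∣ kernel y x - kernel y′ x ∣
        regroup : ∀ p ν a → p * (ν * a + ν * a) ≡ 2 * (p * ν) * a
        regroup = solve-∀
        regroup′ : ∀ t a → 2 * (2 * t) * a ≡ 4 * (t * a)
        regroup′ = solve-∀
        pointwise : ∀ x → ∣ mass x y - mass x y′ ∣ ≤ ∣ kernel y x - kernel y′ x ∣ * a + kernel y′ x * ∣ a - a′ ∣
        pointwise x = ℕₚ.≤-trans (ℕₚ.∣-∣-triangle (mass x y) (kernel y′ x * a) (mass x y′))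
          (ℕₚ.≤-reflexive (sym (cong₂ _+_ (ℕₚ.*-distribʳ-∣-∣ a (kernel y x) (kernel y′ x))
                                          (ℕₚ.*-distribˡ-∣-∣ (kernel y′ x) a a′))))
        rescale : total y′ * ∣ a - a′ ∣ ≤ ν * a
        rescale = begin
          total y′ * ∣ a - a′ ∣ ≡⟨ ℕₚ.*-distribˡ-∣-∣ (total y′) a a′ ⟩
          ∣ total y′ * a - total y′ * a′ ∣ ≡⟨ cong (∣ total y′ * a -_∣) (trans (scaled y′) (sym (scaled y))) ⟩
          ∣ total y′ * a - total y * a ∣ ≡⟨ ℕₚ.∣-∣-comm (total y′ * a) (total y * a) ⟩
          ∣ total y * a - total y′ * a ∣ ≡⟨ ℕₚ.*-distribʳ-∣-∣ a (total y) (total y′) ⟨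
          ∣ total y - total y′ ∣ * a ≤⟨ ℕₚ.*-monoˡ-≤ a (∣∑-∑∣ V (kernel y) (kernel y′)) ⟩
          ν * a ∎
        p*ν≤ : p * ν ≤ 2 * total y
        p*ν≤ = begin
          p * ν ≡⟨ ∑-*ˡ p V _ ⟩
          ∑ V (λ x → p * ∣ kernel y x - kernel y′ x ∣) ≤⟨ Σℕ.∑-mono V (kernel-close y~y′) ⟩
          ∑ V (λ x → kernel y x + p ^ s * 𝟙 (ball G s y x)) ≡⟨ trans (Σℕ.∑-∙ V _ _) (cong (total y +_) (sym (∑-*ˡ (p ^ s) V _))) ⟩
          total y + p ^ s * ‖ ball G s y ‖ ≤⟨ ℕₚ.+-monoʳ-≤ (total y) (ℕₚ.≤-trans (ℕₚ.*-monoʳ-≤ (p ^ s) (growth y)) (total-≥ y)) ⟩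
          total y + total y ≡⟨ cong (total y +_) (ℕₚ.+-identityʳ (total y)) ⟨
          2 * total y ∎

      variation-dist : ∀ {i y y′} → Dist≤ G i y y′ → p * variation y y′ ≤ i * (4 * D)
      variation-dist {y = y} here = ℕₚ.≤-trans (ℕₚ.≤-reflexive (trans (cong (p *_) (trans
        (Σℕ.∑-cong V λ x → ℕₚ.∣n-n∣≡0 (mass x y)) (Σℕ.∑-ε V))) (ℕₚ.*-zeroʳ p))) z≤n
      variation-dist {suc i} {y} {y′} (step {y = z} y~z near) = begin
        p * variation y y′ ≤⟨ ℕₚ.*-monoʳ-≤ p triangle ⟩
        p * (variation y z + variation z y′) ≡⟨ ℕₚ.*-distribˡ-+ p (variation y z) (variation z y′) ⟩
        p * variation y z + p * variation z y′ ≤⟨ ℕₚ.+-mono-≤ (variation-adjacent y~z) (variation-dist near) ⟩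
        4 * D + i * (4 * D) ∎
        where
        open ℕₚ.≤-Reasoning
        triangle : variation y y′ ≤ variation y z + variation z y′
        triangle = ℕₚ.≤-trans (Σℕ.∑-mono V λ x → ℕₚ.∣-∣-triangle (mass x y) (mass x z) (mass x y′))
                              (ℕₚ.≤-reflexive (Σℕ.∑-∙ V _ _))

      -- The clusters separating `x` from `y` are at most as many as the variation, which along `R`
      -- steps is at most `R * (4 * D) / p`; the choice of `p` makes this `D / q`.
      coherent : ∀ q R → 1 ≤ R → p ≡ 4 * R * q → ∀ x y → Dist≤ G R x y →
                 q * ∑ clusters (λ C → 𝟙 (C x xor C y)) ≤ D
      coherent q R 1≤R refl x y near = ℕₚ.*-cancelˡ-≤ (4 * R) {{ℕ.>-nonZero (ℕₚ.≤-trans 1≤R (ℕₚ.m≤m+n R _))}} (begin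
        4 * R * (q * ∑ clusters (λ C → 𝟙 (C x xor C y)))
          ≡⟨ ℕₚ.*-assoc (4 * R) q _ ⟨
        p * ∑ clusters (λ C → 𝟙 (C x xor C y))
          ≡⟨ cong (p *_) (trans (Σℕ.∑-map (uncurry cluster) (cartesianProduct V (upTo D)) (λ C → 𝟙 (C x xor C y)))
               (Σℕ.∑-cartesianProduct V (upTo D) (λ (z , t) → 𝟙 ((t <ᵇ mass z x) xor (t <ᵇ mass z y))))) ⟩
        p * ∑ V (λ z → ∑ (upTo D) λ t → 𝟙 ((t <ᵇ mass z x) xor (t <ᵇ mass z y)))
          ≤⟨ ℕₚ.*-monoʳ-≤ p (Σℕ.∑-mono V λ z → count-xor D (mass z x) (mass z y)) ⟩
        p * variation x y
          ≤⟨ variation-dist near ⟩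
        R * (4 * D)
          ≡⟨ regroup R D ⟩
        4 * R * D ∎)
        where
        open ℕₚ.≤-Reasoning
        regroup : ∀ R D → R * (4 * D) ≡ 4 * R * D
        regroup = solve-∀

-- The value contributed by the clusters around a vertex depends on a ball only.

module Patches where

  open OrderedMonoids
  open GraphParameters
  open Decomposition
  open Spreading
  open import Data.Nat using (_+_; _*_; _∸_; _^_; _≤_; _<ᵇ_)

  patchGraph : ∀ {r d} → Patch r d → FiniteGraph
  patchGraph α = record { order = size ; nonempty = Finₚ.nonZeroIndex root ; graph = pgraph }
    where open Patch α

  patchEmbedding : ∀ {r d} {α : Patch r d} {H : FiniteGraph} {x} → BallIso (graph H) α x → Embedding (patchGraph α) H
  patchEmbedding iso = record { to = to ; injective = injective ; adjacent = adj-pres }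
    where open BallIso iso

  module Ambient {V X : Set} {G : Graph V} {K : Graph X} {r : ℕ} {x : V} {to : X → V}
    (to-injective : Injective _≡_ _≡_ to)
    (surjective : ∀ y → Dist≤ G r x y → ∃ λ a → to a ≡ y)
    (adjacent : ∀ a b → Graph._~_ K a b ⇔ Graph._~_ G (to a) (to b)) where

    push-dist : ∀ {i a b} → Dist≤ K i a b → Dist≤ G i (to a) (to b)
    push-dist here         = here
    push-dist (step a~c p) = step (Equivalence.to (adjacent _ _) a~c) (push-dist p)

    -- Walks between points of the ball may leave it, so distances in `K` can exceed those in `G`. A
    -- walk of length `j` from distance `i` stays within `i + j` of `x`, hence in the ball, and can
    -- be lifted.
    lift-dist : ∀ {i j a y} → Dist≤ G i x (to a) → Dist≤ G j (to a) y → i + j ≤ r →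
                ∃[ b ] to b ≡ y × Dist≤ K j a b
    lift-dist {a = a} near here i+j≤r = a , refl , here
    lift-dist {i} {suc j} near (step {y = z} a~z p) i+j≤r
      with c , refl ← surjective z (dist-mono (ℕₚ.≤-trans (ℕₚ.m≤m+n (suc i) j)
                        (ℕₚ.≤-trans (ℕₚ.≤-reflexive (sym (ℕₚ.+-suc i j))) i+j≤r)) (dist-snoc near a~z))
      with b , eq , q ← lift-dist (dist-snoc near a~z) p (ℕₚ.≤-trans (ℕₚ.≤-reflexive (sym (ℕₚ.+-suc i j))) i+j≤r)
      = b , eq , step (Equivalence.from (adjacent _ _) a~z) q

    pull-dist : ∀ {i j a b} → Dist≤ G i x (to a) → Dist≤ G j (to a) (to b) → i + j ≤ r → Dist≤ K j a b
    pull-dist near p i+j≤r with c , eq , q ← lift-dist near p i+j≤r rewrite to-injective eq = q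

  -- The mass near x involves the s-balls of the points of the s-ball, so it is visible in the
  -- 2s-ball.
  module Locality {A : OrderedMonoid} {d : ℕ} (θ : GraphParameter A d) (p s D : ℕ) where

    open OrderedMonoid A
    open GraphParameter θ

    localValue : (H : FiniteGraph) → Vertex H → Carrier
    localValue H x = ∑ (upTo D) λ t → value H (Kernel.cluster (graph H) p s D x t)

    module _ {H : FiniteGraph} {x : Vertex H} {α : Patch (s + s) d} (iso : BallIso (graph H) α x) where
      open BallIso iso
      open Patch α using (pgraph; root)
      open Ambient {G = graph H} {K = pgraph} injective (λ y → Equivalence.to (image y)) adj-pres
      private
        G = graph H
        module KH = Kernel G p s D
        module Kα = Kernel pgraph p s D

      within-image : ∀ {y} → Dist≤ G s y x → ∃ λ a → to a ≡ y
      within-image near = Equivalence.to (image _) (dist-mono (ℕₚ.m≤m+n s s) (dist-sym near))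

      ball-local : ∀ {b} → Dist≤ G s x (to b) → ∀ {i} → i ≤ s → ∀ a → ball G i (to b) (to a) ≡ ball pgraph i b a
      ball-local {b} near {i} i≤s a = does-⇔
        (mk⇔ (λ q → pull-dist near q (ℕₚ.+-monoʳ-≤ s i≤s)) (push-dist))
        (dist? G i (to b) (to a)) (dist? pgraph i b a)

      cappedDist-local : ∀ {b} → Dist≤ G s x (to b) → ∀ i → i ≤ s → ∀ a →
                         KH.cappedDist i (to b) (to a) ≡ Kα.cappedDist i b a
      cappedDist-local near zero    i≤s a = refl
      cappedDist-local near (suc i) i≤s a = cong₂ (λ m c → m ℕ.+ 𝟙 (not c))
        (cappedDist-local near i (ℕₚ.<⇒≤ i≤s) a) (ball-local near (ℕₚ.<⇒≤ i≤s) a)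

      kernel-local : ∀ {b} → Dist≤ G s x (to b) → ∀ a → KH.kernel (to b) (to a) ≡ Kα.kernel b a
      kernel-local near a = cong (λ j → decay p s j ∸ p ^ s) (cappedDist-local near s ℕₚ.≤-refl a)

      total-local : ∀ {b} → Dist≤ G s x (to b) → KH.total (to b) ≡ Kα.total b
      total-local {b} near = trans
        (∑-reindex injective λ w w∉ → KH.kernel-far (dec-false (dist? G s (to b) w)
          λ q → w∉ (Equivalence.to (image w) (dist-trans near q))))
        (Σℕ.∑-cong (allFin _) (kernel-local near))

      -- Near `x` both the kernel and its normalisation are seen by the patch. Farther out the patch
      -- may truncate the ball that determines `scale`, but there the kernel is zero on both sides.
      mass-local : ∀ b → KH.mass x (to b) ≡ Kα.mass root b
      mass-local b with dist? G s (to b) x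
      ... | yes near = cong₂ _*_
        (trans (cong (KH.kernel (to b)) (sym root-pres)) (kernel-local (dist-sym near) root))
        (cong (λ t → D ℕ./ suc (ℕ.pred t)) (total-local (dist-sym near)))
      ... | no far = trans
        (cong (_* KH.scale (to b)) (KH.kernel-far (dec-false (dist? G s (to b) x) far)))
        (sym (cong (_* Kα.scale b) (Kα.kernel-far (dec-false (dist? pgraph s b root)
          λ q → far (subst (Dist≤ G s (to b)) root-pres (push-dist q))))))

      cluster-support : ∀ t v → KH.cluster x t v ≡ true → ∃ λ a → to a ≡ v
      cluster-support t v inside with dist? G s v x
      ... | yes near = within-image near
      ... | no far with () ← trans (sym inside) (cong (λ k → t <ᵇ k * KH.scale v)
                               (KH.kernel-far (dec-false (dist? G s v x) far)))

      localValue-local : localValue H x ≡ localValue (patchGraph α) root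
      localValue-local = ∑-cong (upTo D) λ t → trans
        (restriction (patchEmbedding {H = H} iso) (cluster-support t))
        (extensional (patchGraph α) λ b → cong (t <ᵇ_) (mass-local b))

-- A finite list containing every isomorphism type of patch of bounded size.

module PatchEnumeration where

  open OrderedMonoids
  open GraphParameters
  open Decomposition
  open Patches
  open import Data.Nat using (_+_; _≤_)
  open import Data.List using (concatMap; cartesianProductWith)
  open import Data.List.Membership.Propositional.Properties using (∈-cartesianProductWith⁺; ∈-upTo⁺)
  open import Data.List.Relation.Unary.Any using (index)
  open import Data.Vec using (Vec; []; _∷_)

  lookup-injective : ∀ {X : Set} {xs : List X} → Unique xs → Injective _≡_ _≡_ (lookup xs)
  lookup-injective (x∉ ∷ xs!) {Fin.zero}  {Fin.zero}  eq = refl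
  lookup-injective (x∉ ∷ xs!) {Fin.zero}  {Fin.suc j} eq = contradiction eq (All.lookup x∉ (∈-lookup j))
  lookup-injective (x∉ ∷ xs!) {Fin.suc i} {Fin.zero}  eq = contradiction (sym eq) (All.lookup x∉ (∈-lookup i))
  lookup-injective (x∉ ∷ xs!) {Fin.suc i} {Fin.suc j} eq = cong Fin.suc (lookup-injective xs! eq)

  allVecs : ∀ {X : Set} → List X → ∀ n → List (Vec X n)
  allVecs xs zero    = [] ∷ []
  allVecs xs (suc n) = cartesianProductWith _∷_ xs (allVecs xs n)

  ∈-allVecs : ∀ {X : Set} {xs : List X} → (∀ x → x ∈ xs) → ∀ {n} (v : Vec X n) → v ∈ allVecs xs n
  ∈-allVecs all []      = here refl
  ∈-allVecs all (x ∷ v) = ∈-cartesianProductWith⁺ _∷_ (all x) (∈-allVecs all v)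

  -- Adjacency matrices. A `Graph` carries an arbitrary relation, whereas matrices form a finite
  -- type whose elements can be listed.
  Code : ℕ → Set
  Code n = Vec (Vec Bool n) n

  codes : ∀ n → List (Code n)
  codes n = allVecs (allVecs (false ∷ true ∷ []) n) n

  ∈-codes : ∀ {n} (code : Code n) → code ∈ codes n
  ∈-codes = ∈-allVecs (∈-allVecs λ { false → here refl ; true → there (here refl) })

  bit : ∀ {n} → Code n → Fin n → Fin n → Bool
  bit code a b = Vec.lookup (Vec.lookup code a) b

  -- Requiring both bits and distinct vertices turns every matrix into a simple graph, so that
  -- symmetry and irreflexivity need not be tested.
  codeGraph : ∀ {n} → Code n → Graph (Fin n)
  codeGraph code = record
    { _~_    = λ a b → (bit code a b ≡ true × bit code b a ≡ true) × a ≢ b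
    ; _~?_   = λ a b → ((bit code a b Boolₚ.≟ true) ×-dec (bit code b a Boolₚ.≟ true)) ×-dec ¬? (a Fin.≟ b)
    ; symm   = λ ((ab , ba) , a≢b) → (ba , ab) , a≢b ∘ sym
    ; irrefl = λ a≡b (_ , a≢b) → a≢b a≡b
    }

  module _ (r d : ℕ) where

    Valid : ∀ {n} → Code n → Fin n → Set
    Valid code root = (∀ a → Dist≤ (codeGraph code) r root a) ×
                   (∀ a → ‖ (λ b → does (Graph._~?_ (codeGraph code) a b)) ‖ ≤ d)

    valid? : ∀ {n} (code : Code n) root → Dec (Valid code root)
    valid? code root = Finₚ.all? (dist? (codeGraph code) r root) ×-dec Finₚ.all? (λ a → _ ℕₚ.≤? d)

    codePatch : ∀ {n} (code : Code n) root → Valid code root → Patch r d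
    codePatch {n} code root (radius , degree) = record
      { size      = n
      ; pgraph    = codeGraph code
      ; root      = root
      ; connected = λ a b → r + r , dist-trans (dist-sym (radius a)) (radius b)
      ; degree    = λ a → _ , filter-cardinality (Graph._~?_ (codeGraph code) a) , degree a
      ; radius    = radius
      }

    decode : ∀ {n} → Code n → Fin n → List (Patch r d)
    decode code root with valid? code root
    ... | yes valid = codePatch code root valid ∷ []
    ... | no  _     = []

    rootings : ∀ {n} → Code n → List (Patch r d)
    rootings code = concatMap (decode code) (allFin _)

    patchesOfSize : ℕ → List (Patch r d)
    patchesOfSize n = concatMap rootings (codes n)

    -- An isomorphism type occurs once for each of its matrices and roots; the repetitions are dealt
    -- with when vertices are assigned to patches.
    patches : ℕ → List (Patch r d)
    patches B = concatMap patchesOfSize (upTo (suc B))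

    any-concatMap : ∀ {X : Set} {ℓ} {P : Patch r d → Set ℓ} (f : X → List (Patch r d)) {xs x} →
                    x ∈ xs → Any P (f x) → Any P (concatMap f xs)
    any-concatMap f x∈ p = Anyₚ.concat⁺ (Anyₚ.map⁺ (Any.map (λ { refl → p }) x∈))

    any-decode : ∀ {ℓ} {P : Patch r d → Set ℓ} {n} (code : Code n) root → Valid code root →
                 (∀ valid → P (codePatch code root valid)) → Any P (decode code root)
    any-decode code root valid p with valid? code root
    ... | yes valid′ = here (p valid′)
    ... | no  ¬valid = contradiction valid ¬valid

    module _ (H : FiniteGraph) (degree : MaxDegree≤ (graph H) d) (x : Vertex H) where
      open FiniteGraph H using (_~_; _~?_; irrefl; symm)

      private
        G = graph H
        members : List (Vertex H)
        members = filter (dist? G r x) (allFin (order H))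

        members! : Unique members
        members! = Uniqueₚ.filter⁺ (dist? G r x) (Uniqueₚ.allFin⁺ (order H))

        to : Fin (length members) → Vertex H
        to = lookup members

        to-injective : Injective _≡_ _≡_ to
        to-injective = lookup-injective members!

        image : ∀ y → Dist≤ G r x y ⇔ (∃ λ a → to a ≡ y)
        image y = mk⇔
          (λ near → let y∈ = ∈-filter⁺ (dist? G r x) (∈-allFin y) near
                    in index y∈ , sym (Anyₚ.lookup-index y∈))
          (λ { (a , refl) → proj₂ (∈-filter⁻ (dist? G r x) {xs = allFin (order H)} (∈-lookup {xs = members} a)) })

        code : Code (length members)
        code = Vec.tabulate λ a → Vec.tabulate λ b → does (to a ~? to b)

        bit-code : ∀ a b → bit code a b ≡ does (to a ~? to b)
        bit-code a b = trans (cong (λ row → Vec.lookup row b) (Vecₚ.lookup∘tabulate _ a)) (Vecₚ.lookup∘tabulate _ b)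

        adjacent : ∀ a b → Graph._~_ (codeGraph code) a b ⇔ (to a ~ to b)
        adjacent a b = mk⇔
          (λ ((ab , _) , _) → from-does (to a ~? to b) (trans (sym (bit-code a b)) ab))
          (λ a~b → (trans (bit-code a b) (dec-true (to a ~? to b) a~b) ,
                    trans (bit-code b a) (dec-true (to b ~? to a) (symm a~b))) , λ { refl → irrefl refl a~b })

        root : Fin (length members)
        root = proj₁ (Equivalence.to (image x) here)

        to-root : to root ≡ x
        to-root = proj₂ (Equivalence.to (image x) here)

        open Ambient {G = G} {K = codeGraph code} to-injective (λ y → Equivalence.to (image y)) adjacent

        valid : Valid code root
        valid = (λ a → pull-dist (subst (λ y → Dist≤ G 0 x y) (sym to-root) here)
                         (subst (λ y → Dist≤ G r y (to a)) (sym to-root) (Equivalence.from (image (to a)) (a , refl)))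
                         ℕₚ.≤-refl) ,
                degree-bound
          where
          degree-bound : ∀ a → ‖ (λ b → does (Graph._~?_ (codeGraph code) a b)) ‖ ≤ d
          degree-bound a with m , card , m≤d ← degree (to a) = begin
            ‖ (λ b → does (Graph._~?_ (codeGraph code) a b)) ‖
              ≡⟨ Σℕ.∑-cong (allFin _) (λ b → cong 𝟙 (does-⇔ (adjacent a b) (Graph._~?_ (codeGraph code) a b) (to a ~? to b))) ⟩
            ‖ (λ b → does (to a ~? to b)) ‖
              ≤⟨ ∑-injective to-injective (λ v → 𝟙 (does (to a ~? v))) ⟩
            ‖ (λ v → does (to a ~? v)) ‖
              ≡⟨ cardinality-unique (to a ~?_) card ⟨
            m
              ≤⟨ m≤d ⟩
            d ∎
            where open ℕₚ.≤-Reasoning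

      -- The witness is the adjacency matrix of the ball, its vertices numbered as in `members`.
      patches-cover : ∀ {B} → ‖ ball G r x ‖ ≤ B → Any (λ α → BallIso G α x) (patches B)
      patches-cover {B} small =
        any-concatMap patchesOfSize (∈-upTo⁺ (s≤s (subst (_≤ B) (sym size) small)))
          (any-concatMap rootings (∈-codes code)
            (any-concatMap (decode code) (∈-allFin root)
              (any-decode code root valid λ _ → record
                { to = to ; injective = to-injective ; image = image ; root-pres = to-root ; adj-pres = adjacent })))
        where
        size : length members ≡ ‖ ball G r x ‖
        size = trans (length-∑ members) (∑-filter (dist? G r x) (allFin (order H)) (λ _ → 1))

  -- From `α` to the ball around `x`, back to `β`, and on to the ball around `y`. So a common patch
  -- `β` forces the two vertices to match the same patches.
  ballIso-transport : ∀ {V V′ : Set} {G : Graph V} {G′ : Graph V′} {r d} {α β : Patch r d} {x y} →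
                      BallIso G β x → BallIso G′ β y → BallIso G α x → BallIso G′ α y
  ballIso-transport {G = G} {G′} {r} {α = α} {β} {x} {y} βx βy αx = record
    { to        = βy.to ∘ pick
    ; injective = λ {a} {a′} eq → αx.injective (trans (sym (picked a)) (trans (cong βx.to (βy.injective eq)) (picked a′)))
    ; image     = λ z → mk⇔ (hit z) (λ { (a , refl) → Equivalence.from (βy.image z) (pick a , refl) })
    ; root-pres = trans (cong βy.to (βx.injective (trans (picked _) (trans αx.root-pres (sym βx.root-pres))))) βy.root-pres
    ; adj-pres  = λ a b → mk⇔
        (λ a~b → Equivalence.to (βy.adj-pres _ _) (Equivalence.from (βx.adj-pres _ _)
                   (subst₂ (Graph._~_ G) (sym (picked a)) (sym (picked b)) (Equivalence.to (αx.adj-pres a b) a~b))))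
        (λ p → Equivalence.from (αx.adj-pres a b)
                   (subst₂ (Graph._~_ G) (picked a) (picked b) (Equivalence.to (βx.adj-pres _ _) (Equivalence.from (βy.adj-pres _ _) p))))
    }
    where
    module βx = BallIso βx
    module βy = BallIso βy
    module αx = BallIso αx
    preimage : ∀ a → ∃ λ b → βx.to b ≡ αx.to a
    preimage a = Equivalence.to (βx.image _) (Equivalence.from (αx.image _) (a , refl))
    pick : Fin (Patch.size α) → Fin (Patch.size β)
    pick = proj₁ ∘ preimage
    picked : ∀ a → βx.to (pick a) ≡ αx.to a
    picked = proj₂ ∘ preimage
    hit : ∀ z → Dist≤ G′ r y z → ∃ λ a → βy.to (pick a) ≡ z
    hit z near with b , refl ← Equivalence.to (βy.image z) near
      with a , eq ← Equivalence.to (αx.image _) (Equivalence.from (βx.image _) (b , refl))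
      = a , cong βy.to (βx.injective (trans (picked a) eq))

-- Comparing sums of local quantities by patch frequencies.

module Frequencies where

  open OrderedMonoids
  open GraphParameters
  open PatchEnumeration
  open import Data.Nat using (_+_; _*_; _≤_; ∣_-_∣)

  open Σℕ using (∑)

  -- Two patches of a list may be isomorphic, so every vertex is assigned to the first patch
  -- matching it; the number of vertices assigned to a patch is its count in all graphs of the
  -- sequence, or zero in all of them.
  module FirstMatch {r d : ℕ} (Hs : ℕ → FiniteGraph) (freq : (α : Patch r d) → PatchFrequencyConverges Hs α) where

    private
      V : ∀ k → List (Vertex (Hs k))
      V k = allFin (order (Hs k))

    abstract
      -- No search for isomorphisms: the list behind the patch count contains exactly the matching
      -- vertices.
      iso? : ∀ (α : Patch r d) k x → Dec (BallIso (graph (Hs k)) α x)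
      iso? α k x with proj₁ (proj₂ (freq α)) k
      ... | xs , _ , xs⇔iso , _ = map′ (Equivalence.to (xs⇔iso x)) (Equivalence.from (xs⇔iso x))
                                       (DecMembership._∈?_ Fin._≟_ x xs)

    count : Patch r d → ℕ → ℕ
    count α = proj₁ (freq α)

    count-≡ : ∀ α k → count α k ≡ ‖ does ∘ iso? α k ‖
    count-≡ α k = cardinality-unique (iso? α k) (proj₁ (proj₂ (freq α)) k)

    Mask : Set
    Mask = ∀ k → Vertex (Hs k) → Bool

    Coherent : Mask → Set₁
    Coherent X = ∀ {k l x y} (α : Patch r d) → BallIso (graph (Hs k)) α x → BallIso (graph (Hs l)) α y → X k x ≡ X l y

    assigned rest : Patch r d → Mask → Mask
    assigned α X k x = X k x ∧ does (iso? α k x)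
    rest     α X k   = X k ∖ (does ∘ iso? α k)

    rest-coherent : ∀ α {X} → Coherent X → Coherent (rest α X)
    rest-coherent α X-coherent {k} {l} {x} {y} β βx βy = cong₂ (λ a b → a ∧ not b) (X-coherent β βx βy)
      (does-⇔ (mk⇔ (ballIso-transport βx βy) (ballIso-transport βy βx)) (iso? α k x) (iso? α l y))

    -- The difference of the frequencies in the `k`-th and the `l`-th graph, multiplied by both
    -- orders.
    discrepancy : (ℕ → ℕ) → ℕ → ℕ → ℕ
    discrepancy c k l = ∣ c k * order (Hs l) - c l * order (Hs k) ∣

    -- A single assigned vertex in one of the two graphs forces, by coherence, every vertex matching
    -- `α` to be assigned in all graphs, and then the assigned number is the full count. If there is
    -- none in either graph, both numbers are zero.
    assigned-discrepancy : ∀ α {X} → Coherent X → ∀ k l →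
                           discrepancy (λ j → ‖ assigned α X j ‖) k l ≤ discrepancy (count α) k l
    assigned-discrepancy α {X} X-coherent k l = decide
      (Finₚ.any? λ x → assigned α X k x Boolₚ.≟ true) (Finₚ.any? λ y → assigned α X l y Boolₚ.≟ true)
      where
      full : ∀ {j z} → assigned α X j z ≡ true → ∀ i → ‖ assigned α X i ‖ ≡ count α i
      full {j} {z} hit i = trans (Σℕ.∑-cong (V i) λ x → cong 𝟙 (all-in x)) (sym (count-≡ α i))
        where
        all-in : ∀ x → assigned α X i x ≡ does (iso? α i x)
        all-in x with iso? α i x
        ... | no  _  = Boolₚ.∧-zeroʳ _
        ... | yes αx = trans (Boolₚ.∧-identityʳ _) (trans
          (X-coherent α αx (from-does (iso? α j z) (proj₂ (∧-true⁻ (X j z) hit)))) (proj₁ (∧-true⁻ (X j z) hit)))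
      equal : ∀ {j z} → assigned α X j z ≡ true →
              discrepancy (λ j → ‖ assigned α X j ‖) k l ≤ discrepancy (count α) k l
      equal hit = ℕₚ.≤-reflexive (cong₂ (λ a b → ∣ a * order (Hs l) - b * order (Hs k) ∣) (full hit k) (full hit l))
      none : ∀ j → ¬ (∃ λ x → assigned α X j x ≡ true) → ‖ assigned α X j ‖ ≡ 0
      none j nobody = trans (Σℕ.∑-cong (V j) λ x → cong 𝟙 (Boolₚ.¬-not λ hit → nobody (x , hit))) (Σℕ.∑-ε (V j))
      decide : Dec (∃ λ x → assigned α X k x ≡ true) → Dec (∃ λ y → assigned α X l y ≡ true) →
               discrepancy (λ j → ‖ assigned α X j ‖) k l ≤ discrepancy (count α) k l
      decide (yes (x , hit)) _               = equal hit
      decide (no _)          (yes (y , hit)) = equal hit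
      decide (no k-none)     (no l-none)     = ℕₚ.≤-trans
        (ℕₚ.≤-reflexive (cong₂ (λ a b → ∣ a * order (Hs l) - b * order (Hs k) ∣) (none k k-none) (none l l-none))) z≤n

    module _ {A : OrderedMonoid} where
      open OrderedMonoid A hiding (∑)
      open OrderedMonoid A using () renaming (∑ to ∑ᴬ)

      module _ (u : ∀ k → Vertex (Hs k) → Carrier) (v : Patch r d → Carrier) (b : Patch r d → ℕ) (c : Carrier)
               (local : ∀ α k x → BallIso (graph (Hs k)) α x → u k x ≡ v α)
               (bounded : ∀ α → v α ⊑ b α · c) where

        maskedSum : Mask → ℕ → Carrier
        maskedSum X k = ∑ᴬ (V k) λ x → if X k x then u k x else ε

        maskedSum-split : ∀ α X k → maskedSum X k ≡ ‖ assigned α X k ‖ · v α ∙ maskedSum (rest α X) k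
        maskedSum-split α X k = begin
          maskedSum X k
            ≡⟨ ∑-cong (V k) pointwise ⟩
          ∑ᴬ (V k) (λ x → 𝟙 (assigned α X k x) · v α ∙ (if rest α X k x then u k x else ε))
            ≡⟨ ∑-∙ (V k) _ _ ⟩
          ∑ᴬ (V k) (λ x → 𝟙 (assigned α X k x) · v α) ∙ maskedSum (rest α X) k
            ≡⟨ cong (_∙ maskedSum (rest α X) k) (∑-·ˡ A (V k) _ (v α)) ⟩
          ‖ assigned α X k ‖ · v α ∙ maskedSum (rest α X) k ∎
          where
          open ≡-Reasoning
          pointwise : ∀ x → (if X k x then u k x else ε) ≡
                            𝟙 (assigned α X k x) · v α ∙ (if rest α X k x then u k x else ε)
          pointwise x with X k x | iso? α k x
          ... | false | _      = sym (identityˡ ε)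
          ... | true  | yes αx = trans (local α k x αx) (sym (trans (identityʳ _) (identityʳ (v α))))
          ... | true  | no  _  = sym (identityˡ _)

        -- Splits off the vertices assigned to the first patch. They all have the value `v α`, so
        -- only their numbers matter, and these differ by at most the discrepancy; `bounded`
        -- expresses the error in multiples of `c`. When the list is exhausted, the covering leaves
        -- nothing in the mask.
        compare : ∀ αs {X} → Coherent X →
                  (∀ k x → X k x ≡ true → Any (λ α → BallIso (graph (Hs k)) α x) αs) → ∀ k l →
                  order (Hs l) · maskedSum X k ⊑
                  order (Hs k) · maskedSum X l ∙ ∑ αs (λ α → discrepancy (count α) k l * b α) · c
        compare []       {X} X-coherent cover k l = begin
          order (Hs l) · maskedSum X k
            ≡⟨ cong (order (Hs l) ·_) (trans (∑-cong (V k) outside) (∑-ε (V k))) ⟩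
          order (Hs l) · ε
            ≡⟨ ·-ε (order (Hs l)) ⟩
          ε
            ≲⟨ ε-least _ ⟩
          order (Hs k) · maskedSum X l ∙ 0 · c ∎
          where
          open ⊑-Reasoning
          outside : ∀ x → (if X k x then u k x else ε) ≡ ε
          outside x with X k x in eq
          ... | false = refl
          ... | true  with () ← cover k x eq
        compare (α ∷ αs) {X} X-coherent cover k l = begin
          Nl · maskedSum X k
            ≡⟨ cong (Nl ·_) (maskedSum-split α X k) ⟩
          Nl · (ek · v α ∙ Sk)
            ≡⟨ ×-distrib-+ _ _ Nl ⟩
          Nl · ek · v α ∙ Nl · Sk
            ≲⟨ ∙-mono head (compare αs (rest-coherent α X-coherent) cover′ k l) ⟩
          (Nk · el · v α ∙ (δ * b α) · c) ∙ (Nk · Sl ∙ Σδ · c)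
            ≡⟨ interchange _ _ _ _ ⟩
          (Nk · el · v α ∙ Nk · Sl) ∙ ((δ * b α) · c ∙ Σδ · c)
            ≡⟨ cong₂ _∙_ (trans (sym (×-distrib-+ _ _ Nk)) (cong (Nk ·_) (sym (maskedSum-split α X l))))
                         (sym (×-homo-+ c (δ * b α) Σδ)) ⟩
          Nk · maskedSum X l ∙ (δ * b α + Σδ) · c ∎
          where
          open ⊑-Reasoning
          Nk = order (Hs k)
          Nl = order (Hs l)
          ek = ‖ assigned α X k ‖
          el = ‖ assigned α X l ‖
          Sk = maskedSum (rest α X) k
          Sl = maskedSum (rest α X) l
          δ  = discrepancy (count α) k l
          Σδ = ∑ αs λ α → discrepancy (count α) k l * b α
          head : Nl · ek · v α ⊑ Nk · el · v α ∙ (δ * b α) · c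
          head = begin
            Nl · ek · v α ≡⟨ ×-assocˡ (v α) Nl ek ⟩
            (Nl * ek) · v α ≲⟨ ·-monoˡ (v α) numbers ⟩
            (Nk * el + δ) · v α ≡⟨ ×-homo-+ (v α) (Nk * el) δ ⟩
            (Nk * el) · v α ∙ δ · v α ≲⟨ ∙-mono ⊑-refl (·-monoʳ δ (bounded α)) ⟩
            (Nk * el) · v α ∙ δ · b α · c ≡⟨ cong₂ _∙_ (sym (×-assocˡ (v α) Nk el)) (×-assocˡ c δ (b α)) ⟩
            Nk · el · v α ∙ (δ * b α) · c ∎
            where
            numbers : Nl * ek ≤ Nk * el + δ
            numbers = ℕₚ.≤-trans (ℕₚ.≤-reflexive (ℕₚ.*-comm Nl ek))
              (ℕₚ.≤-trans (ℕₚ.m≤n+∣m-n∣ (ek * Nl) (el * Nk))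
                (ℕₚ.+-mono-≤ (ℕₚ.≤-reflexive (ℕₚ.*-comm el Nk)) (assigned-discrepancy α X-coherent k l)))
          cover′ : ∀ k x → rest α X k x ≡ true → Any (λ α → BallIso (graph (Hs k)) α x) αs
          cover′ k x eq with cover k x (proj₁ (∧-true⁻ (X k x) eq))
          ... | there later = later
          ... | here αx with () ← trans (sym (proj₂ (∧-true⁻ (X k x) eq))) (cong not (dec-true (iso? α k x) αx))

-- Rational arithmetic, and Cauchy properties cleared of denominators.

module Rationals where

  open import Data.Nat using (NonZero)
  open import Data.Integer using (ℤ; +_; -[1+_]; +≤+)
  open import Data.Rational using (mkℚ; _+_; _*_; _-_; -_; _≤_; _<_; _/_; *≤*)

  open +-*-Solver using (solve; _:+_; _:*_; _:-_; :-_; _:=_; con)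

  abstract
    ι : ℕ → ℚ
    ι n = + n / 1

    inv : ℕ → ℚ
    inv k = + 1 / suc k

    ι-def : ∀ n → ι n ≡ + n / 1
    ι-def n = refl

    ι-0 : ι 0 ≡ 0ℚ
    ι-0 = refl

    ι-1 : ι 1 ≡ 1ℚ
    ι-1 = refl

    toℚᵘ-/ : ∀ i n → ℚ.toℚᵘ (i / suc n) ℚᵘ.≃ ℚᵘ.mkℚᵘ i n
    toℚᵘ-/ i n = ℚₚ.toℚᵘ-fromℚᵘ (ℚᵘ.mkℚᵘ i n)

    ι-+ : ∀ m n → ι (m ℕ.+ n) ≡ ι m + ι n
    ι-+ m n = ℚₚ.toℚᵘ-injective (begin
      ℚ.toℚᵘ (ι (m ℕ.+ n)) ≈⟨ toℚᵘ-/ (+ (m ℕ.+ n)) 0 ⟩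
      ℚᵘ.mkℚᵘ (+ (m ℕ.+ n)) 0 ≈⟨ ℚᵘ.*≡* (cong (ℤ._* (+ 1)) (sym (trans (cong₂ ℤ._+_ (ℤₚ.*-identityʳ (+ m)) (ℤₚ.*-identityʳ (+ n))) refl))) ⟩
      ℚᵘ.mkℚᵘ (+ m) 0 ℚᵘ.+ ℚᵘ.mkℚᵘ (+ n) 0 ≈⟨ ℚᵘₚ.+-cong (toℚᵘ-/ (+ m) 0) (toℚᵘ-/ (+ n) 0) ⟨
      ℚ.toℚᵘ (ι m) ℚᵘ.+ ℚ.toℚᵘ (ι n) ≈⟨ ℚₚ.toℚᵘ-homo-+ (ι m) (ι n) ⟨
      ℚ.toℚᵘ (ι m + ι n) ∎)
      where open ℚᵘₚ.≃-Reasoning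

    ι-* : ∀ m n → ι (m ℕ.* n) ≡ ι m * ι n
    ι-* m n = ℚₚ.toℚᵘ-injective (begin
      ℚ.toℚᵘ (ι (m ℕ.* n)) ≈⟨ toℚᵘ-/ (+ (m ℕ.* n)) 0 ⟩
      ℚᵘ.mkℚᵘ (+ (m ℕ.* n)) 0 ≈⟨ ℚᵘ.*≡* (cong (ℤ._* (+ 1)) (ℤₚ.pos-* m n)) ⟩
      ℚᵘ.mkℚᵘ (+ m) 0 ℚᵘ.* ℚᵘ.mkℚᵘ (+ n) 0 ≈⟨ ℚᵘₚ.*-cong (toℚᵘ-/ (+ m) 0) (toℚᵘ-/ (+ n) 0) ⟨
      ℚ.toℚᵘ (ι m) ℚᵘ.* ℚ.toℚᵘ (ι n) ≈⟨ ℚₚ.toℚᵘ-homo-* (ι m) (ι n) ⟨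
      ℚ.toℚᵘ (ι m * ι n) ∎)
      where open ℚᵘₚ.≃-Reasoning

    /-cancel : ∀ m n .{{_ : NonZero n}} → (+ m / n) * ι n ≡ ι m
    /-cancel m n@(suc k) = ℚₚ.toℚᵘ-injective (begin
      ℚ.toℚᵘ ((+ m / n) * ι n) ≈⟨ ℚₚ.toℚᵘ-homo-* (+ m / n) (ι n) ⟩
      ℚ.toℚᵘ (+ m / n) ℚᵘ.* ℚ.toℚᵘ (ι n) ≈⟨ ℚᵘₚ.*-cong (toℚᵘ-/ (+ m) k) (toℚᵘ-/ (+ n) 0) ⟩
      ℚᵘ.mkℚᵘ (+ m) k ℚᵘ.* ℚᵘ.mkℚᵘ (+ n) 0 ≈⟨ ℚᵘ.*≡* (trans (ℤₚ.*-identityʳ _) (cong (λ e → + m ℤ.* + e) (sym (ℕₚ.*-identityʳ n)))) ⟩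
      ℚᵘ.mkℚᵘ (+ m) 0 ≈⟨ toℚᵘ-/ (+ m) 0 ⟨
      ℚ.toℚᵘ (ι m) ∎)
      where open ℚᵘₚ.≃-Reasoning

    ι-mono : ∀ {m n} → m ℕ.≤ n → ι m ≤ ι n
    ι-mono {m} {n} m≤n = ℚₚ.toℚᵘ-cancel-≤ (ℚᵘₚ.≤-respˡ-≃ (ℚᵘₚ.≃-sym (toℚᵘ-/ (+ m) 0)) (ℚᵘₚ.≤-respʳ-≃ (ℚᵘₚ.≃-sym (toℚᵘ-/ (+ n) 0))
      (ℚᵘ.*≤* (ℤₚ.*-monoʳ-≤-nonNeg (+ 1) (+≤+ m≤n)))))

    ι-cancel : ∀ {m n} → ι m ≤ ι n → m ℕ.≤ n
    ι-cancel {m} {n} m≤n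
      with ℚᵘ.*≤* p ← ℚᵘₚ.≤-respˡ-≃ (toℚᵘ-/ (+ m) 0) (ℚᵘₚ.≤-respʳ-≃ (toℚᵘ-/ (+ n) 0) (ℚₚ.toℚᵘ-mono-≤ m≤n))
      = ℤₚ.drop‿+≤+ (subst₂ ℤ._≤_ (ℤₚ.*-identityʳ (+ m)) (ℤₚ.*-identityʳ (+ n)) p)

    inv-cancel : ∀ k → inv k * ι (suc k) ≡ 1ℚ
    inv-cancel k = /-cancel 1 (suc k)

    upper-bound : ∀ x → ∃[ n ] x ≤ ι n
    upper-bound x@(mkℚ (+ n) d-1 _) = n , ℚₚ.toℚᵘ-cancel-≤ (ℚᵘₚ.≤-respʳ-≃ (ℚᵘₚ.≃-sym (toℚᵘ-/ (+ n) 0))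
      (ℚᵘ.*≤* (ℤₚ.*-monoˡ-≤-nonNeg (+ n) (+≤+ (s≤s z≤n)))))
    upper-bound x@(mkℚ -[1+ n ] d-1 _) = 0 , ℚₚ.toℚᵘ-cancel-≤ (ℚᵘₚ.≤-respʳ-≃ (ℚᵘₚ.≃-sym (toℚᵘ-/ (+ 0) 0)) (ℚᵘ.*≤* ℤ.-≤+))

  ι-nonneg : ∀ n → 0ℚ ≤ ι n
  ι-nonneg n = subst (_≤ ι n) ι-0 (ι-mono z≤n)

  ι-pos : ∀ {n} → 1 ℕ.≤ n → 0ℚ < ι n
  ι-pos {n} 1≤n = ℚₚ.<-≤-trans (ℚₚ.positive⁻¹ 1ℚ) (subst (_≤ ι n) ι-1 (ι-mono 1≤n))

  *-mono : ∀ {a b c d} → 0ℚ ≤ a → a ≤ b → 0ℚ ≤ c → c ≤ d → a * c ≤ b * d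
  *-mono {a} {b} {c} {d} 0≤a a≤b 0≤c c≤d = ℚₚ.≤-trans
    (ℚₚ.*-monoʳ-≤-nonNeg c {{ℚ.nonNegative 0≤c}} a≤b)
    (ℚₚ.*-monoˡ-≤-nonNeg b {{ℚ.nonNegative (ℚₚ.≤-trans 0≤a a≤b)}} c≤d)

  *-nonneg : ∀ {a b} → 0ℚ ≤ a → 0ℚ ≤ b → 0ℚ ≤ a * b
  *-nonneg {a} {b} 0≤a 0≤b = subst (_≤ a * b) (ℚₚ.*-zeroʳ a) (ℚₚ.*-monoˡ-≤-nonNeg a {{ℚ.nonNegative 0≤a}} 0≤b)

  *-pos : ∀ {a b} → 0ℚ < a → 0ℚ < b → 0ℚ < a * b
  *-pos {a} {b} 0<a 0<b = subst (_< a * b) (ℚₚ.*-zeroʳ a) (ℚₚ.*-monoʳ-<-pos a {{ℚ.positive 0<a}} 0<b)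

  *-cancel-≤ : ∀ {a b} c → 0ℚ < c → a * c ≤ b * c → a ≤ b
  *-cancel-≤ c 0<c = ℚₚ.*-cancelʳ-≤-pos c {{ℚ.positive 0<c}}

  inv-pos : ∀ k → 0ℚ < inv k
  inv-pos k = ℚₚ.*-cancelʳ-<-nonNeg (ι (suc k)) {{ℚ.nonNegative (ι-nonneg (suc k))}}
    (subst₂ _<_ (sym (ℚₚ.*-zeroˡ (ι (suc k)))) (sym (inv-cancel k)) (ℚₚ.positive⁻¹ 1ℚ))

  inv-anti : ∀ {j k} → j ℕ.≤ k → inv k ≤ inv j
  inv-anti {j} {k} j≤k = *-cancel-≤ (ι (suc k)) (ι-pos (s≤s z≤n)) (begin
    inv k * ι (suc k) ≡⟨ trans (inv-cancel k) (sym (inv-cancel j)) ⟩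
    inv j * ι (suc j) ≤⟨ ℚₚ.*-monoˡ-≤-nonNeg (inv j) {{ℚ.nonNegative (ℚₚ.<⇒≤ (inv-pos j))}} (ι-mono (s≤s j≤k)) ⟩
    inv j * ι (suc k) ∎)
    where open ℚₚ.≤-Reasoning

  small-inv : ∀ ε → 0ℚ < ε → ∃[ k ] inv k < ε
  small-inv ε 0<ε with upper-bound ((ℚ.1/ ε) {{ℚₚ.pos⇒nonZero ε {{ℚ.positive 0<ε}}}})
  ... | n , 1/ε≤n = n , (begin-strict
    inv n ≡⟨ ℚₚ.*-identityʳ (inv n) ⟨
    inv n * 1ℚ ≡⟨ cong (inv n *_) (ℚₚ.*-inverseˡ ε) ⟨
    inv n * (ℚ.1/ ε * ε) ≤⟨ ℚₚ.*-monoˡ-≤-nonNeg (inv n) {{ℚ.nonNegative (ℚₚ.<⇒≤ (inv-pos n))}}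
                                      (ℚₚ.*-monoʳ-≤-nonNeg ε {{ℚ.nonNegative (ℚₚ.<⇒≤ 0<ε)}} 1/ε≤n) ⟩
    inv n * (ι n * ε) <⟨ ℚₚ.*-monoʳ-<-pos (inv n) {{ℚ.positive (inv-pos n)}}
                                      (ℚₚ.*-monoˡ-<-pos ε {{ℚ.positive 0<ε}} n<1+n) ⟩
    inv n * (ι (suc n) * ε) ≡⟨ ℚₚ.*-assoc (inv n) (ι (suc n)) ε ⟨
    inv n * ι (suc n) * ε ≡⟨ cong (_* ε) (inv-cancel n) ⟩
    1ℚ * ε ≡⟨ ℚₚ.*-identityˡ ε ⟩
    ε ∎)
    where
    open ℚₚ.≤-Reasoning
    instance
      ε-nz = ℚₚ.pos⇒nonZero ε {{ℚ.positive 0<ε}}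
    n<1+n : ι n < ι (suc n)
    n<1+n = subst₂ _<_ (ℚₚ.+-identityˡ (ι n)) (trans (cong (_+ ι n) (sym ι-1)) (sym (ι-+ 1 n))) (ℚₚ.+-monoˡ-< (ι n) (ℚₚ.positive⁻¹ 1ℚ))

  half : ℚ → ℚ
  half ε = ℚ.½ * ε

  half-pos : ∀ {ε} → 0ℚ < ε → 0ℚ < half ε
  half-pos = *-pos (ℚₚ.positive⁻¹ ℚ.½)

  half+half : ∀ ε → half ε + half ε ≡ ε
  half+half = solve 1 (λ e → con ℚ.½ :* e :+ con ℚ.½ :* e := e) refl

  -- Rearranges linear inequalities: `z` is added on both sides, and the ring solver proves the two
  -- equations.
  shift-< : ∀ {p q p′ q′} z → p < q → z + p ≡ p′ → z + q ≡ q′ → p′ < q′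
  shift-< z p<q refl refl = ℚₚ.+-monoʳ-< z p<q

  shift-≤ : ∀ {p q p′ q′} z → p ≤ q → z + p ≡ p′ → z + q ≡ q′ → p′ ≤ q′
  shift-≤ z p≤q refl refl = ℚₚ.+-monoʳ-≤ z p≤q

  p≤∣p∣ : ∀ p → p ≤ ℚ.∣ p ∣
  p≤∣p∣ p with ℚₚ.≤-total 0ℚ p
  ... | inj₁ 0≤p = ℚₚ.≤-reflexive (sym (ℚₚ.0≤p⇒∣p∣≡p 0≤p))
  ... | inj₂ p≤0 = ℚₚ.≤-trans p≤0 (ℚₚ.0≤∣p∣ p)

  ∣-∣-comm : ∀ x y → ℚ.∣ x - y ∣ ≡ ℚ.∣ y - x ∣
  ∣-∣-comm x y = trans (sym (ℚₚ.∣-p∣≡∣p∣ (x - y))) (cong ℚ.∣_∣ (solve 2 (λ x y → :- (x :- y) := y :- x) refl x y))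

  ∣∣-upper : ∀ {x y ε} → ℚ.∣ x - y ∣ < ε → x < y + ε
  ∣∣-upper {x} {y} {ε} close = shift-< y (ℚₚ.≤-<-trans (p≤∣p∣ (x - y)) close)
    (solve 2 (λ x y → y :+ (x :- y) := x) refl x y) refl

  ∣∣-lower : ∀ {x y ε} → ℚ.∣ x - y ∣ < ε → y < x + ε
  ∣∣-lower {x} {y} {ε} close = ∣∣-upper {y} {x} (subst (_< ε) (∣-∣-comm x y) close)

  ∣∣-intro : ∀ {x y ε} → x < y + ε → y < x + ε → ℚ.∣ x - y ∣ < ε
  ∣∣-intro {x} {y} {ε} x<y+ε y<x+ε with ℚₚ.∣p∣≡p∨∣p∣≡-p (x - y)
  ... | inj₁ eq = subst (_< ε) (sym eq) (shift-< (- y) x<y+ε (ℚₚ.+-comm (- y) x) (solve 2 (λ y ε → :- y :+ (y :+ ε) := ε) refl y ε))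
  ... | inj₂ eq = subst (_< ε) (sym eq) (shift-< (- x) y<x+ε (solve 2 (λ x y → :- x :+ y := :- (x :- y)) refl x y)
                                                           (solve 2 (λ x ε → :- x :+ (x :+ ε) := ε) refl x ε))

  -- The terms are constant sequences, so comparing both with a single late approximation of `L`
  -- gives an inequality between rationals.
  limit⇒cauchy : ∀ {a : ℕ → ℚ} → LimitExists (λ n → fromℚ (a n)) → ∀ ε → 0ℚ < ε →
                 ∃[ N ] ∀ m n → N ℕ.≤ m → N ℕ.≤ n → a m < a n + ε
  limit⇒cauchy {a} (L , a⟶L) ε 0<ε with a⟶L (half ε) (half-pos 0<ε)
  ... | N , near = N , λ m n N≤m N≤n → bound (proj₂ (near m N≤m)) (proj₁ (near n N≤n))
    where
    bound : ∀ {m n} → fromℚ (a m) <ᴿ L +ᴿ fromℚ (half ε) → L -ᴿ fromℚ (half ε) <ᴿ fromℚ (a n) → a m < a n + ε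
    bound {m} {n} (δ , 0<δ , K , up) (δ′ , 0<δ′ , K′ , low) = shift-< (- ℓ + half ε)
      (ℚₚ.+-mono-< (ℚₚ.<-trans (shift-< (a m) 0<δ (ℚₚ.+-identityʳ (a m)) refl) (up k (ℕₚ.m≤m⊔n K K′)))
                   (ℚₚ.<-trans (shift-< (ℓ - half ε) 0<δ′ (ℚₚ.+-identityʳ (ℓ - half ε)) refl) (low k (ℕₚ.m≤n⊔m K K′))))
      (solve 3 (λ l h x → (:- l :+ h) :+ (x :+ (l :- h)) := x) refl ℓ (half ε) (a m))
      (trans (solve 3 (λ l h y → (:- l :+ h) :+ ((l :+ h) :+ y) := y :+ (h :+ h)) refl ℓ (half ε) (a n))
             (cong (λ e → a n + e) (half+half ε)))
      where
      k = K ℕ.⊔ K′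
      ℓ = seq L k

  fraction-≤ : ∀ a b c d q .{{_ : NonZero b}} .{{_ : NonZero d}} →
               + a / b ≤ + c / d + inv q → suc q ℕ.* (a ℕ.* d) ℕ.≤ suc q ℕ.* (c ℕ.* b) ℕ.+ b ℕ.* d
  fraction-≤ a b c d q x≤y+ε = ι-cancel (begin
    ι (suc q ℕ.* (a ℕ.* d))
      ≡⟨ trans (ι-* (suc q) (a ℕ.* d)) (cong (ι (suc q) *_) (trans (ι-* a d) (cong (_* ι d) (sym (/-cancel a b))))) ⟩
    ι (suc q) * (x * ι b * ι d)
      ≡⟨ solve 4 (λ Q x b d → Q :* (x :* b :* d) := x :* (Q :* b :* d)) refl (ι (suc q)) x (ι b) (ι d) ⟩
    x * (ι (suc q) * ι b * ι d)
      ≤⟨ ℚₚ.*-monoʳ-≤-nonNeg (ι (suc q) * ι b * ι d)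
           {{ℚ.nonNegative (*-nonneg (*-nonneg (ι-nonneg (suc q)) (ι-nonneg b)) (ι-nonneg d))}} x≤y+ε ⟩
    (y + inv q) * (ι (suc q) * ι b * ι d)
      ≡⟨ solve 5 (λ y e Q b d → (y :+ e) :* (Q :* b :* d) := Q :* (y :* d :* b) :+ (e :* Q) :* (b :* d)) refl
           y (inv q) (ι (suc q)) (ι b) (ι d) ⟩
    ι (suc q) * (y * ι d * ι b) + (inv q * ι (suc q)) * (ι b * ι d)
      ≡⟨ cong₂ _+_ (cong (λ t → ι (suc q) * (t * ι b)) (/-cancel c d))
                   (trans (cong (_* (ι b * ι d)) (inv-cancel q)) (ℚₚ.*-identityˡ (ι b * ι d))) ⟩
    ι (suc q) * (ι c * ι b) + ι b * ι d
      ≡⟨ cong₂ _+_ (trans (ι-* (suc q) (c ℕ.* b)) (cong (ι (suc q) *_) (ι-* c b))) (ι-* b d) ⟨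
    ι (suc q ℕ.* (c ℕ.* b)) + ι (b ℕ.* d)
      ≡⟨ ι-+ (suc q ℕ.* (c ℕ.* b)) (b ℕ.* d) ⟨
    ι (suc q ℕ.* (c ℕ.* b) ℕ.+ b ℕ.* d) ∎)
    where
    open ℚₚ.≤-Reasoning
    x = + a / b
    y = + c / d

  ∣-∣≤ : ∀ {m n e} → m ℕ.≤ n ℕ.+ e → n ℕ.≤ m ℕ.+ e → ℕ.∣ m - n ∣ ℕ.≤ e
  ∣-∣≤ {m} {n} {e} m≤ n≤ with ℕₚ.≤-total m n
  ... | inj₁ m≤n = ℕₚ.≤-trans (ℕₚ.≤-reflexive (ℕₚ.m≤n⇒∣m-n∣≡n∸m m≤n)) (ℕₚ.m≤n+o⇒m∸n≤o n m n≤)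
  ... | inj₂ n≤m = ℕₚ.≤-trans (ℕₚ.≤-reflexive (ℕₚ.m≤n⇒∣n-m∣≡n∸m n≤m)) (ℕₚ.m≤n+o⇒m∸n≤o m n m≤)

  /∣∣-≤ : ∀ a c q (H K : FiniteGraph) → (a /∣ H ∣) < (c /∣ K ∣) + inv q →
          suc q ℕ.* (a ℕ.* order K) ℕ.≤ suc q ℕ.* (c ℕ.* order H) ℕ.+ order H ℕ.* order K
  /∣∣-≤ a c q H K less = fraction-≤ a (order H) c (order K) q {{FiniteGraph.nonempty H}} {{FiniteGraph.nonempty K}}
    (ℚₚ.<⇒≤ less)

  -- Convergence of a patch frequency in the form of a bound on its `discrepancy`.
  frequency-cauchy : ∀ {F r d} {α : Patch r d} (p : PatchFrequencyConverges F α) → ∀ q →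
    ∃[ N ] ∀ m n → N ℕ.≤ m → N ℕ.≤ n →
    suc q ℕ.* ℕ.∣ proj₁ p m ℕ.* order (F n) - proj₁ p n ℕ.* order (F m) ∣ ℕ.≤ order (F m) ℕ.* order (F n)
  frequency-cauchy {F} (c , _ , lim) q = proj₁ near , λ m n N≤m N≤n → subst (ℕ._≤ order (F m) ℕ.* order (F n))
        (sym (ℕₚ.*-distribˡ-∣-∣ (suc q) (c m ℕ.* order (F n)) (c n ℕ.* order (F m))))
        (∣-∣≤ (/∣∣-≤ (c m) (c n) q (F m) (F n) (proj₂ near m n N≤m N≤n))
              (subst (λ t → suc q ℕ.* (c n ℕ.* order (F m)) ℕ.≤ suc q ℕ.* (c m ℕ.* order (F n)) ℕ.+ t)
                (ℕₚ.*-comm (order (F n)) (order (F m)))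
                (/∣∣-≤ (c n) (c m) q (F n) (F m) (proj₂ near n m N≤n N≤m))))
    where
    near : ∃[ N ] ∀ m n → N ℕ.≤ m → N ℕ.≤ n → (c m /∣ F m ∣) < (c n /∣ F n ∣) + inv q
    near = limit⇒cauchy {λ n → c n /∣ F n ∣} lim (inv q) (inv-pos q)

-- The values of two graphs of the sequence compared at a given precision.

module Comparisons where

  open OrderedMonoids
  open GraphParameters
  open Decomposition
  open Spreading
  open Patches
  open PatchEnumeration
  open Frequencies
  open Rationals
  open import Data.Nat using (_+_; _*_; _^_; _!; _⊔_; _≤_; _<_)
  open import Data.Integer.Base using (+_)

  open Σℕ using (∑)

  ι-^ : ∀ m n → ι (m ^ n) ≡ ι m ^ℚ n
  ι-^ m zero    = ι-1
  ι-^ m (suc n) = trans (ι-* m (m ^ n)) (cong (ι m ℚ.*_) (ι-^ m n))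

  ^ℚ-distrib-* : ∀ a b n → (a ℚ.* b) ^ℚ n ≡ (a ^ℚ n) ℚ.* (b ^ℚ n)
  ^ℚ-distrib-* a b zero    = sym (ℚₚ.*-identityˡ 1ℚ)
  ^ℚ-distrib-* a b (suc n) = trans (cong (a ℚ.* b ℚ.*_) (^ℚ-distrib-* a b n))
    (solve 4 (λ a b c d → a :* b :* (c :* d) := (a :* c) :* (b :* d)) refl a b (a ^ℚ n) (b ^ℚ n))
    where open +-*-Solver

  -- Bernoulli's inequality for `1 + 1 / t`, multiplied by `t ^ (s + 1)`.
  bernoulli : ∀ t s → t ^ s * (t + s) ≤ t * suc t ^ s
  bernoulli t zero    = ℕₚ.≤-reflexive (trans (ℕₚ.*-identityˡ (t + 0)) (trans (ℕₚ.+-identityʳ t) (sym (ℕₚ.*-identityʳ t))))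
  bernoulli t (suc s) = begin
    t * t ^ s * (t + suc s) ≤⟨ ℕₚ.m≤m+n _ (t ^ s * s) ⟩
    t * t ^ s * (t + suc s) + t ^ s * s ≡⟨ regroup t (t ^ s) s ⟩
    suc t * (t ^ s * (t + s)) ≤⟨ ℕₚ.*-monoʳ-≤ (suc t) (bernoulli t s) ⟩
    suc t * (t * suc t ^ s) ≡⟨ exchange (suc t) t (suc t ^ s) ⟩
    t * (suc t * suc t ^ s) ∎
    where
    open ℕₚ.≤-Reasoning
    regroup : ∀ t a s → t * a * (t + suc s) + a * s ≡ suc t * (a * (t + s))
    regroup = solve-∀
    exchange : ∀ a b c → a * (b * c) ≡ b * (a * c)
    exchange = solve-∀

  *^-distrib : ∀ a b n → (a * b) ^ n ≡ a ^ n * b ^ n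
  *^-distrib a b zero    = refl
  *^-distrib a b (suc n) = trans (cong (a * b *_) (*^-distrib a b n)) (regroup a b (a ^ n) (b ^ n))
    where
    regroup : ∀ a b c d → a * b * (c * d) ≡ a * c * (b * d)
    regroup = solve-∀

  -- With t = 2q + 1 one has f(n) (2q)^n ≤ c t^n, while (c + 1) t^s ≤ (t + 1)^s for s = t (c + 1).
  subexponential-slow : ∀ {f} → SubexponentialGrowth f → ∀ q → 1 ≤ q → ∃[ s ] 1 ≤ s × q ^ s * suc (f s) ≤ suc q ^ s
  subexponential-slow {f} growth (suc q₀) _ = s , s≤s z≤n , ℕₚ.*-cancelˡ-≤ (2 ^ s) {{ℕₚ.m^n≢0 2 s}} (begin
    2 ^ s * (q ^ s * suc (f s)) ≡⟨ trans (sym (ℕₚ.*-assoc (2 ^ s) (q ^ s) (suc (f s)))) (cong (_* suc (f s)) (sym (*^-distrib 2 q s))) ⟩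
    (2 * q) ^ s * suc (f s) ≡⟨ ℕₚ.*-suc ((2 * q) ^ s) (f s) ⟩
    (2 * q) ^ s + (2 * q) ^ s * f s ≤⟨ ℕₚ.+-mono-≤ (ℕₚ.^-monoˡ-≤ s (ℕₚ.n≤1+n (2 * q))) bound ⟩
    t ^ s + c * t ^ s ≤⟨ ℕₚ.*-cancelˡ-≤ t bernoulli′ ⟩
    suc t ^ s ≡⟨ cong (_^ s) (double q₀) ⟩
    (2 * suc q) ^ s ≡⟨ *^-distrib 2 (suc q) s ⟩
    2 ^ s * suc q ^ s ∎)
    where
    open ℕₚ.≤-Reasoning
    q = suc q₀
    t = suc (2 * q)
    δ : ℚ
    δ = inv (ℕ.pred (2 * q))
    subexp : ∃[ C ] (0ℚ ℚ.< C × (∀ n → 1 ≤ n → ℚ._/_ (+ f n) 1 ℚ.≤ C ℚ.* ((1ℚ ℚ.+ δ) ^ℚ n)))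
    subexp = growth δ (inv-pos _)
    c s : ℕ
    c = proj₁ (upper-bound (proj₁ subexp))
    s = t * suc c
    double : ∀ q₀ → suc (suc (2 * suc q₀)) ≡ 2 * suc (suc q₀)
    double = solve-∀
    base : (1ℚ ℚ.+ δ) ℚ.* ι (2 * q) ≡ ι t
    base = trans (ℚₚ.*-distribʳ-+ (ι (2 * q)) 1ℚ δ)
      (trans (cong₂ ℚ._+_ (ℚₚ.*-identityˡ (ι (2 * q))) (inv-cancel _))
        (trans (ℚₚ.+-comm (ι (2 * q)) 1ℚ) (trans (cong (ℚ._+ ι (2 * q)) (sym ι-1)) (sym (ι-+ 1 (2 * q))))))
    bound : (2 * q) ^ s * f s ≤ c * t ^ s
    bound = ι-cancel (ℚₚ.≤-trans (ℚₚ.≤-reflexive left) (ℚₚ.≤-trans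
      (ℚₚ.*-monoʳ-≤-nonNeg (ι ((2 * q) ^ s)) {{ℚ.nonNegative (ι-nonneg ((2 * q) ^ s))}}
        (ℚₚ.≤-trans (proj₂ (proj₂ subexp) s (s≤s z≤n))
          (ℚₚ.*-monoʳ-≤-nonNeg ((1ℚ ℚ.+ δ) ^ℚ s) {{ℚ.nonNegative (power-nonneg s)}} (proj₂ (upper-bound (proj₁ subexp))))))
      (ℚₚ.≤-reflexive right)))
      where
      power-nonneg : ∀ n → 0ℚ ℚ.≤ (1ℚ ℚ.+ δ) ^ℚ n
      power-nonneg zero    = ℚₚ.<⇒≤ (ℚₚ.positive⁻¹ 1ℚ)
      power-nonneg (suc n) = *-nonneg
        (ℚₚ.<⇒≤ (ℚₚ.+-mono-< (ℚₚ.positive⁻¹ 1ℚ) (inv-pos (ℕ.pred (2 * q))))) (power-nonneg n)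
      left : ι ((2 * q) ^ s * f s) ≡ ℚ._/_ (+ f s) 1 ℚ.* ι ((2 * q) ^ s)
      left = trans (ι-* ((2 * q) ^ s) (f s)) (trans (ℚₚ.*-comm (ι ((2 * q) ^ s)) (ι (f s))) (cong (ℚ._* ι ((2 * q) ^ s)) (ι-def (f s))))
      right : ι c ℚ.* ((1ℚ ℚ.+ δ) ^ℚ s) ℚ.* ι ((2 * q) ^ s) ≡ ι (c * t ^ s)
      right = trans (ℚₚ.*-assoc (ι c) _ _) (trans (cong (ι c ℚ.*_) (trans (cong (((1ℚ ℚ.+ δ) ^ℚ s) ℚ.*_) (ι-^ (2 * q) s))
        (trans (sym (^ℚ-distrib-* (1ℚ ℚ.+ δ) (ι (2 * q)) s)) (trans (cong (_^ℚ s) base) (sym (ι-^ t s))))))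
        (sym (ι-* c (t ^ s))))
    bernoulli′ : t * (t ^ s + c * t ^ s) ≤ t * suc t ^ s
    bernoulli′ = ℕₚ.≤-trans (ℕₚ.≤-trans (ℕₚ.m≤m+n _ (t ^ s * t)) (ℕₚ.≤-reflexive (regroup t (t ^ s) c))) (bernoulli t s)
      where
      regroup : ∀ t a c → t * (a + c * a) + a * t ≡ a * (t + t * suc c)
      regroup = solve-∀

  ·≡* : ∀ n k → n Σℕ.· k ≡ n * k
  ·≡* zero    k = refl
  ·≡* (suc n) k = cong (λ m → k + m) (·≡* n k)

  ‖⊤‖ : ∀ n → ‖ (λ (_ : Fin n) → true) ‖ ≡ n
  ‖⊤‖ n = trans (sym (length-∑ (allFin n))) (Listₚ.length-tabulate _)

  module Comparison
    {f : ℕ → ℕ} (slow : ∀ q → 1 ≤ q → ∃[ s ] 1 ≤ s × q ^ s * suc (f s) ≤ suc q ^ s)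
    {d : ℕ} {Hs : ℕ → FiniteGraph} (convergent : WeaklyConvergent d Hs)
    (growth : ∀ n x i → 1 ≤ i → ‖ ball (graph (Hs n)) i x ‖ ≤ f i) where

    open WeaklyConvergent convergent

    whole : ∀ {A} → GraphParameter A d → ∀ n → OrderedMonoid.Carrier A
    whole θ n = GraphParameter.value θ (Hs n) λ _ → true

    -- `R` is a radius by which growth falls behind `(q + 1) / q` per step, so carving at ratio `q`
    -- succeeds within it; `p` makes the clusters coherent up to distance `R`; `s` is the spreading
    -- radius for `p`; and `ρ` is the radius of the patches that show the clusters.
    module Scale (q₀ : ℕ) where

      q R p s D ρ : ℕ
      q = suc q₀
      R = proj₁ (slow q (s≤s z≤n))
      p = 4 * R * q

      1≤R : 1 ≤ R
      1≤R = proj₁ (proj₂ (slow q (s≤s z≤n)))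

      1≤p : 1 ≤ p
      1≤p = ℕₚ.*-mono-≤ {1} {4 * R} (ℕₚ.≤-trans 1≤R (ℕₚ.m≤m+n R _)) (s≤s z≤n)

      s = proj₁ (slow p 1≤p)
      D = (f s * suc p ^ s) !
      ρ = s + s

      1≤s : 1 ≤ s
      1≤s = proj₁ (proj₂ (slow p 1≤p))

      1≤D : 1 ≤ D
      1≤D = ℕₚ.1≤n! (f s * suc p ^ s)

      1≤ρ : 1 ≤ ρ
      1≤ρ = ℕₚ.≤-trans 1≤s (ℕₚ.m≤m+n s s)

      αs : List (Patch ρ d)
      αs = patches ρ d (f ρ)

      open FirstMatch {ρ} {d} Hs (frequencies ρ 1≤ρ)

      -- There are `D` clusters around the root, each worth at most one `unit` per vertex of the
      -- patch.
      b : Patch ρ d → ℕ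
      b α = D * Patch.size α

      error : ℕ → ℕ → ℕ
      error m n = ∑ αs λ α → discrepancy (count α) m n * b α

      errors-vanish : ∀ q′ (βs : List (Patch ρ d)) → ∃[ N ] ∀ m n → N ≤ m → N ≤ n →
                      suc q′ * ∑ βs (λ α → discrepancy (count α) m n * b α) ≤ order (Hs m) * order (Hs n) * ∑ βs b
      errors-vanish q′ []       = 0 , λ m n _ _ → ℕₚ.≤-trans (ℕₚ.≤-reflexive (ℕₚ.*-zeroʳ (suc q′))) z≤n
      errors-vanish q′ (β ∷ βs) = proj₁ one ⊔ proj₁ others , λ m n N≤m N≤n → begin
        suc q′ * (discrepancy (count β) m n * b β + ∑ βs (λ α → discrepancy (count α) m n * b α))
          ≡⟨ ℕₚ.*-distribˡ-+ (suc q′) (discrepancy (count β) m n * b β) _ ⟩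
        suc q′ * (discrepancy (count β) m n * b β) + suc q′ * ∑ βs (λ α → discrepancy (count α) m n * b α)
          ≤⟨ ℕₚ.+-mono-≤
               (ℕₚ.≤-trans (ℕₚ.≤-reflexive (sym (ℕₚ.*-assoc (suc q′) (discrepancy (count β) m n) (b β))))
                 (ℕₚ.*-monoˡ-≤ (b β) (proj₂ one m n (ℕₚ.m⊔n≤o⇒m≤o (proj₁ one) (proj₁ others) N≤m)
                                                    (ℕₚ.m⊔n≤o⇒m≤o (proj₁ one) (proj₁ others) N≤n))))
               (proj₂ others m n (ℕₚ.m⊔n≤o⇒n≤o (proj₁ one) (proj₁ others) N≤m)
                                 (ℕₚ.m⊔n≤o⇒n≤o (proj₁ one) (proj₁ others) N≤n)) ⟩
        order (Hs m) * order (Hs n) * b β + order (Hs m) * order (Hs n) * ∑ βs b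
          ≡⟨ ℕₚ.*-distribˡ-+ (order (Hs m) * order (Hs n)) (b β) (∑ βs b) ⟨
        order (Hs m) * order (Hs n) * (b β + ∑ βs b) ∎
        where
        open ℕₚ.≤-Reasoning
        one = frequency-cauchy {Hs} {ρ} {d} {β} (frequencies ρ 1≤ρ β) q′
        others = errors-vanish q′ βs

      -- The factor on the left is `q * suc (∑ αs b)`, written as a successor. It makes the weighted
      -- sum of all discrepancies at most a fraction `1 / q` of the product of the orders. No graph
      -- parameter enters, so one threshold serves all of them.
      threshold : ∃[ N ] ∀ m n → N ≤ m → N ≤ n →
                  suc (∑ αs b + q₀ * suc (∑ αs b)) * error m n ≤ order (Hs m) * order (Hs n) * ∑ αs b
      threshold = errors-vanish (∑ αs b + q₀ * suc (∑ αs b)) αs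

      error-bound : ∀ m n → proj₁ threshold ≤ m → proj₁ threshold ≤ n → q * error m n ≤ order (Hs m) * order (Hs n)
      error-bound m n N≤m N≤n = ℕₚ.*-cancelʳ-≤ (q * error m n) (order (Hs m) * order (Hs n)) (suc (∑ αs b)) (begin
        q * error m n * suc (∑ αs b) ≡⟨ exchange q (error m n) (suc (∑ αs b)) ⟩
        q * suc (∑ αs b) * error m n ≤⟨ proj₂ threshold m n N≤m N≤n ⟩
        order (Hs m) * order (Hs n) * ∑ αs b ≤⟨ ℕₚ.*-monoʳ-≤ (order (Hs m) * order (Hs n)) (ℕₚ.n≤1+n (∑ αs b)) ⟩
        order (Hs m) * order (Hs n) * suc (∑ αs b) ∎)
        where
        open ℕₚ.≤-Reasoning
        exchange : ∀ a b c → a * b * c ≡ a * c * b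
        exchange = solve-∀

      module _ {A : OrderedMonoid} (θ : GraphParameter A d) where
        open OrderedMonoid A hiding (∑)
        open OrderedMonoid A using () renaming (∑ to ∑ᴬ)
        open GraphParameter θ
        open Locality θ p s D

        localSum : ℕ → Carrier
        localSum n = ∑ᴬ (allFin (order (Hs n))) (localValue (Hs n))

        localValue-bounded : ∀ α → localValue (patchGraph α) (Patch.root α) ⊑ b α · unit
        localValue-bounded α = begin
          localValue (patchGraph α) (Patch.root α)
            ≲⟨ ∑-mono (upTo D) (λ t → small (Kernel.cluster (Patch.pgraph α) p s D (Patch.root α) t)) ⟩
          ∑ᴬ (upTo D) (λ _ → Patch.size α · unit)
            ≡⟨ trans (∑-const (upTo D) _) (cong (_· (Patch.size α · unit)) (Listₚ.length-upTo D)) ⟩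
          D · Patch.size α · unit
            ≡⟨ ×-assocˡ unit D (Patch.size α) ⟩
          b α · unit ∎
          where
          open ⊑-Reasoning
          small : ∀ χ → value (patchGraph α) χ ⊑ Patch.size α · unit
          small χ = begin
            value (patchGraph α) χ
              ≲⟨ lipschitz (patchGraph α) (Patch.degree α) (λ _ → false) χ ⟩
            value (patchGraph α) (λ _ → false) ∙ ‖ χ ∖ (λ _ → false) ‖ · unit
              ≡⟨ trans (cong (_∙ ‖ χ ∖ (λ _ → false) ‖ · unit) (empty (patchGraph α) λ _ → refl)) (identityˡ _) ⟩
            ‖ χ ∖ (λ _ → false) ‖ · unit
              ≲⟨ ·-monoˡ unit (ℕₚ.≤-trans (‖‖-mono {χ = χ ∖ (λ _ → false)} {χ′ = λ _ → true} λ _ _ → refl) (ℕₚ.≤-reflexive (‖⊤‖ (Patch.size α)))) ⟩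
            Patch.size α · unit ∎

        localSum-compare : ∀ m n → order (Hs n) · localSum m ⊑ order (Hs m) · localSum n ∙ error m n · unit
        localSum-compare = compare {A} (λ k → localValue (Hs k)) (λ α → localValue (patchGraph α) (Patch.root α)) b unit
          (λ α k x iso → localValue-local {Hs k} {x} {α} iso) localValue-bounded αs {λ _ _ → true} (λ _ _ _ → refl)
          (λ k x _ → patches-cover ρ d (Hs k) (degree k) x (growth k x ρ 1≤ρ))

        Approximate : ℕ → Set
        Approximate n = ∃[ K ] q * K ≤ 2 * D * order (Hs n) ×
                        localSum n ⊑ D · whole θ n ∙ K · unit × D · whole θ n ⊑ localSum n ∙ K · unit

        approximate : ∀ n → Approximate n
        approximate n = finish (approximation (order (Hs n)) (λ _ → true) (ℕₚ.≤-reflexive (‖⊤‖ (order (Hs n)))))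
          where
          open Kernel (graph (Hs n)) p s D using (cluster; clusters; module Properties)
          open Properties (f s) (λ y → growth n y s 1≤s) (proj₂ (proj₂ (slow p 1≤p))) refl 1≤p using (covering; coherent)
          -- The `suc` in front of `f R` in `slow` provides the strict inequality.
          large : ∀ x → ‖ ball (graph (Hs n)) R x ‖ * q ^ R < suc q ^ R
          large x = ℕₚ.<-≤-trans
            (ℕₚ.*-monoˡ-< (q ^ R) {{ℕₚ.m^n≢0 q R}} (s≤s (growth n x R 1≤R)))
            (ℕₚ.≤-trans (ℕₚ.≤-reflexive (ℕₚ.*-comm (suc (f R)) (q ^ R))) (proj₂ (proj₂ (slow q (s≤s z≤n)))))
          open Exhaustion θ (Hs n) (degree n) q R D clusters covering (coherent q R 1≤R refl) large
          same : ∑ᴬ clusters (λ C → value (Hs n) (λ v → C v ∧ true)) ≡ localSum n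
          same = trans (∑-cong clusters λ C → extensional (Hs n) λ v → Boolₚ.∧-identityʳ (C v))
            (trans (∑-map (uncurry cluster) (cartesianProduct (allFin (order (Hs n))) (upTo D)) (value (Hs n)))
                   (∑-cartesianProduct (allFin (order (Hs n))) (upTo D) (λ (x , t) → value (Hs n) (cluster x t))))
          finish : Approximation (λ _ → true) → Approximate n
          finish (K , bound , up , low) = K , subst (λ t → q * K ≤ 2 * D * t) (‖⊤‖ (order (Hs n))) bound ,
            subst (_⊑ D · whole θ n ∙ K · unit) same up , subst (λ t → D · whole θ n ⊑ t ∙ K · unit) same low

        -- From the `m`-th value to its local sum, across to the `n`-th local sum by patch
        -- frequencies, and back to a value; each step is multiplied by the order of the other
        -- graph.
        chain : ∀ m n K L → D · whole θ m ⊑ localSum m ∙ K · unit → localSum n ⊑ D · whole θ n ∙ L · unit →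
                (D * order (Hs n)) · whole θ m ⊑
                (D * order (Hs m)) · whole θ n ∙ (order (Hs m) * L + error m n + order (Hs n) * K) · unit
        chain m n K L low up = begin
          (D * Nn) · whole θ m
            ≡⟨ trans (cong (_· whole θ m) (ℕₚ.*-comm D Nn)) (sym (×-assocˡ (whole θ m) Nn D)) ⟩
          Nn · D · whole θ m
            ≲⟨ ·-monoʳ Nn low ⟩
          Nn · (localSum m ∙ K · unit)
            ≡⟨ trans (×-distrib-+ _ _ Nn) (cong (Nn · localSum m ∙_) (×-assocˡ unit Nn K)) ⟩
          Nn · localSum m ∙ (Nn * K) · unit
            ≲⟨ ∙-mono (localSum-compare m n) ⊑-refl ⟩
          Nm · localSum n ∙ e · unit ∙ (Nn * K) · unit
            ≲⟨ ∙-mono (∙-mono (·-monoʳ Nm up) ⊑-refl) ⊑-refl ⟩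
          Nm · (D · whole θ n ∙ L · unit) ∙ e · unit ∙ (Nn * K) · unit
            ≡⟨ cong (λ t → t ∙ e · unit ∙ (Nn * K) · unit) (trans (×-distrib-+ _ _ Nm)
                 (cong₂ _∙_ (trans (×-assocˡ (whole θ n) Nm D) (cong (_· whole θ n) (ℕₚ.*-comm Nm D))) (×-assocˡ unit Nm L))) ⟩
          (D * Nm) · whole θ n ∙ (Nm * L) · unit ∙ e · unit ∙ (Nn * K) · unit
            ≡⟨ trans (cong (_∙ (Nn * K) · unit) (trans (assoc _ _ _) (cong ((D * Nm) · whole θ n ∙_) (sym (×-homo-+ unit (Nm * L) e)))))
                 (trans (assoc _ _ _) (cong ((D * Nm) · whole θ n ∙_) (sym (×-homo-+ unit (Nm * L + e) (Nn * K))))) ⟩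
          (D * Nm) · whole θ n ∙ (Nm * L + e + Nn * K) · unit ∎
          where
          open ⊑-Reasoning
          Nm = order (Hs m)
          Nn = order (Hs n)
          e  = error m n

        -- The 5 is 2 for the clusters of each graph and 1 for the patch frequencies, the latter
        -- being enlarged by `1 ≤ D`.
        combine : ∀ m n → proj₁ threshold ≤ m → proj₁ threshold ≤ n → ∃[ E ]
                  q * E ≤ 5 * (D * (order (Hs m) * order (Hs n))) ×
                  (D * order (Hs n)) · whole θ m ⊑ (D * order (Hs m)) · whole θ n ∙ E · unit
        combine m n N≤m N≤n = Nm * L + e + Nn * K , (begin
            q * (Nm * L + e + Nn * K)
              ≡⟨ distribute q Nm L e Nn K ⟩
            Nm * (q * L) + q * e + Nn * (q * K)
              ≤⟨ ℕₚ.+-mono-≤ (ℕₚ.+-mono-≤ (ℕₚ.*-monoʳ-≤ Nm L-bound) (error-bound m n N≤m N≤n)) (ℕₚ.*-monoʳ-≤ Nn K-bound) ⟩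
            Nm * (2 * D * Nn) + Nm * Nn + Nn * (2 * D * Nm)
              ≤⟨ ℕₚ.+-monoˡ-≤ _ (ℕₚ.+-monoʳ-≤ (Nm * (2 * D * Nn))
                   (ℕₚ.≤-trans (ℕₚ.≤-reflexive (sym (ℕₚ.*-identityˡ (Nm * Nn)))) (ℕₚ.*-monoˡ-≤ (Nm * Nn) 1≤D))) ⟩
            Nm * (2 * D * Nn) + D * (Nm * Nn) + Nn * (2 * D * Nm)
              ≡⟨ collect Nm Nn D ⟩
            5 * (D * (Nm * Nn)) ∎) , chain m n K L low up
          where
          K L : ℕ
          K = proj₁ (approximate m)
          L = proj₁ (approximate n)
          K-bound = proj₁ (proj₂ (approximate m))
          L-bound = proj₁ (proj₂ (approximate n))
          low = proj₂ (proj₂ (proj₂ (approximate m)))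
          up  = proj₁ (proj₂ (proj₂ (approximate n)))
          open ℕₚ.≤-Reasoning
          Nm = order (Hs m)
          Nn = order (Hs n)
          e  = error m n
          distribute : ∀ q a l e b k → q * (a * l + e + b * k) ≡ a * (q * l) + q * e + b * (q * k)
          distribute = solve-∀
          collect : ∀ a b D → a * (2 * D * b) + D * (a * b) + b * (2 * D * a) ≡ 5 * (D * (a * b))
          collect = solve-∀

-- The two weights, and their partition functions as `I`, `M` and the generating functions.

module Weights where

  open OrderedMonoids
  open PartitionFunctions
  open GraphParameters
  open Rationals
  open import Data.Nat using (_+_; _*_; _⊔_; _≤_)
  open import Data.List using (foldr)
  open import Data.Bool.ListAction using (all)
  open import Data.List.Relation.Unary.AllPairs using (allPairs?)
  open import Data.Product using (Σ)
  open import Relation.Binary.Core using (Rel)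
  open import Relation.Binary.Definitions using (Decidable)

  sizeWeight : Weight ℕ-orderedMonoid
  sizeWeight = record
    { _⋆_          = λ a b → a ⊔ suc b
    ; cost         = 1
    ; ⋆-mono       = λ a≤b c≤d → ℕₚ.⊔-mono-≤ a≤b (s≤s c≤d)
    ; ⋆-increasing = λ a b → ℕₚ.m≤m⊔n a (suc b)
    ; ⋆-bound      = λ {a} {b} b≤a → ℕₚ.⊔-lub (ℕₚ.m≤m+n a 1) (ℕₚ.≤-trans (s≤s b≤a) (ℕₚ.≤-reflexive (ℕₚ.+-comm 1 a)))
    ; ⋆-distrib    = λ a b c → ℕₚ.+-distribʳ-⊔ c a (suc b)
    ; ⋆-medial     = λ a b c d → trans (ℕₚ.⊔-assoc a (suc b) _) (trans (cong (a ⊔_) (exchange (suc b) (suc c) (suc (suc d))))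
                       (sym (ℕₚ.⊔-assoc a (suc c) _)))
    ; ⋆-right-comm = λ a b c → trans (ℕₚ.⊔-assoc a (suc b) (suc c)) (trans (cong (a ⊔_) (ℕₚ.⊔-comm (suc b) (suc c)))
                       (sym (ℕₚ.⊔-assoc a (suc c) (suc b))))
    }
    where
    exchange : ∀ a b c → a ⊔ (b ⊔ c) ≡ b ⊔ (a ⊔ c)
    exchange a b c = trans (sym (ℕₚ.⊔-assoc a b c)) (trans (cong (_⊔ c) (ℕₚ.⊔-comm a b)) (ℕₚ.⊔-assoc b a c))

  -- The bound makes the unit of multiplication the least element; partition functions satisfy it
  -- thanks to the empty set.
  ℚ≥1 : Set
  ℚ≥1 = Σ ℚ (1ℚ ℚ.≤_)

  ℚ≥1-≡ : {x y : ℚ≥1} → proj₁ x ≡ proj₁ y → x ≡ y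
  ℚ≥1-≡ {q , 1≤q} {.q , 1≤q′} refl = cong (q ,_) (ℚₚ.≤-irrelevant 1≤q 1≤q′)

  0≤1 : 0ℚ ℚ.≤ 1ℚ
  0≤1 = ℚₚ.<⇒≤ (ℚₚ.positive⁻¹ 1ℚ)

  ℚ≥1-nonneg : (x : ℚ≥1) → 0ℚ ℚ.≤ proj₁ x
  ℚ≥1-nonneg (_ , 1≤q) = ℚₚ.≤-trans 0≤1 1≤q

  1≤* : ∀ {p q} → 1ℚ ℚ.≤ p → 1ℚ ℚ.≤ q → 1ℚ ℚ.≤ p ℚ.* q
  1≤* {p} {q} 1≤p 1≤q = subst (ℚ._≤ p ℚ.* q) (ℚₚ.*-identityʳ 1ℚ) (*-mono 0≤1 1≤p 0≤1 1≤q)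

  1≤+ : ∀ {p q} → 1ℚ ℚ.≤ p → 0ℚ ℚ.≤ q → 1ℚ ℚ.≤ p ℚ.+ q
  1≤+ {p} {q} 1≤p 0≤q = subst (ℚ._≤ p ℚ.+ q) (ℚₚ.+-identityʳ 1ℚ) (ℚₚ.+-mono-≤ 1≤p 0≤q)

  ℚ≥1-orderedMonoid : OrderedMonoid
  ℚ≥1-orderedMonoid = record
    { Carrier = ℚ≥1 ; _⊑_ = λ x y → proj₁ x ℚ.≤ proj₁ y
    ; _∙_ = λ (p , 1≤p) (q , 1≤q) → p ℚ.* q , 1≤* 1≤p 1≤q
    ; ε = 1ℚ , ℚₚ.≤-refl
    ; isCommutativeMonoid = record
      { isMonoid = record
        { isSemigroup = record
          { isMagma = record { isEquivalence = isEquivalence ; ∙-cong = λ { refl refl → refl } }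
          ; assoc = λ (p , _) (q , _) (r , _) → ℚ≥1-≡ (ℚₚ.*-assoc p q r) }
        ; identity = (λ (p , _) → ℚ≥1-≡ (ℚₚ.*-identityˡ p)) , (λ (p , _) → ℚ≥1-≡ (ℚₚ.*-identityʳ p)) }
      ; comm = λ (p , _) (q , _) → ℚ≥1-≡ (ℚₚ.*-comm p q) }
    ; ⊑-refl = ℚₚ.≤-refl ; ⊑-trans = ℚₚ.≤-trans
    ; ∙-mono = λ {a} {b} {c} {d} a≤b c≤d → *-mono (ℚ≥1-nonneg a) a≤b (ℚ≥1-nonneg c) c≤d
    ; ε-least = proj₂ }

  module _ {z : ℚ} (0≤z : 0ℚ ℚ.≤ z) where
    open +-*-Solver

    polynomialWeight : Weight ℚ≥1-orderedMonoid
    polynomialWeight = record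
      { _⋆_          = λ (p , 1≤p) q → p ℚ.+ z ℚ.* proj₁ q , 1≤+ 1≤p (*-nonneg 0≤z (ℚ≥1-nonneg q))
      ; cost         = 1ℚ ℚ.+ z , 1≤+ ℚₚ.≤-refl 0≤z
      ; ⋆-mono       = λ a≤b c≤d → ℚₚ.+-mono-≤ a≤b (scale c≤d)
      ; ⋆-increasing = λ (p , _) q → subst (ℚ._≤ p ℚ.+ z ℚ.* proj₁ q) (ℚₚ.+-identityʳ p)
                                       (ℚₚ.+-monoʳ-≤ p (*-nonneg 0≤z (ℚ≥1-nonneg q)))
      ; ⋆-bound      = λ {(p , _)} b≤a → ℚₚ.≤-trans (ℚₚ.+-monoʳ-≤ p (scale b≤a))
                         (ℚₚ.≤-reflexive (solve 2 (λ p z → p :+ z :* p := p :* (con 1ℚ :+ z)) refl p z))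
      ; ⋆-distrib    = λ (a , _) (b , _) (c , _) → ℚ≥1-≡
                         (solve 4 (λ a b c z → (a :+ z :* b) :* c := a :* c :+ z :* (b :* c)) refl a b c z)
      ; ⋆-medial     = λ (a , _) (b , _) (c , _) (d , _) → ℚ≥1-≡
                         (solve 5 (λ a b c d z → (a :+ z :* b) :+ z :* (c :+ z :* d) := (a :+ z :* c) :+ z :* (b :+ z :* d)) refl a b c d z)
      ; ⋆-right-comm = λ (a , _) (b , _) (c , _) → ℚ≥1-≡
                         (solve 4 (λ a b c z → (a :+ z :* b) :+ z :* c := (a :+ z :* c) :+ z :* b) refl a b c z)
      }
      where
      scale : ∀ {p q} → p ℚ.≤ q → z ℚ.* p ℚ.≤ z ℚ.* q
      scale = ℚₚ.*-monoˡ-≤-nonNeg z {{ℚ.nonNegative 0≤z}}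

  -- Pairwise compatibility, tested as in the recursion of `Z`, where each chosen element narrows
  -- the predicate for the rest.
  good : ∀ {X : Set} → (X → X → Bool) → (X → Bool) → List X → Bool
  good _∥_ P []      = true
  good _∥_ P (x ∷ S) = P x ∧ good _∥_ (λ y → P y ∧ (x ∥ y)) S

  goods : ∀ {X : Set} → (X → X → Bool) → (X → Bool) → List X → List (List X)
  goods _∥_ P xs = filter (λ S → good _∥_ P S Boolₚ.≟ true) (sublists xs)

  filter-cong : ∀ {X : Set} {P Q : Pred X 0ℓ} (P? : Unary.Decidable P) (Q? : Unary.Decidable Q) →
                (∀ x → does (P? x) ≡ does (Q? x)) → ∀ xs → filter P? xs ≡ filter Q? xs
  filter-cong P? Q? eq []       = refl
  filter-cong P? Q? eq (x ∷ xs) rewrite eq x with does (Q? x)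
  ... | true  = cong (x ∷_) (filter-cong P? Q? eq xs)
  ... | false = filter-cong P? Q? eq xs

  filter-map : ∀ {X Y : Set} {P : Pred Y 0ℓ} (P? : Unary.Decidable P) (φ : X → Y) xs →
               filter P? (map φ xs) ≡ map φ (filter (P? ∘ φ) xs)
  filter-map P? φ []       = refl
  filter-map P? φ (x ∷ xs) with does (P? (φ x))
  ... | true  = cong (φ x ∷_) (filter-map P? φ xs)
  ... | false = filter-map P? φ xs

  module _ {X : Set} (_∥_ : X → X → Bool) where

    does-≟-true : ∀ b → does (b Boolₚ.≟ true) ≡ b
    does-≟-true true  = refl
    does-≟-true false = refl

    goods-∷ : ∀ P x xs → goods _∥_ P (x ∷ xs) ≡
              (if P x then goods _∥_ P xs ++ map (x ∷_) (goods _∥_ (λ y → P y ∧ (x ∥ y)) xs) else goods _∥_ P xs)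
    goods-∷ P x xs = trans
      (trans (Listₚ.filter-++ good? (sublists xs) (map (x ∷_) (sublists xs)))
             (cong (goods _∥_ P xs ++_) (filter-map good? (x ∷_) (sublists xs))))
      (split (P x) refl)
      where
      good? : Unary.Decidable λ S → good _∥_ P S ≡ true
      good? S = good _∥_ P S Boolₚ.≟ true
      split : ∀ b → P x ≡ b → goods _∥_ P xs ++ map (x ∷_) (filter (good? ∘ (x ∷_)) (sublists xs)) ≡
              (if b then goods _∥_ P xs ++ map (x ∷_) (goods _∥_ (λ y → P y ∧ (x ∥ y)) xs) else goods _∥_ P xs)
      split true  Px = cong (λ Ss → goods _∥_ P xs ++ map (x ∷_) Ss)
        (filter-cong (good? ∘ (x ∷_)) (λ S → good _∥_ (λ y → P y ∧ (x ∥ y)) S Boolₚ.≟ true)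
          (λ S → cong (λ b → does ((b ∧ good _∥_ (λ y → P y ∧ (x ∥ y)) S) Boolₚ.≟ true)) Px) (sublists xs))
      split false Px = trans
        (cong (λ Ss → goods _∥_ P xs ++ map (x ∷_) Ss)
              (Listₚ.filter-none (good? ∘ (x ∷_)) (All.universal excluded (sublists xs))))
        (Listₚ.++-identityʳ (goods _∥_ P xs))
        where
        excluded : ∀ S → ¬ (P x ∧ good _∥_ (λ y → P y ∧ (x ∥ y)) S) ≡ true
        excluded S eq with () ← trans (sym (proj₁ (∧-true⁻ (P x) eq))) Px

    good-all : ∀ {R : Rel X 0ℓ} (R? : Decidable R) → (∀ x y → does (R? x y) ≡ (x ∥ y)) → ∀ P S →
               good _∥_ P S ≡ all P S ∧ does (allPairs? R? S)
    good-all R? R≡∥ P []      = refl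
    good-all R? R≡∥ P (x ∷ S) = trans
      (cong (P x ∧_) (trans (good-all R? R≡∥ (λ y → P y ∧ (x ∥ y)) S) (cong (_∧ does (allPairs? R? S)) (all-∧ S))))
      (regroup (P x) (all P S) (does (All.all? (R? x) S)) (does (allPairs? R? S)))
      where
      all-∧ : ∀ S → all (λ y → P y ∧ (x ∥ y)) S ≡ all P S ∧ does (All.all? (R? x) S)
      all-∧ []      = refl
      all-∧ (y ∷ S) rewrite all-∧ S | sym (R≡∥ x y) =
        interchange (P y) (does (R? x y)) (all P S) (does (All.all? (R? x) S))
        where
        interchange : ∀ a b c d → ((a ∧ b) ∧ (c ∧ d)) ≡ ((a ∧ c) ∧ (b ∧ d))
        interchange false b c d = refl
        interchange true  b true  d = refl
        interchange true  b false d = Boolₚ.∧-zeroʳ b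
      regroup : ∀ a b c d → (a ∧ ((b ∧ c) ∧ d)) ≡ ((a ∧ b) ∧ (c ∧ d))
      regroup false b c d = refl
      regroup true  b c d = Boolₚ.∧-assoc b c d

    goods-compatible : ∀ {R : Rel X 0ℓ} (R? : Decidable R) → (∀ x y → does (R? x y) ≡ (x ∥ y)) → ∀ xs →
                       filter (allPairs? R?) (sublists xs) ≡ goods _∥_ (λ _ → true) xs
    goods-compatible R? R≡∥ xs = filter-cong (allPairs? R?) (λ S → good _∥_ (λ _ → true) S Boolₚ.≟ true)
      (λ S → sym (trans (does-≟-true (good _∥_ (λ _ → true) S)) (trans (good-all R? R≡∥ (λ _ → true) S)
        (cong (_∧ does (allPairs? R? S)) (all-true S))))) (sublists xs)
      where
      all-true : ∀ S → all (λ (_ : X) → true) S ≡ true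
      all-true []      = refl
      all-true (_ ∷ S) = all-true S

  maximum-++ : ∀ ks ls → maximum (ks ++ ls) ≡ maximum ks ⊔ maximum ls
  maximum-++ []       ls = refl
  maximum-++ (k ∷ ks) ls = trans (cong (k ⊔_) (maximum-++ ks ls)) (sym (ℕₚ.⊔-assoc k (maximum ks) (maximum ls)))

  -- False for the empty list, whose maximum is 0 by default; `goods-head` excludes this case.
  maximum-suc : ∀ k ks → maximum (map suc (k ∷ ks)) ≡ suc (maximum (k ∷ ks))
  maximum-suc k []        = sym (cong suc (ℕₚ.⊔-identityʳ k))
  maximum-suc k (l ∷ ks)  = cong (suc k ⊔_) (maximum-suc l ks)

  module _ {X : Set} (_∥_ : X → X → Bool) where
    open PartitionFunction

    -- The empty set is the first of the sublists, so the lists of good sets are never empty.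
    goods-head : ∀ P xs → ∃[ S ] ∃[ Ss ] goods _∥_ P xs ≡ S ∷ Ss
    goods-head P []       = [] , [] , refl
    goods-head P (x ∷ xs) with S , Ss , eq ← goods-head P xs with P x | goods-∷ _∥_ P x xs
    ... | true  | eq′ = S , _ , trans eq′ (cong (_++ map (x ∷_) (goods _∥_ (λ y → P y ∧ (x ∥ y)) xs)) eq)
    ... | false | eq′ = S , Ss , trans eq′ eq

    Z-maximum : ∀ P xs → Z sizeWeight _∥_ P xs ≡ maximum (map length (goods _∥_ P xs))
    Z-maximum P []       = refl
    Z-maximum P (x ∷ xs) with P x | goods-∷ _∥_ P x xs
    ... | false | eq = trans (Z-maximum P xs) (cong (maximum ∘ map length) (sym eq))
    ... | true  | eq = begin
      Z sizeWeight _∥_ P xs ⊔ suc (Z sizeWeight _∥_ P′ xs)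
        ≡⟨ cong₂ (λ k l → k ⊔ suc l) (Z-maximum P xs) (Z-maximum P′ xs) ⟩
      maximum (map length (goods _∥_ P xs)) ⊔ suc (maximum (map length (goods _∥_ P′ xs)))
        ≡⟨ cong (maximum (map length (goods _∥_ P xs)) ⊔_) longer ⟩
      maximum (map length (goods _∥_ P xs)) ⊔ maximum (map length (map (x ∷_) (goods _∥_ P′ xs)))
        ≡⟨ maximum-++ (map length (goods _∥_ P xs)) _ ⟨
      maximum (map length (goods _∥_ P xs) ++ map length (map (x ∷_) (goods _∥_ P′ xs)))
        ≡⟨ cong maximum (Listₚ.map-++ length (goods _∥_ P xs) _) ⟨
      maximum (map length (goods _∥_ P xs ++ map (x ∷_) (goods _∥_ P′ xs)))
        ≡⟨ cong (maximum ∘ map length) eq ⟨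
      maximum (map length (goods _∥_ P (x ∷ xs))) ∎
      where
      open ≡-Reasoning
      P′ : X → Bool
      P′ y = P y ∧ (x ∥ y)
      longer : suc (maximum (map length (goods _∥_ P′ xs))) ≡ maximum (map length (map (x ∷_) (goods _∥_ P′ xs)))
      longer with S , Ss , eq ← goods-head P′ xs rewrite eq = trans (sym (maximum-suc (length S) (map length Ss)))
        (cong (maximum ∘ (suc (length S) ∷_)) (trans (sym (Listₚ.map-∘ Ss)) (Listₚ.map-∘ Ss)))

  sumℚ : List ℚ → ℚ
  sumℚ = foldr ℚ._+_ 0ℚ

  sumℚ-++ : ∀ ps qs → sumℚ (ps ++ qs) ≡ sumℚ ps ℚ.+ sumℚ qs
  sumℚ-++ []       qs = sym (ℚₚ.+-identityˡ (sumℚ qs))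
  sumℚ-++ (p ∷ ps) qs = trans (cong (p ℚ.+_) (sumℚ-++ ps qs)) (sym (ℚₚ.+-assoc p (sumℚ ps) (sumℚ qs)))

  module _ {X : Set} (_∥_ : X → X → Bool) {z : ℚ} (0≤z : 0ℚ ℚ.≤ z) where
    open PartitionFunction (polynomialWeight 0≤z)

    monomials : List (List X) → ℚ
    monomials = sumℚ ∘ map (λ S → z ^ℚ length S)

    monomials-∷ : ∀ x Ss → monomials (map (x ∷_) Ss) ≡ z ℚ.* monomials Ss
    monomials-∷ x []       = sym (ℚₚ.*-zeroʳ z)
    monomials-∷ x (S ∷ Ss) = trans (cong (z ℚ.* (z ^ℚ length S) ℚ.+_) (monomials-∷ x Ss))
                                   (sym (ℚₚ.*-distribˡ-+ z (z ^ℚ length S) (monomials Ss)))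

    Z-polynomial : ∀ P xs → proj₁ (Z _∥_ P xs) ≡ monomials (goods _∥_ P xs)
    Z-polynomial P []       = sym (ℚₚ.+-identityʳ 1ℚ)
    Z-polynomial P (x ∷ xs) with P x | goods-∷ _∥_ P x xs
    ... | false | eq = trans (Z-polynomial P xs) (cong monomials (sym eq))
    ... | true  | eq = begin
      proj₁ (Z _∥_ P xs) ℚ.+ z ℚ.* proj₁ (Z _∥_ P′ xs)
        ≡⟨ cong₂ (λ p q → p ℚ.+ z ℚ.* q) (Z-polynomial P xs) (Z-polynomial P′ xs) ⟩
      monomials (goods _∥_ P xs) ℚ.+ z ℚ.* monomials (goods _∥_ P′ xs)
        ≡⟨ cong (monomials (goods _∥_ P xs) ℚ.+_) (monomials-∷ x (goods _∥_ P′ xs)) ⟨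
      monomials (goods _∥_ P xs) ℚ.+ monomials (map (x ∷_) (goods _∥_ P′ xs))
        ≡⟨ sumℚ-++ (map (λ S → z ^ℚ length S) (goods _∥_ P xs)) _ ⟨
      sumℚ (map (λ S → z ^ℚ length S) (goods _∥_ P xs) ++ map (λ S → z ^ℚ length S) (map (x ∷_) (goods _∥_ P′ xs)))
        ≡⟨ cong sumℚ (Listₚ.map-++ (λ S → z ^ℚ length S) (goods _∥_ P xs) _) ⟨
      monomials (goods _∥_ P xs ++ map (x ∷_) (goods _∥_ P′ xs))
        ≡⟨ cong monomials eq ⟨
      monomials (goods _∥_ P (x ∷ xs)) ∎
      where
      open ≡-Reasoning
      P′ : X → Bool
      P′ y = P y ∧ (x ∥ y)

  seq-^ : ∀ z n k → seq (z ^ᴿ n) k ≡ seq z k ^ℚ n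
  seq-^ z zero    k = refl
  seq-^ z (suc n) k = cong (seq z k ℚ.*_) (seq-^ z n k)

  seq-sum : ∀ {X : Set} (g : X → ℝ) xs k → seq (sumᴿ (map g xs)) k ≡ sumℚ (map (λ x → seq (g x) k) xs)
  seq-sum g []       k = refl
  seq-sum g (x ∷ xs) k = cong (seq (g x) k ℚ.+_) (seq-sum g xs k)

  -- Real operations act on each approximation separately, so the `k`-th approximation of a
  -- generating function at `z` is the same polynomial at the rational `seq z k`. All estimates can
  -- therefore be made over the rationals.
  seq-monomials : ∀ {X : Set} z (Ss : List (List X)) k →
                  seq (sumᴿ (map (λ S → z ^ᴿ length S) Ss)) k ≡ sumℚ (map (λ S → seq z k ^ℚ length S) Ss)
  seq-monomials z Ss k = trans (seq-sum (λ S → z ^ᴿ length S) Ss k)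
    (cong sumℚ (Listₚ.map-cong (λ S → seq-^ z (length S) k) Ss))

  module _ (H : FiniteGraph) where

    independentSets-goods : independentSets H ≡ goods (nonAdjacent H) (λ _ → true) (allFin (order H))
    independentSets-goods = goods-compatible (nonAdjacent H) (λ i j → ¬? (FiniteGraph._~?_ H i j))
      (λ _ _ → refl) (allFin (order H))

    matchings-goods : matchings H ≡ goods (disjoint H) (λ _ → true) (edgeList H)
    matchings-goods = goods-compatible (disjoint H) (disjoint? H) (λ _ _ → refl) (edgeList H)

    I-value : ∀ d → GraphParameter.value (independence sizeWeight d) H (λ _ → true) ≡ I H
    I-value d = trans (Z-maximum (nonAdjacent H) (λ _ → true) (allFin (order H)))
                      (cong (maximum ∘ map length) (sym independentSets-goods))

    M-value : ∀ d → GraphParameter.value (matching sizeWeight d) H (λ _ → true) ≡ M H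
    M-value d = trans (Z-maximum (disjoint H) (λ _ → true) (edgeList H))
                      (cong (maximum ∘ map length) (sym matchings-goods))

    module _ (z : ℝ) (k : ℕ) (0≤z : 0ℚ ℚ.≤ seq z k) where

      πᴵ-value : ∀ d → proj₁ (GraphParameter.value (independence (polynomialWeight 0≤z) d) H (λ _ → true)) ≡ seq (πᴵ H z) k
      πᴵ-value d = trans (Z-polynomial (nonAdjacent H) 0≤z (λ _ → true) (allFin (order H)))
        (trans (cong (monomials (nonAdjacent H) 0≤z) (sym independentSets-goods)) (sym (seq-monomials z (independentSets H) k)))

      πᴹ-value : ∀ d → proj₁ (GraphParameter.value (matching (polynomialWeight 0≤z) d) H (λ _ → true)) ≡ seq (πᴹ H z) k
      πᴹ-value d = trans (Z-polynomial (disjoint H) 0≤z (λ _ → true) (edgeList H))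
        (trans (cong (monomials (disjoint H) 0≤z) (sym matchings-goods)) (sym (seq-monomials z (matchings H) k)))

-- Partial sums of the exponential series at rational points.

module ExponentialSeries where

  open Rationals
  open Weights using (0≤1; 1≤*; 1≤+; sumℚ; sumℚ-++; seq-sum; seq-^)
  open import Data.Nat using (_!)
  open import Data.Rational using (_+_; _*_; _-_; -_; _≤_; _<_; _/_)

  open +-*-Solver using (solve; _:+_; _:*_; _:-_; :-_; _:=_; con)
  open ℚₚ.≤-Reasoning

  +-nonneg : ∀ {a b} → 0ℚ ≤ a → 0ℚ ≤ b → 0ℚ ≤ a + b
  +-nonneg {a} {b} 0≤a 0≤b = subst (_≤ a + b) (ℚₚ.+-identityʳ 0ℚ) (ℚₚ.+-mono-≤ 0≤a 0≤b)

  ≤-+ʳ : ∀ a {b} → 0ℚ ≤ b → a ≤ a + b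
  ≤-+ʳ a {b} 0≤b = subst (_≤ a + b) (ℚₚ.+-identityʳ a) (ℚₚ.+-monoʳ-≤ a 0≤b)

  *-monoˡ : ∀ c {a b} → 0ℚ ≤ c → a ≤ b → c * a ≤ c * b
  *-monoˡ c 0≤c = ℚₚ.*-monoˡ-≤-nonNeg c {{ℚ.nonNegative 0≤c}}

  *-monoʳ : ∀ c {a b} → 0ℚ ≤ c → a ≤ b → a * c ≤ b * c
  *-monoʳ c 0≤c = ℚₚ.*-monoʳ-≤-nonNeg c {{ℚ.nonNegative 0≤c}}

  ^-nonneg : ∀ {t} n → 0ℚ ≤ t → 0ℚ ≤ t ^ℚ n
  ^-nonneg zero    0≤t = 0≤1
  ^-nonneg (suc n) 0≤t = *-nonneg 0≤t (^-nonneg n 0≤t)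

  ^-mono : ∀ {s t} n → 0ℚ ≤ s → s ≤ t → s ^ℚ n ≤ t ^ℚ n
  ^-mono zero    0≤s s≤t = ℚₚ.≤-refl
  ^-mono (suc n) 0≤s s≤t = *-mono 0≤s s≤t (^-nonneg n 0≤s) (^-mono n 0≤s s≤t)

  1≤^ : ∀ {b} n → 1ℚ ≤ b → 1ℚ ≤ b ^ℚ n
  1≤^ zero    1≤b = ℚₚ.≤-refl
  1≤^ (suc n) 1≤b = 1≤* 1≤b (1≤^ n 1≤b)

  ι-suc : ∀ n → ι (suc n) ≡ 1ℚ + ι n
  ι-suc n = trans (ι-+ 1 n) (cong (_+ ι n) ι-1)

  module _ {t h : ℚ} (0≤t : 0ℚ ≤ t) (0≤h : 0ℚ ≤ h) where

    private
      0≤t+h : 0ℚ ≤ t + h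
      0≤t+h = +-nonneg 0≤t 0≤h

      t≤t+h : t ≤ t + h
      t≤t+h = ≤-+ʳ t 0≤h

    -- The mean value inequality for a power, with the derivative at the right end of the interval;
    -- `power-lower` takes it at the left end.
    power-upper : ∀ i → (t + h) ^ℚ suc i ≤ t ^ℚ suc i + ι (suc i) * (h * (t + h) ^ℚ i)
    power-upper zero = ℚₚ.≤-reflexive (trans
      (solve 2 (λ t h → (t :+ h) :* con 1ℚ := t :* con 1ℚ :+ con 1ℚ :* (h :* con 1ℚ)) refl t h)
      (cong (λ c → t * 1ℚ + c * (h * 1ℚ)) (sym ι-1)))
    power-upper (suc i) = begin
      (t + h) * (t + h) ^ℚ suc i
        ≤⟨ *-monoˡ (t + h) 0≤t+h (power-upper i) ⟩
      (t + h) * (t ^ℚ suc i + ι (suc i) * (h * (t + h) ^ℚ i))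
        ≡⟨ solve 5 (λ t h a n b → (t :+ h) :* (a :+ n :* (h :* b)) := t :* a :+ h :* a :+ n :* (h :* ((t :+ h) :* b))) refl
             t h (t ^ℚ suc i) (ι (suc i)) ((t + h) ^ℚ i) ⟩
      t ^ℚ suc (suc i) + h * t ^ℚ suc i + ι (suc i) * (h * (t + h) ^ℚ suc i)
        ≤⟨ ℚₚ.+-monoˡ-≤ _ (ℚₚ.+-monoʳ-≤ (t ^ℚ suc (suc i)) (*-monoˡ h 0≤h (^-mono (suc i) 0≤t t≤t+h))) ⟩
      t ^ℚ suc (suc i) + h * (t + h) ^ℚ suc i + ι (suc i) * (h * (t + h) ^ℚ suc i)
        ≡⟨ solve 3 (λ a b n → a :+ b :+ n :* b := a :+ (con 1ℚ :+ n) :* b) refl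
             (t ^ℚ suc (suc i)) (h * (t + h) ^ℚ suc i) (ι (suc i)) ⟩
      t ^ℚ suc (suc i) + (1ℚ + ι (suc i)) * (h * (t + h) ^ℚ suc i)
        ≡⟨ cong (λ c → t ^ℚ suc (suc i) + c * (h * (t + h) ^ℚ suc i)) (ι-suc (suc i)) ⟨
      t ^ℚ suc (suc i) + ι (suc (suc i)) * (h * (t + h) ^ℚ suc i) ∎

    power-lower : ∀ i → t ^ℚ suc i + ι (suc i) * (h * t ^ℚ i) ≤ (t + h) ^ℚ suc i
    power-lower zero = ℚₚ.≤-reflexive (trans
      (cong (λ c → t * 1ℚ + c * (h * 1ℚ)) ι-1)
      (solve 2 (λ t h → t :* con 1ℚ :+ con 1ℚ :* (h :* con 1ℚ) := (t :+ h) :* con 1ℚ) refl t h))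
    power-lower (suc i) = begin
      t ^ℚ suc (suc i) + ι (suc (suc i)) * (h * t ^ℚ suc i)
        ≡⟨ cong (λ c → t ^ℚ suc (suc i) + c * (h * t ^ℚ suc i)) (ι-suc (suc i)) ⟩
      t ^ℚ suc (suc i) + (1ℚ + ι (suc i)) * (h * t ^ℚ suc i)
        ≤⟨ ≤-+ʳ _ (*-nonneg (ι-nonneg (suc i)) (*-nonneg 0≤h (*-nonneg 0≤h (^-nonneg i 0≤t)))) ⟩
      t ^ℚ suc (suc i) + (1ℚ + ι (suc i)) * (h * t ^ℚ suc i) + ι (suc i) * (h * (h * t ^ℚ i))
        ≡⟨ solve 4 (λ t h n a → t :* (t :* a) :+ (con 1ℚ :+ n) :* (h :* (t :* a)) :+ n :* (h :* (h :* a)) :=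
                                (t :+ h) :* (t :* a :+ n :* (h :* a))) refl t h (ι (suc i)) (t ^ℚ i) ⟩
      (t + h) * (t ^ℚ suc i + ι (suc i) * (h * t ^ℚ i))
        ≤⟨ *-monoˡ (t + h) 0≤t+h (power-lower i) ⟩
      (t + h) * (t + h) ^ℚ suc i ∎

  abstract
    1/! : ℕ → ℚ
    1/! n = _/_ (ℤ.+ 1) (n !) {{n ℕₚ.!≢0}}

    1/!-def : ∀ n → 1/! n ≡ _/_ (ℤ.+ 1) (n !) {{n ℕₚ.!≢0}}
    1/!-def n = refl

    1/!-cancel : ∀ n → 1/! n * ι (n !) ≡ 1ℚ
    1/!-cancel n = trans (/-cancel 1 (n !) {{n ℕₚ.!≢0}}) ι-1

  1/!-suc : ∀ n → 1/! (suc n) * ι (suc n) ≡ 1/! n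
  1/!-suc n = begin-equality
    1/! (suc n) * ι (suc n) ≡⟨ ℚₚ.*-identityʳ _ ⟨
    1/! (suc n) * ι (suc n) * 1ℚ ≡⟨ cong (1/! (suc n) * ι (suc n) *_) (1/!-cancel n) ⟨
    1/! (suc n) * ι (suc n) * (1/! n * ι (n !)) ≡⟨ solve 4 (λ a b c d → a :* b :* (c :* d) := a :* (b :* d) :* c) refl (1/! (suc n)) (ι (suc n)) (1/! n) (ι (n !)) ⟩
    1/! (suc n) * (ι (suc n) * ι (n !)) * 1/! n ≡⟨ cong (λ c → 1/! (suc n) * c * 1/! n) (ι-* (suc n) (n !)) ⟨
    1/! (suc n) * ι (suc n ℕ.* n !) * 1/! n ≡⟨ cong (_* 1/! n) (1/!-cancel (suc n)) ⟩
    1ℚ * 1/! n ≡⟨ ℚₚ.*-identityˡ (1/! n) ⟩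
    1/! n ∎

  1/!-0 : 1/! 0 ≡ 1ℚ
  1/!-0 = trans (sym (ℚₚ.*-identityʳ (1/! 0))) (trans (cong (1/! 0 *_) (sym ι-1)) (1/!-cancel 0))

  1/!-nonneg : ∀ n → 0ℚ ≤ 1/! n
  1/!-nonneg n = *-cancel-≤ (ι (n !)) (ι-pos (ℕₚ.1≤n! n))
    (subst₂ _≤_ (sym (ℚₚ.*-zeroˡ (ι (n !)))) (sym (1/!-cancel n)) 0≤1)

  expTerm : ℕ → ℚ → ℚ
  expTerm n t = 1/! n * t ^ℚ n

  expSum : ℕ → ℚ → ℚ
  expSum zero    t = 0ℚ
  expSum (suc n) t = expSum n t + expTerm n t

  expTerm-nonneg : ∀ n {t} → 0ℚ ≤ t → 0ℚ ≤ expTerm n t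
  expTerm-nonneg n 0≤t = *-nonneg (1/!-nonneg n) (^-nonneg n 0≤t)

  expSum-nonneg : ∀ n {t} → 0ℚ ≤ t → 0ℚ ≤ expSum n t
  expSum-nonneg zero    0≤t = ℚₚ.≤-refl
  expSum-nonneg (suc n) 0≤t = +-nonneg (expSum-nonneg n 0≤t) (expTerm-nonneg n 0≤t)

  expTerm-mono : ∀ n {s t} → 0ℚ ≤ s → s ≤ t → expTerm n s ≤ expTerm n t
  expTerm-mono n 0≤s s≤t = *-monoˡ (1/! n) (1/!-nonneg n) (^-mono n 0≤s s≤t)

  expTerm-0 : ∀ t → expTerm 0 t ≡ 1ℚ
  expTerm-0 t = trans (ℚₚ.*-identityʳ (1/! 0)) 1/!-0

  1≤expSum : ∀ n {t} → 0ℚ ≤ t → 1ℚ ≤ expSum (suc n) t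
  1≤expSum zero    {t} 0≤t = ℚₚ.≤-reflexive (sym (trans (ℚₚ.+-identityˡ (expTerm 0 t)) (expTerm-0 t)))
  1≤expSum (suc n) 0≤t = 1≤+ (1≤expSum n 0≤t) (expTerm-nonneg (suc n) 0≤t)

  module _ {t h : ℚ} (0≤t : 0ℚ ≤ t) (0≤h : 0ℚ ≤ h) where

    private
      shift : ∀ i s → 1/! (suc i) * (ι (suc i) * (h * s ^ℚ i)) ≡ h * expTerm i s
      shift i s = trans (solve 4 (λ a n h p → a :* (n :* (h :* p)) := h :* ((a :* n) :* p)) refl (1/! (suc i)) (ι (suc i)) h (s ^ℚ i))
                        (cong (λ c → h * (c * s ^ℚ i)) (1/!-suc i))

    expTerm-upper : ∀ i → expTerm (suc i) (t + h) ≤ expTerm (suc i) t + h * expTerm i (t + h)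
    expTerm-upper i = begin
      1/! (suc i) * (t + h) ^ℚ suc i
        ≤⟨ *-monoˡ (1/! (suc i)) (1/!-nonneg (suc i)) (power-upper 0≤t 0≤h i) ⟩
      1/! (suc i) * (t ^ℚ suc i + ι (suc i) * (h * (t + h) ^ℚ i))
        ≡⟨ trans (ℚₚ.*-distribˡ-+ (1/! (suc i)) _ _) (cong (expTerm (suc i) t +_) (shift i (t + h))) ⟩
      expTerm (suc i) t + h * expTerm i (t + h) ∎

    expTerm-lower : ∀ i → expTerm (suc i) t + h * expTerm i t ≤ expTerm (suc i) (t + h)
    expTerm-lower i = begin
      expTerm (suc i) t + h * expTerm i t
        ≡⟨ trans (ℚₚ.*-distribˡ-+ (1/! (suc i)) _ _) (cong (expTerm (suc i) t +_) (shift i t)) ⟨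
      1/! (suc i) * (t ^ℚ suc i + ι (suc i) * (h * t ^ℚ i))
        ≤⟨ *-monoˡ (1/! (suc i)) (1/!-nonneg (suc i)) (power-lower 0≤t 0≤h i) ⟩
      1/! (suc i) * (t + h) ^ℚ suc i ∎

    -- The partial sums E satisfy E′ₙ₊₁ = Eₙ; these are the two mean value inequalities.
    expSum-upper : ∀ n → expSum (suc n) (t + h) ≤ expSum (suc n) t + h * expSum n (t + h)
    expSum-upper zero    = ℚₚ.≤-reflexive (trans (cong (λ c → 0ℚ + c) (trans (expTerm-0 (t + h)) (sym (expTerm-0 t))))
      (solve 2 (λ e h → con 0ℚ :+ e := con 0ℚ :+ e :+ h :* con 0ℚ) refl (expTerm 0 t) h))
    expSum-upper (suc n) = ℚₚ.≤-trans (ℚₚ.+-mono-≤ (expSum-upper n) (expTerm-upper n)) (ℚₚ.≤-reflexive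
      (solve 5 (λ a b h c d → (a :+ h :* b) :+ (c :+ h :* d) := (a :+ c) :+ h :* (b :+ d)) refl
        (expSum (suc n) t) (expSum n (t + h)) h (expTerm (suc n) t) (expTerm n (t + h))))

    expSum-lower : ∀ n → expSum (suc n) t + h * expSum n t ≤ expSum (suc n) (t + h)
    expSum-lower zero    = ℚₚ.≤-reflexive (trans
      (solve 2 (λ e h → con 0ℚ :+ e :+ h :* con 0ℚ := con 0ℚ :+ e) refl (expTerm 0 t) h)
      (cong (λ c → 0ℚ + c) (trans (expTerm-0 t) (sym (expTerm-0 (t + h))))))
    expSum-lower (suc n) = ℚₚ.≤-trans (ℚₚ.≤-reflexive
      (solve 5 (λ a b h c d → (a :+ c) :+ h :* (b :+ d) := (a :+ h :* b) :+ (c :+ h :* d)) refl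
        (expSum (suc n) t) (expSum n t) h (expTerm (suc n) t) (expTerm n t)))
      (ℚₚ.+-mono-≤ (expSum-lower n) (expTerm-lower n))

  -- The derivative of the partial sum is the previous one, which is at least 1 as soon as it
  -- contains the constant term; this is why two terms are demanded.
  expSum-reflects : ∀ n {s t ε} → 0ℚ ≤ s → 0ℚ ≤ t → 0ℚ < ε → expSum (suc (suc n)) t < expSum (suc (suc n)) s + ε → t < s + ε
  expSum-reflects n {s} {t} {ε} 0≤s 0≤t 0<ε less with ℚₚ.≤-total t s
  ... | inj₁ t≤s = ℚₚ.≤-<-trans t≤s (shift-< s 0<ε (ℚₚ.+-identityʳ s) refl)
  ... | inj₂ s≤t = shift-< (- e + s) (ℚₚ.≤-<-trans gap less)
        (solve 3 (λ e s t → (:- e :+ s) :+ (e :+ (t :- s)) := t) refl e s t)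
        (solve 3 (λ e s ε → (:- e :+ s) :+ (e :+ ε) := s :+ ε) refl e s ε)
    where
    e = expSum (suc (suc n)) s
    0≤t-s : 0ℚ ≤ t - s
    0≤t-s = shift-≤ (- s) s≤t (ℚₚ.+-inverseˡ s) (ℚₚ.+-comm (- s) t)
    gap : e + (t - s) ≤ expSum (suc (suc n)) t
    gap = begin
      e + (t - s) ≡⟨ cong (e +_) (ℚₚ.*-identityʳ (t - s)) ⟨
      e + (t - s) * 1ℚ ≤⟨ ℚₚ.+-monoʳ-≤ e (*-monoˡ (t - s) 0≤t-s (1≤expSum n 0≤s)) ⟩
      e + (t - s) * expSum (suc n) s ≤⟨ expSum-lower 0≤s 0≤t-s (suc n) ⟩
      expSum (suc (suc n)) (s + (t - s)) ≡⟨ cong (expSum (suc (suc n))) (solve 2 (λ s t → s :+ (t :- s) := t) refl s t) ⟩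
      expSum (suc (suc n)) t ∎

  -- Along the multiples of h, the partial sums of exp follow the powers of 1 + h.
  module _ {h : ℚ} (0≤h : 0ℚ ≤ h) (n : ℕ) where

    private
      b : ℚ
      b = 1ℚ + h

      1≤b : 1ℚ ≤ b
      1≤b = ≤-+ʳ 1ℚ 0≤h

      0≤b^ : ∀ j → 0ℚ ≤ b ^ℚ j
      0≤b^ j = ℚₚ.≤-trans 0≤1 (1≤^ j 1≤b)

      point : ℕ → ℚ
      point j = ι j * h

      0≤point : ∀ j → 0ℚ ≤ point j
      0≤point j = *-nonneg (ι-nonneg j) 0≤h

      point-suc : ∀ j → point (suc j) ≡ point j + h
      point-suc j = trans (cong (_* h) (ι-suc j)) (solve 2 (λ i h → (con 1ℚ :+ i) :* h := i :* h :+ h) refl (ι j) h)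

      x τ : ℕ → ℚ
      x j = expSum (suc n) (point j)
      τ j = expTerm n (point j)

      0≤x : ∀ j → 0ℚ ≤ x j
      0≤x j = expSum-nonneg (suc n) (0≤point j)

      point-0 : point 0 ≡ 0ℚ
      point-0 = trans (cong (_* h) ι-0) (ℚₚ.*-zeroˡ h)

      expSum-at-0 : ∀ n → expSum (suc n) 0ℚ ≡ 1ℚ
      expSum-at-0 zero    = trans (ℚₚ.+-identityˡ _) (expTerm-0 0ℚ)
      expSum-at-0 (suc n) = trans (cong₂ _+_ (expSum-at-0 n) (trans (cong (1/! (suc n) *_) (ℚₚ.*-zeroˡ (0ℚ ^ℚ n))) (ℚₚ.*-zeroʳ (1/! (suc n)))))
                                  (ℚₚ.+-identityʳ 1ℚ)

      x-0 : x 0 ≡ 1ℚ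
      x-0 = trans (cong (expSum (suc n)) point-0) (expSum-at-0 n)

      upper-step : ∀ j → x (suc j) ≤ x j + h * x (suc j)
      upper-step j = begin
        x (suc j) ≡⟨ cong (expSum (suc n)) (point-suc j) ⟩
        expSum (suc n) (point j + h) ≤⟨ expSum-upper (0≤point j) 0≤h n ⟩
        x j + h * expSum n (point j + h) ≡⟨ cong (λ t → x j + h * expSum n t) (point-suc j) ⟨
        x j + h * expSum n (point (suc j)) ≤⟨ ℚₚ.+-monoʳ-≤ (x j) (*-monoˡ h 0≤h (≤-+ʳ _ (expTerm-nonneg n (0≤point (suc j))))) ⟩
        x j + h * x (suc j) ∎

      lower-step : ∀ j → b * x j ≤ x (suc j) + h * τ j
      lower-step j = begin
        b * x j ≡⟨ solve 3 (λ h e t → (con 1ℚ :+ h) :* (e :+ t) := (e :+ t) :+ h :* e :+ h :* t) refl h (expSum n (point j)) (τ j) ⟩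
        x j + h * expSum n (point j) + h * τ j ≤⟨ ℚₚ.+-monoˡ-≤ (h * τ j) (expSum-lower (0≤point j) 0≤h n) ⟩
        expSum (suc n) (point j + h) + h * τ j ≡⟨ cong (λ t → expSum (suc n) t + h * τ j) (point-suc j) ⟨
        x (suc j) + h * τ j ∎

      increasing : ∀ j → x j ≤ x (suc j)
      increasing j = begin
        x j ≤⟨ ≤-+ʳ (x j) (*-nonneg 0≤h (expSum-nonneg n (0≤point j))) ⟩
        x j + h * expSum n (point j) ≤⟨ expSum-lower (0≤point j) 0≤h n ⟩
        expSum (suc n) (point j + h) ≡⟨ cong (expSum (suc n)) (point-suc j) ⟨
        x (suc j) ∎

    -- Using `upper-step` twice bounds `x (suc j)` by `b * x j` plus an error `h * h * x (suc j)` of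
    -- second order. After `j` steps these errors add up to `j * h * h * x j`.
    expSum-≤-power : ∀ j → x j ≤ b ^ℚ j * (1ℚ + point j * h * x j)
    expSum-≤-power zero = begin
      x 0 ≡⟨ x-0 ⟩
      1ℚ ≤⟨ ≤-+ʳ 1ℚ (*-nonneg (*-nonneg (0≤point 0) 0≤h) (0≤x 0)) ⟩
      1ℚ + point 0 * h * x 0 ≡⟨ ℚₚ.*-identityˡ _ ⟨
      1ℚ * (1ℚ + point 0 * h * x 0) ∎
    expSum-≤-power (suc j) = begin
      x (suc j)
        ≤⟨ upper-step j ⟩
      x j + h * x (suc j)
        ≤⟨ ℚₚ.+-monoʳ-≤ (x j) (*-monoˡ h 0≤h (upper-step j)) ⟩
      x j + h * (x j + h * x (suc j))
        ≡⟨ solve 3 (λ a h c → a :+ h :* (a :+ h :* c) := (con 1ℚ :+ h) :* a :+ h :* h :* c) refl (x j) h (x (suc j)) ⟩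
      b * x j + h * h * x (suc j)
        ≤⟨ ℚₚ.+-monoˡ-≤ _ (*-monoˡ b (ℚₚ.≤-trans 0≤1 1≤b) (expSum-≤-power j)) ⟩
      b * (b ^ℚ j * (1ℚ + point j * h * x j)) + h * h * x (suc j)
        ≤⟨ ℚₚ.+-mono-≤
             (*-monoˡ b (ℚₚ.≤-trans 0≤1 1≤b) (*-monoˡ (b ^ℚ j) (0≤b^ j) (ℚₚ.+-monoʳ-≤ 1ℚ
               (*-monoˡ (point j * h) (*-nonneg (0≤point j) 0≤h) (increasing j)))))
             (ℚₚ.≤-trans (ℚₚ.≤-reflexive (sym (ℚₚ.*-identityˡ _)))
               (*-monoʳ (h * h * x (suc j)) (*-nonneg (*-nonneg 0≤h 0≤h) (0≤x (suc j))) (1≤^ (suc j) 1≤b))) ⟩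
      b * (b ^ℚ j * (1ℚ + point j * h * x (suc j))) + b * b ^ℚ j * (h * h * x (suc j))
        ≡⟨ solve 5 (λ b c p h y → b :* (c :* (con 1ℚ :+ p :* h :* y)) :+ b :* c :* (h :* h :* y) :=
                                  b :* c :* (con 1ℚ :+ (p :+ h) :* h :* y)) refl b (b ^ℚ j) (point j) h (x (suc j)) ⟩
      b ^ℚ suc j * (1ℚ + (point j + h) * h * x (suc j))
        ≡⟨ cong (λ p → b ^ℚ suc j * (1ℚ + p * h * x (suc j))) (point-suc j) ⟨
      b ^ℚ suc j * (1ℚ + point (suc j) * h * x (suc j)) ∎

    -- Differentiation drops the last term `τ`, so each step falls short of a multiplication by `b`
    -- by at most `h * τ j`; later steps magnify this by powers of `b`.
    power-≤-expSum : ∀ j → b ^ℚ j ≤ x j + τ j * (point j * b ^ℚ j)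
    power-≤-expSum zero = begin
      1ℚ ≡⟨ x-0 ⟨
      x 0 ≤⟨ ≤-+ʳ (x 0) (*-nonneg (expTerm-nonneg n (0≤point 0)) (*-nonneg (0≤point 0) 0≤1)) ⟩
      x 0 + τ 0 * (point 0 * 1ℚ) ∎
    power-≤-expSum (suc j) = begin
      b * b ^ℚ j
        ≤⟨ *-monoˡ b (ℚₚ.≤-trans 0≤1 1≤b) (power-≤-expSum j) ⟩
      b * (x j + τ j * (point j * b ^ℚ j))
        ≡⟨ solve 5 (λ b y t p c → b :* (y :+ t :* (p :* c)) := b :* y :+ t :* (p :* (b :* c))) refl b (x j) (τ j) (point j) (b ^ℚ j) ⟩
      b * x j + τ j * (point j * b ^ℚ suc j)
        ≤⟨ ℚₚ.+-monoˡ-≤ _ (lower-step j) ⟩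
      x (suc j) + h * τ j + τ j * (point j * b ^ℚ suc j)
        ≤⟨ ℚₚ.+-monoˡ-≤ _ (ℚₚ.+-monoʳ-≤ (x (suc j)) (ℚₚ.≤-trans (ℚₚ.≤-reflexive (sym (ℚₚ.*-identityʳ (h * τ j))))
             (*-monoˡ (h * τ j) (*-nonneg 0≤h (expTerm-nonneg n (0≤point j))) (1≤^ (suc j) 1≤b)))) ⟩
      x (suc j) + h * τ j * b ^ℚ suc j + τ j * (point j * b ^ℚ suc j)
        ≡⟨ solve 5 (λ y h t c p → y :+ h :* t :* c :+ t :* (p :* c) := y :+ t :* ((p :+ h) :* c)) refl
             (x (suc j)) h (τ j) (b ^ℚ suc j) (point j) ⟩
      x (suc j) + τ j * ((point j + h) * b ^ℚ suc j)
        ≡⟨ cong (λ p → x (suc j) + τ j * (p * b ^ℚ suc j)) (point-suc j) ⟨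
      x (suc j) + τ j * (point (suc j) * b ^ℚ suc j)
        ≤⟨ ℚₚ.+-monoʳ-≤ (x (suc j)) (*-monoʳ (point (suc j) * b ^ℚ suc j) (*-nonneg (0≤point (suc j)) (0≤b^ (suc j)))
             (expTerm-mono n (0≤point j) (subst (point j ≤_) (sym (point-suc j)) (≤-+ʳ (point j) 0≤h)))) ⟩
      x (suc j) + τ (suc j) * (point (suc j) * b ^ℚ suc j) ∎

  seq-expPartialSum : ∀ y n k → seq (expPartialSum y n) k ≡ expSum n (seq y k)
  seq-expPartialSum y n k = trans (seq-sum _ (upTo n) k) (trans (cong sumℚ (Listₚ.map-cong term (upTo n))) (collect n))
    where
    t = seq y k
    term : ∀ i → _/_ (ℤ.+ 1) (i !) {{i ℕₚ.!≢0}} * seq (y ^ᴿ i) k ≡ expTerm i t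
    term i = cong₂ _*_ (sym (1/!-def i)) (seq-^ y i k)
    collect : ∀ n → sumℚ (map (λ i → expTerm i t) (upTo n)) ≡ expSum n t
    collect zero    = refl
    collect (suc n) = trans (cong (λ is → sumℚ (map (λ i → expTerm i t) is)) (sym (Listₚ.upTo-∷ʳ n)))
      (trans (cong sumℚ (Listₚ.map-++ (λ i → expTerm i t) (upTo n) (n ∷ [])))
        (trans (sumℚ-++ (map (λ i → expTerm i t) (upTo n)) (expTerm n t ∷ []))
          (cong₂ _+_ (collect n) (ℚₚ.+-identityʳ (expTerm n t)))))

-- Real logarithms from discrete ones.

module Logarithms where

  open Rationals
  open Weights using (0≤1)
  open ExponentialSeries
  open import Data.Nat using (_⊔_)
  open import Data.Rational using (½; _+_; _*_; _-_; -_; _≤_; _<_)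

  open +-*-Solver using (solve; _:+_; _:*_; _:-_; :-_; _:=_; con)
  open ℚₚ.≤-Reasoning

  0≤inv : ∀ k → 0ℚ ≤ inv k
  0≤inv k = ℚₚ.<⇒≤ (inv-pos k)

  0<½ : 0ℚ < ½
  0<½ = ℚₚ.positive⁻¹ ½

  ∣∣-triangle : ∀ {x y z ε δ} → ℚ.∣ x - y ∣ < ε → ℚ.∣ y - z ∣ < δ → ℚ.∣ x - z ∣ < ε + δ
  ∣∣-triangle {x} {y} {z} {ε} {δ} xy yz = begin-strict
    ℚ.∣ x - z ∣ ≡⟨ cong ℚ.∣_∣ (solve 3 (λ x y z → x :- z := (x :- y) :+ (y :- z)) refl x y z) ⟩
    ℚ.∣ (x - y) + (y - z) ∣ ≤⟨ ℚₚ.∣p+q∣≤∣p∣+∣q∣ (x - y) (y - z) ⟩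
    ℚ.∣ x - y ∣ + ℚ.∣ y - z ∣ <⟨ ℚₚ.+-mono-< xy yz ⟩
    ε + δ ∎

  ∣∣-sym : ∀ {x y ε} → ℚ.∣ x - y ∣ < ε → ℚ.∣ y - x ∣ < ε
  ∣∣-sym {x} {y} {ε} = subst (_< ε) (∣-∣-comm x y)

  inv-vanishes : ∀ c ε → 0ℚ < ε → ∃[ K ] ∀ k → K ℕ.≤ k → ι c * inv k < ε
  inv-vanishes c ε 0<ε = proj₁ small , λ k K≤k → begin-strict
    ι c * inv k ≤⟨ *-mono (ι-nonneg c) (ι-mono (ℕₚ.n≤1+n c)) (0≤inv k) (inv-anti K≤k) ⟩
    ι (suc c) * inv (proj₁ small) <⟨ ℚₚ.*-monoʳ-<-pos (ι (suc c)) {{ℚ.positive (ι-pos (s≤s z≤n))}} (proj₂ small) ⟩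
    ι (suc c) * (ε * inv c) ≡⟨ solve 3 (λ a e b → a :* (e :* b) := (b :* a) :* e) refl (ι (suc c)) ε (inv c) ⟩
    (inv c * ι (suc c)) * ε ≡⟨ cong (_* ε) (inv-cancel c) ⟩
    1ℚ * ε ≡⟨ ℚₚ.*-identityˡ ε ⟩
    ε ∎
    where
    small = small-inv (ε * inv c) (*-pos 0<ε (inv-pos c))

  expTerm-suc : ∀ n t → expTerm (suc n) t * ι (suc n) ≡ t * expTerm n t
  expTerm-suc n t = trans
    (solve 4 (λ a t p n → (a :* (t :* p)) :* n := t :* ((a :* n) :* p)) refl (1/! (suc n)) t (t ^ℚ n) (ι (suc n)))
    (cong (λ c → t * (c * t ^ℚ n)) (1/!-suc n))

  -- From index `T` on the ratio of successive terms is at most 1, so the terms stay bounded; the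
  -- last factor `T / (n + 1)` then makes them small.
  expTerm-vanishes : ∀ c T ε → 0ℚ < ε → ∃[ N ] ∀ n → N ℕ.≤ n → ι c * expTerm n (ι T) < ε
  expTerm-vanishes c T ε 0<ε = suc (proj₁ small ⊔ T) , bound
    where
    t = ι T
    decreasing : ∀ n → T ℕ.≤ n → expTerm (suc n) t ≤ expTerm n t
    decreasing n T≤n = *-cancel-≤ (ι (suc n)) (ι-pos (s≤s z≤n)) (begin
      expTerm (suc n) t * ι (suc n) ≡⟨ expTerm-suc n t ⟩
      t * expTerm n t ≤⟨ *-monoʳ (expTerm n t) (expTerm-nonneg n (ι-nonneg T)) (ι-mono (ℕₚ.m≤n⇒m≤1+n T≤n)) ⟩
      ι (suc n) * expTerm n t ≡⟨ ℚₚ.*-comm (ι (suc n)) (expTerm n t) ⟩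
      expTerm n t * ι (suc n) ∎)
    bounded : ∀ i → expTerm (i ℕ.+ T) t ≤ expTerm T t
    bounded zero    = ℚₚ.≤-refl
    bounded (suc i) = ℚₚ.≤-trans (decreasing (i ℕ.+ T) (ℕₚ.m≤n+m T i)) (bounded i)
    C : ℕ
    C = proj₁ (upper-bound (expTerm T t))
    small : ∃[ K ] ∀ k → K ℕ.≤ k → ι (c ℕ.* (T ℕ.* C)) * inv k < ε
    small = inv-vanishes (c ℕ.* (T ℕ.* C)) ε 0<ε
    bound : ∀ n → suc (proj₁ small ⊔ T) ℕ.≤ n → ι c * expTerm n t < ε
    bound (suc n) (s≤s large) = begin-strict
      ι c * expTerm (suc n) t
        ≡⟨ cong (ι c *_) (ℚₚ.*-identityʳ (expTerm (suc n) t)) ⟨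
      ι c * (expTerm (suc n) t * 1ℚ)
        ≡⟨ cong (λ e → ι c * (expTerm (suc n) t * e)) (trans (sym (inv-cancel n)) (ℚₚ.*-comm (inv n) (ι (suc n)))) ⟩
      ι c * (expTerm (suc n) t * (ι (suc n) * inv n))
        ≡⟨ cong (ι c *_) (trans (sym (ℚₚ.*-assoc (expTerm (suc n) t) (ι (suc n)) (inv n))) (cong (_* inv n) (expTerm-suc n t))) ⟩
      ι c * (t * expTerm n t * inv n)
        ≤⟨ *-monoˡ (ι c) (ι-nonneg c) (*-monoʳ (inv n) (0≤inv n) (*-monoˡ t (ι-nonneg T)
             (ℚₚ.≤-trans (subst (λ m → expTerm m t ≤ expTerm T t) (ℕₚ.m∸n+n≡m (ℕₚ.m⊔n≤o⇒n≤o (proj₁ small) T large)) (bounded (n ℕ.∸ T)))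
                         (proj₂ (upper-bound (expTerm T t)))))) ⟩
      ι c * (t * ι C * inv n)
        ≡⟨ ℚₚ.*-assoc (ι c) (t * ι C) (inv n) ⟨
      ι c * (t * ι C) * inv n
        ≡⟨ cong (_* inv n) (trans (ι-* c (T ℕ.* C)) (cong (ι c *_) (ι-* T C))) ⟨
      ι (c ℕ.* (T ℕ.* C)) * inv n
        <⟨ proj₂ small n (ℕₚ.m⊔n≤o⇒m≤o (proj₁ small) T large) ⟩
      ε ∎

  bernoulliℚ : ∀ {h} → 0ℚ ≤ h → ∀ n → 1ℚ + ι n * h ≤ (1ℚ + h) ^ℚ n
  bernoulliℚ {h} 0≤h zero = ℚₚ.≤-reflexive (trans (cong (λ c → 1ℚ + c * h) ι-0) (solve 1 (λ h → con 1ℚ :+ con 0ℚ :* h := con 1ℚ) refl h))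
  bernoulliℚ {h} 0≤h (suc n) = begin
    1ℚ + ι (suc n) * h ≡⟨ cong (λ c → 1ℚ + c * h) (ι-suc n) ⟩
    1ℚ + (1ℚ + ι n) * h ≤⟨ ≤-+ʳ _ (*-nonneg (ι-nonneg n) (*-nonneg 0≤h 0≤h)) ⟩
    1ℚ + (1ℚ + ι n) * h + ι n * (h * h) ≡⟨ solve 2 (λ n h → con 1ℚ :+ (con 1ℚ :+ n) :* h :+ n :* (h :* h) := (con 1ℚ :+ h) :* (con 1ℚ :+ n :* h)) refl (ι n) h ⟩
    (1ℚ + h) * (1ℚ + ι n * h) ≤⟨ *-monoˡ (1ℚ + h) (+-nonneg 0≤1 0≤h) (bernoulliℚ 0≤h n) ⟩
    (1ℚ + h) * (1ℚ + h) ^ℚ n ∎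

  -- The rounded-down logarithm of `q` to the base `b`, by a search downwards from `F`. The default
  -- 0 is correct when `1 ≤ q`.
  discreteLog : ℚ → ℚ → ℕ → ℕ
  discreteLog b q zero    = 0
  discreteLog b q (suc F) = if does (b ^ℚ suc F ℚ.≤? q) then suc F else discreteLog b q F

  module _ (b q : ℚ) where

    private
      pick : ∀ F → Dec (b ^ℚ suc F ≤ q) → ℕ
      pick F D = if does D then suc F else discreteLog b q F

    discreteLog-≤ : ∀ F → discreteLog b q F ℕ.≤ F
    discreteLog-≤ zero    = z≤n
    discreteLog-≤ (suc F) = split (b ^ℚ suc F ℚ.≤? q)
      where
      split : (D : Dec (b ^ℚ suc F ≤ q)) → pick F D ℕ.≤ suc F
      split (yes _) = ℕₚ.≤-refl
      split (no _)  = ℕₚ.m≤n⇒m≤1+n (discreteLog-≤ F)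

    discreteLog-lower : 1ℚ ≤ q → ∀ F → b ^ℚ discreteLog b q F ≤ q
    discreteLog-lower 1≤q zero    = 1≤q
    discreteLog-lower 1≤q (suc F) = split (b ^ℚ suc F ℚ.≤? q)
      where
      split : (D : Dec (b ^ℚ suc F ≤ q)) → b ^ℚ pick F D ≤ q
      split (yes b^≤q) = b^≤q
      split (no _)     = discreteLog-lower 1≤q F

    discreteLog-upper : ∀ F → q < b ^ℚ suc F → q < b ^ℚ suc (discreteLog b q F)
    discreteLog-upper zero    q< = q<
    discreteLog-upper (suc F) q< = split (b ^ℚ suc F ℚ.≤? q)
      where
      split : (D : Dec (b ^ℚ suc F ≤ q)) → q < b ^ℚ suc (pick F D)
      split (yes _)   = q<
      split (no b^≰q) = discreteLog-upper F (ℚₚ.≰⇒> b^≰q)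

  base : ℕ → ℚ
  base k = 1ℚ + inv k

  1≤base : ∀ k → 1ℚ ≤ base k
  1≤base k = ≤-+ʳ 1ℚ (0≤inv k)

  -- Bernoulli's inequality. It shows that `T * suc k` suffices as a search bound for numbers up to
  -- `T`, and that the cost of a vertex is a number of powers of the base proportional to `suc k`.
  ι≤base^ : ∀ T k → ι (suc T) ≤ base k ^ℚ (T ℕ.* suc k)
  ι≤base^ T k = begin
    ι (suc T) ≡⟨ ι-suc T ⟩
    1ℚ + ι T ≡⟨ cong (1ℚ +_) (trans (sym (ℚₚ.*-identityʳ (ι T))) (cong (ι T *_) (sym (inv-cancel k)))) ⟩
    1ℚ + ι T * (inv k * ι (suc k)) ≡⟨ cong (1ℚ +_) (solve 3 (λ t i m → t :* (i :* m) := (t :* m) :* i) refl (ι T) (inv k) (ι (suc k))) ⟩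
    1ℚ + ι T * ι (suc k) * inv k ≡⟨ cong (λ c → 1ℚ + c * inv k) (ι-* T (suc k)) ⟨
    1ℚ + ι (T ℕ.* suc k) * inv k ≤⟨ bernoulliℚ (0≤inv k) (T ℕ.* suc k) ⟩
    base k ^ℚ (T ℕ.* suc k) ∎

  -- In base 1 + 1/(k+1), the discrete logarithm of the k-th approximation of x is about k+1 times
  -- the natural logarithm.
  module Logarithm (x : ℝ) (T K₀ : ℕ) (1≤x : ∀ k → K₀ ℕ.≤ k → 1ℚ ≤ seq x k) (x≤T : ∀ k → K₀ ℕ.≤ k → seq x k ≤ ι T) where

    private
      q : ℕ → ℚ
      q = seq x

    index : ℕ → ℕ
    index k = discreteLog (base k) (q k) (T ℕ.* suc k)

    approx : ℕ → ℚ
    approx k = ι (index k) * inv k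

    index-lower : ∀ k → K₀ ℕ.≤ k → base k ^ℚ index k ≤ q k
    index-lower k K≤k = discreteLog-lower (base k) (q k) (1≤x k K≤k) (T ℕ.* suc k)

    index-upper : ∀ k → K₀ ℕ.≤ k → q k < base k ^ℚ suc (index k)
    index-upper k K≤k = discreteLog-upper (base k) (q k) (T ℕ.* suc k) (begin-strict
      q k ≤⟨ x≤T k K≤k ⟩
      ι T <⟨ shift-< (ι T) (ℚₚ.positive⁻¹ 1ℚ) (ℚₚ.+-identityʳ (ι T)) (trans (ℚₚ.+-comm (ι T) 1ℚ) (sym (ι-suc T))) ⟩
      ι (suc T) ≤⟨ ι≤base^ T k ⟩
      base k ^ℚ (T ℕ.* suc k) ≡⟨ ℚₚ.*-identityˡ _ ⟨
      1ℚ * base k ^ℚ (T ℕ.* suc k) ≤⟨ *-monoʳ _ (^-nonneg (T ℕ.* suc k) (ℚₚ.≤-trans 0≤1 (1≤base k))) (1≤base k) ⟩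
      base k ^ℚ suc (T ℕ.* suc k) ∎)

    0≤approx : ∀ k → 0ℚ ≤ approx k
    0≤approx k = *-nonneg (ι-nonneg (index k)) (0≤inv k)

    approx-≤ : ∀ k → approx k ≤ ι T
    approx-≤ k = begin
      ι (index k) * inv k ≤⟨ *-monoʳ (inv k) (0≤inv k) (ι-mono (discreteLog-≤ (base k) (q k) (T ℕ.* suc k))) ⟩
      ι (T ℕ.* suc k) * inv k ≡⟨ cong (_* inv k) (ι-* T (suc k)) ⟩
      ι T * ι (suc k) * inv k ≡⟨ solve 3 (λ t m i → t :* m :* i := t :* (i :* m)) refl (ι T) (ι (suc k)) (inv k) ⟩
      ι T * (inv k * ι (suc k)) ≡⟨ trans (cong (ι T *_) (inv-cancel k)) (ℚₚ.*-identityʳ (ι T)) ⟩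
      ι T ∎

    private
      e : ℕ → ℕ → ℚ
      e n k = expSum (suc n) (approx k)

      β : ℕ → ℚ
      β k = base k ^ℚ index k

      0≤β : ∀ k → 0ℚ ≤ β k
      0≤β k = ^-nonneg (index k) (ℚₚ.≤-trans 0≤1 (1≤base k))

      0≤e : ∀ n k → 0ℚ ≤ e n k
      0≤e n k = expSum-nonneg (suc n) (0≤approx k)

      ιTT : ∀ k → ι T * (ι T * inv k) ≡ ι (T ℕ.* T) * inv k
      ιTT k = trans (sym (ℚₚ.*-assoc (ι T) (ι T) (inv k))) (cong (_* inv k) (sym (ι-* T T)))

      excess : ∀ n k → K₀ ℕ.≤ k → e n k ≤ q k + ι (T ℕ.* T) * inv k * e n k
      excess n k K≤k = begin
        e n k
          ≤⟨ expSum-≤-power (0≤inv k) n (index k) ⟩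
        β k * (1ℚ + approx k * inv k * e n k)
          ≡⟨ solve 4 (λ b a i y → b :* (con 1ℚ :+ a :* i :* y) := b :+ b :* (a :* i) :* y) refl (β k) (approx k) (inv k) (e n k) ⟩
        β k + β k * (approx k * inv k) * e n k
          ≤⟨ ℚₚ.+-mono-≤ (index-lower k K≤k) (*-monoʳ (e n k) (0≤e n k)
               (*-mono (0≤β k) (ℚₚ.≤-trans (index-lower k K≤k) (x≤T k K≤k)) (*-nonneg (0≤approx k) (0≤inv k))
                       (*-monoʳ (inv k) (0≤inv k) (approx-≤ k)))) ⟩
        q k + ι T * (ι T * inv k) * e n k
          ≡⟨ cong (λ c → q k + c * e n k) (ιTT k) ⟩
        q k + ι (T ℕ.* T) * inv k * e n k ∎

      -- `excess` bounds `e n k` in terms of itself; with a coefficient of at most one half the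
      -- occurrence on the right is absorbed.
      e-bounded : ∀ n k → K₀ ℕ.≤ k → ι (T ℕ.* T) * inv k ≤ ½ → e n k ≤ ι (2 ℕ.* T)
      e-bounded n k K≤k small = begin
        e n k ≡⟨ solve 1 (λ y → y := (con 1ℚ :+ con 1ℚ) :* (:- (con ½ :* y) :+ y)) refl (e n k) ⟩
        (1ℚ + 1ℚ) * (- (½ * e n k) + e n k)
                                         ≤⟨ *-monoˡ (1ℚ + 1ℚ) (+-nonneg 0≤1 0≤1) (shift-≤ (- (½ * e n k)) (ℚₚ.≤-trans (excess n k K≤k)
                                              (ℚₚ.+-mono-≤ (x≤T k K≤k) (*-monoʳ (e n k) (0≤e n k) small))) refl
                                              (solve 2 (λ y t → :- (con ½ :* y) :+ (t :+ con ½ :* y) := t) refl (e n k) (ι T))) ⟩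
        (1ℚ + 1ℚ) * ι T ≡⟨ cong (_* ι T) (trans (cong₂ _+_ (sym ι-1) (sym ι-1)) (sym (ι-+ 1 1))) ⟩
        ι 2 * ι T ≡⟨ ι-* 2 T ⟨
        ι (2 ℕ.* T) ∎

      -- The first error comes from cutting off the series, the second from rounding the exponent
      -- down.
      deficit : ∀ n k → K₀ ℕ.≤ k → q k < e n k + (ι (T ℕ.* T) * expTerm n (ι T) + ι T * inv k)
      deficit n k K≤k = begin-strict
        q k
          <⟨ index-upper k K≤k ⟩
        (1ℚ + inv k) * β k
          ≡⟨ solve 2 (λ i b → (con 1ℚ :+ i) :* b := b :+ b :* i) refl (inv k) (β k) ⟩
        β k + β k * inv k
          ≤⟨ ℚₚ.+-mono-≤ (power-≤-expSum (0≤inv k) n (index k)) (*-monoʳ (inv k) (0≤inv k) (ℚₚ.≤-trans (index-lower k K≤k) (x≤T k K≤k))) ⟩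
        e n k + expTerm n (approx k) * (approx k * β k) + ι T * inv k
          ≤⟨ ℚₚ.+-monoˡ-≤ (ι T * inv k) (ℚₚ.+-monoʳ-≤ (e n k)
               (*-mono (expTerm-nonneg n (0≤approx k)) (expTerm-mono n (0≤approx k) (approx-≤ k)) (*-nonneg (0≤approx k) (0≤β k))
                       (*-mono (0≤approx k) (approx-≤ k) (0≤β k) (ℚₚ.≤-trans (index-lower k K≤k) (x≤T k K≤k))))) ⟩
        e n k + expTerm n (ι T) * (ι T * ι T) + ι T * inv k
          ≡⟨ trans (ℚₚ.+-assoc (e n k) _ _) (cong (λ c → e n k + (c + ι T * inv k))
               (trans (ℚₚ.*-comm (expTerm n (ι T)) (ι T * ι T)) (cong (_* expTerm n (ι T)) (sym (ι-* T T))))) ⟩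
        e n k + (ι (T ℕ.* T) * expTerm n (ι T) + ι T * inv k) ∎

    -- All approximations lie below `T`, so the number of terms can be fixed by the term at `T`
    -- before `k` is chosen.
    exp-approx : ∀ ε → 0ℚ < ε → ∃[ N ] ∀ n → N ℕ.≤ n → ∃[ K ] ∀ k → K ℕ.≤ k → ℚ.∣ expSum (suc n) (approx k) - q k ∣ < ε
    exp-approx ε 0<ε = proj₁ tail , λ n N≤n → K₀ ⊔ (K₁ ⊔ (K₂ ⊔ K₃)) , λ k K≤k → close n k N≤n
      (ℕₚ.m⊔n≤o⇒m≤o K₀ _ K≤k)
      (proj₂ below½ k (ℕₚ.m⊔n≤o⇒m≤o K₁ _ (ℕₚ.m⊔n≤o⇒n≤o K₀ _ K≤k)))
      (proj₂ below-ε k (ℕₚ.m⊔n≤o⇒m≤o K₂ K₃ (ℕₚ.m⊔n≤o⇒n≤o K₁ _ (ℕₚ.m⊔n≤o⇒n≤o K₀ _ K≤k))))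
      (proj₂ below-½ε k (ℕₚ.m⊔n≤o⇒n≤o K₂ K₃ (ℕₚ.m⊔n≤o⇒n≤o K₁ _ (ℕₚ.m⊔n≤o⇒n≤o K₀ _ K≤k))))
      where
      tail    = expTerm-vanishes (T ℕ.* T) T (half ε) (half-pos 0<ε)
      below½  = inv-vanishes (T ℕ.* T) ½ 0<½
      below-ε = inv-vanishes (T ℕ.* T ℕ.* (2 ℕ.* T)) ε 0<ε
      below-½ε = inv-vanishes T (half ε) (half-pos 0<ε)
      K₁ K₂ K₃ : ℕ
      K₁ = proj₁ below½
      K₂ = proj₁ below-ε
      K₃ = proj₁ below-½ε
      close : ∀ n k → proj₁ tail ℕ.≤ n → K₀ ℕ.≤ k → ι (T ℕ.* T) * inv k < ½ →
              ι (T ℕ.* T ℕ.* (2 ℕ.* T)) * inv k < ε → ι T * inv k < half ε → ℚ.∣ e n k - q k ∣ < ε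
      close n k N≤n K≤k s₁ s₂ s₃ = ∣∣-intro
        (begin-strict
          e n k ≤⟨ excess n k K≤k ⟩
          q k + ι (T ℕ.* T) * inv k * e n k ≤⟨ ℚₚ.+-monoʳ-≤ (q k) (*-monoˡ (ι (T ℕ.* T) * inv k)
                                                                   (*-nonneg (ι-nonneg (T ℕ.* T)) (0≤inv k)) (e-bounded n k K≤k (ℚₚ.<⇒≤ s₁))) ⟩
          q k + ι (T ℕ.* T) * inv k * ι (2 ℕ.* T) ≡⟨ cong (q k +_) (trans (solve 3 (λ a i b → a :* i :* b := a :* b :* i) refl (ι (T ℕ.* T)) (inv k) (ι (2 ℕ.* T)))
                                                                   (cong (_* inv k) (sym (ι-* (T ℕ.* T) (2 ℕ.* T))))) ⟩
          q k + ι (T ℕ.* T ℕ.* (2 ℕ.* T)) * inv k <⟨ ℚₚ.+-monoʳ-< (q k) s₂ ⟩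
          q k + ε ∎)
        (begin-strict
          q k <⟨ deficit n k K≤k ⟩
          e n k + (ι (T ℕ.* T) * expTerm n (ι T) + ι T * inv k) <⟨ ℚₚ.+-monoʳ-< (e n k) (ℚₚ.+-mono-< (proj₂ tail n N≤n) s₃) ⟩
          e n k + (half ε + half ε) ≡⟨ cong (λ c → e n k + c) (half+half ε) ⟩
          e n k + ε ∎)

    -- The exponentials of the approximations are close to those of `x`, which are Cauchy, and
    -- `expSum-reflects` carries closeness back to the exponents. A quarter of `ε` goes to each
    -- exponential and half to `x`; `n` exceeds the required number by one to supply the two terms
    -- that `expSum-reflects` needs.
    approx-cauchy : IsCauchy approx
    approx-cauchy ε 0<ε = K ⊔ K′ , λ k l K≤k K≤l → ∣∣-intro (oneSided k l (left k K≤k) (left l K≤l) (right k K≤k) (right l K≤l))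
                                                              (oneSided l k (left l K≤l) (left k K≤k) (right l K≤l) (right k K≤k))
      where
      ε₁ = half (half ε)
      0<ε₁ : 0ℚ < ε₁
      0<ε₁ = half-pos (half-pos 0<ε)
      ex = exp-approx ε₁ 0<ε₁
      n K K′ : ℕ
      n = suc (proj₁ ex)
      near = proj₂ ex n (ℕₚ.n≤1+n (proj₁ ex))
      K = proj₁ near
      xc = cauchy x (half ε) (half-pos 0<ε)
      K′ = proj₁ xc
      left : ∀ k → K ⊔ K′ ℕ.≤ k → K ℕ.≤ k
      left k = ℕₚ.m⊔n≤o⇒m≤o K K′
      right : ∀ k → K ⊔ K′ ℕ.≤ k → K′ ℕ.≤ k
      right k = ℕₚ.m⊔n≤o⇒n≤o K K′
      oneSided : ∀ k l → K ℕ.≤ k → K ℕ.≤ l → K′ ℕ.≤ k → K′ ℕ.≤ l → approx k < approx l + ε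
      oneSided k l K≤k K≤l K′≤k K′≤l = expSum-reflects (proj₁ ex) (0≤approx l) (0≤approx k) 0<ε
        (subst (λ c → e n k < e n l + c)
          (trans (solve 2 (λ a b → a :+ (b :+ a) := (a :+ a) :+ b) refl ε₁ (half ε))
                 (trans (cong (_+ half ε) (half+half (half ε))) (half+half ε)))
          (∣∣-upper {e n k} {e n l} (∣∣-triangle {e n k} {q k} {e n l} (proj₂ near k K≤k)
            (∣∣-triangle {q k} {q l} {e n l} (proj₂ xc k l K′≤k K′≤l) (∣∣-sym {e n l} {q l} (proj₂ near l K≤l))))))

    logarithm : ℝ
    logarithm = mkℝ approx approx-cauchy

    logarithm-isLog : logarithm IsLogOf x
    logarithm-isLog ε 0<ε = suc (proj₁ ex) , λ { (suc n) (s≤s N≤n) → below n N≤n , above n N≤n }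
      where
      ex = exp-approx (half ε) (half-pos 0<ε)
      below : ∀ n → proj₁ ex ℕ.≤ n → x -ᴿ fromℚ ε <ᴿ expPartialSum logarithm (suc n)
      below n N≤n = half ε , half-pos 0<ε , proj₁ (proj₂ ex n N≤n) , λ k K≤k →
        shift-< (- ε + half ε) (∣∣-lower {e n k} {q k} (proj₂ (proj₂ ex n N≤n) k K≤k))
          (solve 3 (λ q ε h → (:- ε :+ h) :+ q := (q :- ε) :+ h) refl (q k) ε (half ε))
          (trans (solve 3 (λ y ε h → (:- ε :+ h) :+ (y :+ h) := y :+ ((h :+ h) :- ε)) refl (e n k) ε (half ε))
            (trans (cong (λ c → e n k + (c - ε)) (half+half ε)) (trans (cong (e n k +_) (ℚₚ.+-inverseʳ ε))
              (trans (ℚₚ.+-identityʳ (e n k)) (sym (seq-expPartialSum logarithm (suc n) k))))))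
      above : ∀ n → proj₁ ex ℕ.≤ n → expPartialSum logarithm (suc n) <ᴿ x +ᴿ fromℚ ε
      above n N≤n = half ε , half-pos 0<ε , proj₁ (proj₂ ex n N≤n) , λ k K≤k →
        shift-< (half ε) (∣∣-upper {e n k} {q k} (proj₂ (proj₂ ex n N≤n) k K≤k))
          (trans (ℚₚ.+-comm (half ε) (e n k)) (cong (_+ half ε) (sym (seq-expPartialSum logarithm (suc n) k))))
          (trans (solve 2 (λ q h → h :+ (q :+ h) := q :+ (h :+ h)) refl (q k) (half ε)) (cong (q k +_) (half+half ε)))

-- Completeness, and the passage from comparisons of graphs to limits.

module Limits where

  open OrderedMonoids
  open PartitionFunctions
  open GraphParameters
  open Decomposition
  open PatchEnumeration
  open Rationals
  open Comparisons
  open Weights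
  open ExponentialSeries
  open Logarithms
  open import Data.Nat using (_⊔_)
  open import Data.Rational using (_+_; _*_; _-_; -_; _≤_; _<_)
  open import Data.List.Relation.Unary.Any using (index)

  open +-*-Solver using (solve; _:+_; _:*_; _:-_; :-_; _:=_; con)

  -- One inequality is enough, as `m` and `n` may be exchanged. `K` may depend on them: a logarithm
  -- is controlled only at approximations that are late for both terms.
  CauchySequence : (ℕ → ℝ) → Set
  CauchySequence a = ∀ ε → 0ℚ < ε → ∃[ N ] ∀ m n → N ℕ.≤ m → N ℕ.≤ n →
                     ∃[ K ] ∀ k → K ℕ.≤ k → seq (a m) k < seq (a n) k + ε

  -- The limit is diagonal: its p-th approximation is a late approximation of a late term.
  module Completeness (a : ℕ → ℝ) (a-cauchy : CauchySequence a) where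

    private
      N κ : ℕ → ℕ
      N p = proj₁ (a-cauchy (inv p) (inv-pos p))
      κ p = proj₁ (cauchy (a (N p)) (inv p) (inv-pos p))

      L : ℕ → ℚ
      L p = seq (a (N p)) (κ p)

      term-near : ∀ p n → N p ℕ.≤ n → ∃[ K ] ∀ k → K ℕ.≤ k → ℚ.∣ seq (a n) k - L p ∣ < inv p + inv p
      term-near p n N≤n = (K₁ ⊔ K₂) ⊔ κ p , λ k K≤k → ∣∣-triangle {seq (a n) k} {seq (a (N p)) k} {L p}
        (∣∣-intro (proj₂ forth k (ℕₚ.m⊔n≤o⇒m≤o K₁ K₂ (ℕₚ.m⊔n≤o⇒m≤o (K₁ ⊔ K₂) (κ p) K≤k)))
                  (proj₂ back k (ℕₚ.m⊔n≤o⇒n≤o K₁ K₂ (ℕₚ.m⊔n≤o⇒m≤o (K₁ ⊔ K₂) (κ p) K≤k))))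
        (proj₂ (cauchy (a (N p)) (inv p) (inv-pos p)) k (κ p) (ℕₚ.m⊔n≤o⇒n≤o (K₁ ⊔ K₂) (κ p) K≤k) ℕₚ.≤-refl)
        where
        forth = proj₂ (a-cauchy (inv p) (inv-pos p)) n (N p) N≤n ℕₚ.≤-refl
        back  = proj₂ (a-cauchy (inv p) (inv-pos p)) (N p) n ℕₚ.≤-refl N≤n
        K₁ K₂ : ℕ
        K₁ = proj₁ forth
        K₂ = proj₁ back

      L-near : ∀ p r → ℚ.∣ L p - L r ∣ < (inv p + inv p) + (inv r + inv r)
      L-near p r = ∣∣-triangle {L p} {seq (a n) k} {L r}
        (∣∣-sym {seq (a n) k} {L p} (proj₂ p-near k (ℕₚ.m≤m⊔n (proj₁ p-near) (proj₁ r-near))))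
        (proj₂ r-near k (ℕₚ.m≤n⊔m (proj₁ p-near) (proj₁ r-near)))
        where
        n k : ℕ
        n = N p ⊔ N r
        p-near = term-near p n (ℕₚ.m≤m⊔n (N p) (N r))
        r-near = term-near r n (ℕₚ.m≤n⊔m (N p) (N r))
        k = proj₁ p-near ⊔ proj₁ r-near

      small-double : ∀ {P p ε} → inv P < half ε → P ℕ.≤ p → inv p + inv p < ε
      small-double {P} {p} {ε} small P≤p = subst (inv p + inv p <_) (half+half ε)
        (ℚₚ.+-mono-< (ℚₚ.≤-<-trans (inv-anti P≤p) small) (ℚₚ.≤-<-trans (inv-anti P≤p) small))

      L-cauchy : IsCauchy L
      L-cauchy ε 0<ε = proj₁ small , λ p r P≤p P≤r → ℚₚ.<-trans (L-near p r)
        (subst ((inv p + inv p) + (inv r + inv r) <_) (half+half ε)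
          (ℚₚ.+-mono-< (small-double {proj₁ small} {p} {half ε} (proj₂ small) P≤p) (small-double {proj₁ small} {r} {half ε} (proj₂ small) P≤r)))
        where
        small = small-inv (half (half ε)) (half-pos (half-pos 0<ε))

    limit : LimitExists a
    limit = mkℝ L L-cauchy , λ ε 0<ε →
      let η = half (half ε)
          0<η = half-pos (half-pos 0<ε)
          -- Then `inv P + inv P` is below `half η`, and `a n` and `L` are each within `η` of `L P`.
          -- Their distance is below `half ε`; the other half is the gap required by `<ᴿ`.
          small = small-inv (half (half η)) (half-pos (half-pos 0<η))
          P = proj₁ small
      in N P , λ n N≤n →
        let near = term-near P n N≤n
            close : ∀ k → proj₁ near ⊔ P ℕ.≤ k → ℚ.∣ seq (a n) k - L k ∣ < half ε
            close k K≤k = subst (ℚ.∣ seq (a n) k - L k ∣ <_) (half+half (half ε))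
              (∣∣-triangle {seq (a n) k} {L P} {L k}
                (ℚₚ.<-trans (proj₂ near k (ℕₚ.m⊔n≤o⇒m≤o (proj₁ near) P K≤k))
                            (ℚₚ.<-trans (small-double {P} {P} {half η} (proj₂ small) ℕₚ.≤-refl) (half-< 0<η)))
                (ℚₚ.<-trans (L-near P k) (subst ((inv P + inv P) + (inv k + inv k) <_) (half+half η)
                  (ℚₚ.+-mono-< (small-double {P} {P} {half η} (proj₂ small) ℕₚ.≤-refl)
                               (small-double {P} {k} {half η} (proj₂ small) (ℕₚ.m⊔n≤o⇒n≤o (proj₁ near) P K≤k))))))
        in (half ε , half-pos 0<ε , proj₁ near ⊔ P , λ k K≤k →
              shift-< (- ε + half ε) (∣∣-lower {seq (a n) k} {L k} (close k K≤k))
                (solve 3 (λ q ε h → (:- ε :+ h) :+ q := (q :- ε) :+ h) refl (L k) ε (half ε))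
                (trans (solve 3 (λ y ε h → (:- ε :+ h) :+ (y :+ h) := y :+ ((h :+ h) :- ε)) refl (seq (a n) k) ε (half ε))
                  (trans (cong (λ c → seq (a n) k + (c - ε)) (half+half ε)) (trans (cong (seq (a n) k +_) (ℚₚ.+-inverseʳ ε))
                    (ℚₚ.+-identityʳ (seq (a n) k)))))) ,
           (half ε , half-pos 0<ε , proj₁ near ⊔ P , λ k K≤k →
              shift-< (half ε) (∣∣-upper {seq (a n) k} {L k} (close k K≤k))
                (ℚₚ.+-comm (half ε) (seq (a n) k))
                (trans (solve 2 (λ q h → h :+ (q :+ h) := q :+ (h :+ h)) refl (L k) (half ε)) (cong (L k +_) (half+half ε))))
      where
      half-< : ∀ {η} → 0ℚ < η → half η < η
      half-< {η} 0<η = shift-< (half η) (half-pos 0<η) (ℚₚ.+-identityʳ (half η)) (half+half η)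

  abstract
    recip : FiniteGraph → ℚ
    recip H = 1 /∣ H ∣

    recip-def : ∀ H → recip H ≡ 1 /∣ H ∣
    recip-def H = refl

    recip-cancel : ∀ H → recip H * ι (order H) ≡ 1ℚ
    recip-cancel H = trans (/-cancel 1 (order H) {{FiniteGraph.nonempty H}}) ι-1

    density : ∀ a H → (a /∣ H ∣) ≡ ι a * recip H
    density a H = begin
      a /∣ H ∣ ≡⟨ ℚₚ.*-identityʳ (a /∣ H ∣) ⟨
      (a /∣ H ∣) * 1ℚ ≡⟨ cong ((a /∣ H ∣) *_) (trans (sym (recip-cancel H)) (ℚₚ.*-comm (recip H) (ι (order H)))) ⟩
      (a /∣ H ∣) * (ι (order H) * recip H) ≡⟨ ℚₚ.*-assoc (a /∣ H ∣) (ι (order H)) (recip H) ⟨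
      (a /∣ H ∣) * ι (order H) * recip H ≡⟨ cong (_* recip H) (/-cancel a (order H) {{FiniteGraph.nonempty H}}) ⟩
      ι a * recip H ∎
      where open ≡-Reasoning

  1≤order : ∀ H → 1 ℕ.≤ order H
  1≤order H = ℕ.>-nonZero⁻¹ (order H) {{FiniteGraph.nonempty H}}

  recip-nonneg : ∀ H → 0ℚ ≤ recip H
  recip-nonneg H = *-cancel-≤ (ι (order H)) (ι-pos (1≤order H))
    (subst₂ _≤_ (sym (ℚₚ.*-zeroˡ (ι (order H)))) (sym (recip-cancel H)) 0≤1)

  recip-≤1 : ∀ H → recip H ≤ 1ℚ
  recip-≤1 H = *-cancel-≤ (ι (order H)) (ι-pos (1≤order H))
    (subst₂ _≤_ (sym (recip-cancel H)) (sym (ℚₚ.*-identityˡ (ι (order H)))) (subst (_≤ ι (order H)) ι-1 (ι-mono (1≤order H))))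

  density-≤ : ∀ q a b e (H K : FiniteGraph) →
              suc q ℕ.* (a ℕ.* order K) ℕ.≤ suc q ℕ.* (b ℕ.* order H) ℕ.+ e ℕ.* (order H ℕ.* order K) →
              ι a * recip H ≤ ι b * recip K + ι e * inv q
  density-≤ q a b e H K less = begin
    ι a * r
      ≡⟨ expand a (order K) r s (recip-cancel K) ⟨
    ι (suc q ℕ.* (a ℕ.* order K)) * (inv q * (r * s))
      ≤⟨ *-monoʳ _ (*-nonneg (0≤inv q) (*-nonneg (recip-nonneg H) (recip-nonneg K))) (ι-mono less) ⟩
    ι (suc q ℕ.* (b ℕ.* order H) ℕ.+ e ℕ.* (order H ℕ.* order K)) * (inv q * (r * s))
      ≡⟨ trans (cong (_* (inv q * (r * s))) (ι-+ (suc q ℕ.* (b ℕ.* order H)) (e ℕ.* (order H ℕ.* order K))))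
               (ℚₚ.*-distribʳ-+ (inv q * (r * s)) (ι (suc q ℕ.* (b ℕ.* order H))) (ι (e ℕ.* (order H ℕ.* order K)))) ⟩
    ι (suc q ℕ.* (b ℕ.* order H)) * (inv q * (r * s)) + ι (e ℕ.* (order H ℕ.* order K)) * (inv q * (r * s))
      ≡⟨ cong₂ _+_ (trans (cong (λ c → ι (suc q ℕ.* (b ℕ.* order H)) * (inv q * c)) (ℚₚ.*-comm r s))
                          (expand b (order H) s r (recip-cancel H))) error ⟩
    ι b * s + ι e * inv q ∎
    where
    open ℚₚ.≤-Reasoning
    r s : ℚ
    r = recip H
    s = recip K
    expand : ∀ a n r s → s * ι n ≡ 1ℚ → ι (suc q ℕ.* (a ℕ.* n)) * (inv q * (r * s)) ≡ ι a * r
    expand a n r s cancel = begin-equality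
      ι (suc q ℕ.* (a ℕ.* n)) * (inv q * (r * s))
        ≡⟨ cong (_* (inv q * (r * s))) (trans (ι-* (suc q) (a ℕ.* n)) (cong (ι (suc q) *_) (ι-* a n))) ⟩
      ι (suc q) * (ι a * ι n) * (inv q * (r * s))
        ≡⟨ solve 6 (λ Q a n i r s → Q :* (a :* n) :* (i :* (r :* s)) := (i :* Q) :* (s :* n) :* (a :* r)) refl (ι (suc q)) (ι a) (ι n) (inv q) r s ⟩
      (inv q * ι (suc q)) * (s * ι n) * (ι a * r)
        ≡⟨ cong₂ (λ c c′ → c * c′ * (ι a * r)) (inv-cancel q) cancel ⟩
      1ℚ * 1ℚ * (ι a * r)
        ≡⟨ trans (cong (_* (ι a * r)) (ℚₚ.*-identityʳ 1ℚ)) (ℚₚ.*-identityˡ (ι a * r)) ⟩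
      ι a * r ∎
    error : ι (e ℕ.* (order H ℕ.* order K)) * (inv q * (r * s)) ≡ ι e * inv q
    error = begin-equality
      ι (e ℕ.* (order H ℕ.* order K)) * (inv q * (r * s))
        ≡⟨ cong (_* (inv q * (r * s))) (trans (ι-* e (order H ℕ.* order K)) (cong (ι e *_) (ι-* (order H) (order K)))) ⟩
      ι e * (ι (order H) * ι (order K)) * (inv q * (r * s))
        ≡⟨ solve 6 (λ e m n i r s → e :* (m :* n) :* (i :* (r :* s)) := (r :* m) :* (s :* n) :* (e :* i)) refl (ι e) (ι (order H)) (ι (order K)) (inv q) r s ⟩
      (r * ι (order H)) * (s * ι (order K)) * (ι e * inv q)
        ≡⟨ cong₂ (λ c c′ → c * c′ * (ι e * inv q)) (recip-cancel H) (recip-cancel K) ⟩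
      1ℚ * 1ℚ * (ι e * inv q)
        ≡⟨ trans (cong (_* (ι e * inv q)) (ℚₚ.*-identityʳ 1ℚ)) (ℚₚ.*-identityˡ (ι e * inv q)) ⟩
      ι e * inv q ∎

  -- `D` depends on `q` and may be enormous, but it multiplies both the values and the error and
  -- cancels, leaving a relative error of `5 * v / q`.
  cancel-scale : ∀ q D Nm Nn a b v E → 1 ℕ.≤ D →
                 suc q ℕ.* E ℕ.≤ 5 ℕ.* (D ℕ.* (Nm ℕ.* Nn)) →
                 a ℕ.* (D ℕ.* Nn) ℕ.≤ b ℕ.* (D ℕ.* Nm) ℕ.+ v ℕ.* E →
                 suc q ℕ.* (a ℕ.* Nn) ℕ.≤ suc q ℕ.* (b ℕ.* Nm) ℕ.+ 5 ℕ.* v ℕ.* (Nm ℕ.* Nn)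
  cancel-scale q D Nm Nn a b v E 1≤D E-bound less = ℕₚ.*-cancelˡ-≤ D {{ℕ.>-nonZero 1≤D}} (begin
    D ℕ.* (suc q ℕ.* (a ℕ.* Nn)) ≡⟨ left D (suc q) a Nn ⟩
    suc q ℕ.* (a ℕ.* (D ℕ.* Nn)) ≤⟨ ℕₚ.*-monoʳ-≤ (suc q) less ⟩
    suc q ℕ.* (b ℕ.* (D ℕ.* Nm) ℕ.+ v ℕ.* E) ≡⟨ middle (suc q) b D Nm v E ⟩
    suc q ℕ.* (b ℕ.* (D ℕ.* Nm)) ℕ.+ v ℕ.* (suc q ℕ.* E) ≤⟨ ℕₚ.+-monoʳ-≤ _ (ℕₚ.*-monoʳ-≤ v E-bound) ⟩
    suc q ℕ.* (b ℕ.* (D ℕ.* Nm)) ℕ.+ v ℕ.* (5 ℕ.* (D ℕ.* (Nm ℕ.* Nn))) ≡⟨ right (suc q) b D Nm Nn v ⟩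
    D ℕ.* (suc q ℕ.* (b ℕ.* Nm) ℕ.+ 5 ℕ.* v ℕ.* (Nm ℕ.* Nn)) ∎)
    where
    open ℕₚ.≤-Reasoning
    left : ∀ D q a n → D ℕ.* (q ℕ.* (a ℕ.* n)) ≡ q ℕ.* (a ℕ.* (D ℕ.* n))
    left = solve-∀
    middle : ∀ q b D m v E → q ℕ.* (b ℕ.* (D ℕ.* m) ℕ.+ v ℕ.* E) ≡ q ℕ.* (b ℕ.* (D ℕ.* m)) ℕ.+ v ℕ.* (q ℕ.* E)
    middle = solve-∀
    right : ∀ q b D m n v → q ℕ.* (b ℕ.* (D ℕ.* m)) ℕ.+ v ℕ.* (5 ℕ.* (D ℕ.* (m ℕ.* n))) ≡
                            D ℕ.* (q ℕ.* (b ℕ.* m) ℕ.+ 5 ℕ.* v ℕ.* (m ℕ.* n))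
    right = solve-∀

  ^-+ : ∀ b m n → b ^ℚ (m ℕ.+ n) ≡ b ^ℚ m * b ^ℚ n
  ^-+ b zero    n = sym (ℚₚ.*-identityˡ (b ^ℚ n))
  ^-+ b (suc m) n = trans (cong (b *_) (^-+ b m n)) (sym (ℚₚ.*-assoc b (b ^ℚ m) (b ^ℚ n)))

  ^-^ : ∀ b m n → (b ^ℚ m) ^ℚ n ≡ b ^ℚ (m ℕ.* n)
  ^-^ b m zero    = cong (b ^ℚ_) (sym (ℕₚ.*-zeroʳ m))
  ^-^ b m (suc n) = trans (cong (b ^ℚ m *_) (^-^ b m n)) (trans (sym (^-+ b m (m ℕ.* n))) (cong (b ^ℚ_) (sym (ℕₚ.*-suc m n))))

  ^-reflects-≤ : ∀ {b} → 1ℚ < b → ∀ m n → b ^ℚ m ≤ b ^ℚ n → m ℕ.≤ n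
  ^-reflects-≤ {b} 1<b m n b^≤ with m ℕₚ.≤? n
  ... | yes m≤n = m≤n
  ... | no  m≰n = contradiction refl (ℚₚ.<⇒≢ (ℚₚ.<-≤-trans (begin-strict
    b ^ℚ n ≡⟨ ℚₚ.*-identityˡ (b ^ℚ n) ⟨
    1ℚ * b ^ℚ n <⟨ ℚₚ.*-monoˡ-<-pos (b ^ℚ n) {{ℚ.positive (ℚₚ.<-≤-trans (ℚₚ.positive⁻¹ 1ℚ) (1≤^ n 1≤b))}} 1<b ⟩
    b ^ℚ suc n ≡⟨ ℚₚ.*-identityʳ (b ^ℚ suc n) ⟨
    b ^ℚ suc n * 1ℚ ≤⟨ *-monoˡ (b ^ℚ suc n) (^-nonneg (suc n) (ℚₚ.≤-trans 0≤1 1≤b)) (1≤^ (m ℕ.∸ suc n) 1≤b) ⟩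
    b ^ℚ suc n * b ^ℚ (m ℕ.∸ suc n) ≡⟨ ^-+ b (suc n) (m ℕ.∸ suc n) ⟨
    b ^ℚ (suc n ℕ.+ (m ℕ.∸ suc n)) ≡⟨ cong (b ^ℚ_) (ℕₚ.m+[n∸m]≡n (ℕₚ.≰⇒> m≰n)) ⟩
    b ^ℚ m ∎) b^≤))
    where
    open ℚₚ.≤-Reasoning
    1≤b : 1ℚ ≤ b
    1≤b = ℚₚ.<⇒≤ 1<b

  -- Turns a multiplicative comparison into an additive one between exponents. Discrete logarithms
  -- are rounded down, so the larger side has to use `suc l`.
  exponent-compare : ∀ {b X Y C} {j l v} → 1ℚ < b → b ^ℚ j ≤ X → 0ℚ ≤ Y → Y < b ^ℚ suc l → 0ℚ ≤ C → C ≤ b ^ℚ v →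
                     ∀ m n E → X ^ℚ m ≤ Y ^ℚ n * C ^ℚ E → j ℕ.* m ℕ.≤ suc l ℕ.* n ℕ.+ v ℕ.* E
  exponent-compare {b} {X} {Y} {C} {j} {l} {v} 1<b j≤X 0≤Y Y<l 0≤C C≤v m n E less =
    ^-reflects-≤ 1<b (j ℕ.* m) (suc l ℕ.* n ℕ.+ v ℕ.* E) (begin
      b ^ℚ (j ℕ.* m) ≡⟨ ^-^ b j m ⟨
      (b ^ℚ j) ^ℚ m ≤⟨ ^-mono m (^-nonneg j 0≤b) j≤X ⟩
      X ^ℚ m ≤⟨ less ⟩
      Y ^ℚ n * C ^ℚ E ≤⟨ *-mono (^-nonneg n 0≤Y) (^-mono n 0≤Y (ℚₚ.<⇒≤ Y<l)) (^-nonneg E 0≤C) (^-mono E 0≤C C≤v) ⟩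
      (b ^ℚ suc l) ^ℚ n * (b ^ℚ v) ^ℚ E ≡⟨ cong₂ _*_ (^-^ b (suc l) n) (^-^ b v E) ⟩
      b ^ℚ (suc l ℕ.* n) * b ^ℚ (v ℕ.* E) ≡⟨ ^-+ b (suc l ℕ.* n) (v ℕ.* E) ⟨
      b ^ℚ (suc l ℕ.* n ℕ.+ v ℕ.* E) ∎)
    where
    open ℚₚ.≤-Reasoning
    0≤b : 0ℚ ≤ b
    0≤b = ℚₚ.≤-trans 0≤1 (ℚₚ.<⇒≤ 1<b)

  eventually-bounded : ∀ x → ∃[ T ] ∃[ K ] ∀ k → K ℕ.≤ k → seq x k ≤ ι T
  eventually-bounded x = proj₁ top , K , λ k K≤k →
    ℚₚ.≤-trans (ℚₚ.<⇒≤ (∣∣-upper {seq x k} {seq x K} (proj₂ near k K K≤k ℕₚ.≤-refl))) (proj₂ top)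
    where
    near = cauchy x 1ℚ (ℚₚ.positive⁻¹ 1ℚ)
    K = proj₁ near
    top = upper-bound (seq x K + 1ℚ)

  module Densities
    {f : ℕ → ℕ} (slow : ∀ q → 1 ℕ.≤ q → ∃[ s ] 1 ℕ.≤ s × q ℕ.^ s ℕ.* suc (f s) ℕ.≤ suc q ℕ.^ s)
    {d : ℕ} {Hs : ℕ → FiniteGraph} (convergent : WeaklyConvergent d Hs)
    (growth : ∀ n x i → 1 ℕ.≤ i → ‖ ball (graph (Hs n)) i x ‖ ℕ.≤ f i) where

    open Comparison {f} slow {d} {Hs} convergent growth

    private
      order′ : ℕ → ℕ
      order′ n = order (Hs n)

    module _ (θ : GraphParameter ℕ-orderedMonoid d) where

      private
        u : ℕ
        u = GraphParameter.unit θ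

      density-gap : ∀ q m n → proj₁ (Scale.threshold q) ℕ.≤ m → proj₁ (Scale.threshold q) ℕ.≤ n →
                    ι (whole θ m) * recip (Hs m) ≤ ι (whole θ n) * recip (Hs n) + ι (5 ℕ.* u) * inv q
      density-gap q m n N≤m N≤n = density-≤ q (whole θ m) (whole θ n) (5 ℕ.* u) (Hs m) (Hs n)
        (cancel-scale q (Scale.D q) (order′ m) (order′ n) (whole θ m) (whole θ n) u (proj₁ compared) (Scale.1≤D q)
          (proj₁ (proj₂ compared)) (subst₂ ℕ._≤_ (·-* (Scale.D q ℕ.* order′ n) (whole θ m))
            (cong₂ ℕ._+_ (·-* (Scale.D q ℕ.* order′ m) (whole θ n)) (·-* (proj₁ compared) u)) (proj₂ (proj₂ compared))))
        where
        compared = Scale.combine q θ m n N≤m N≤n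
        ·-* : ∀ n k → n Σℕ.· k ≡ k ℕ.* n
        ·-* n k = trans (·≡* n k) (ℕₚ.*-comm n k)

      module _ (a : ℕ → ℕ) (whole≡a : ∀ n → whole θ n ≡ a n) where

        density-close : ∀ q ε → ι (5 ℕ.* u) * inv q < ε → ∀ m n →
                        proj₁ (Scale.threshold q) ℕ.≤ m → proj₁ (Scale.threshold q) ℕ.≤ n →
                        (a m /∣ Hs m ∣) < (a n /∣ Hs n ∣) + ε
        density-close q ε small m n N≤m N≤n = subst₂ _<_ (left m) (cong (_+ ε) (left n))
          (ℚₚ.≤-<-trans (density-gap q m n N≤m N≤n) (ℚₚ.+-monoʳ-< (ι (whole θ n) * recip (Hs n)) small))
          where
          left : ∀ n → ι (whole θ n) * recip (Hs n) ≡ a n /∣ Hs n ∣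
          left n = trans (cong (λ w → ι w * recip (Hs n)) (whole≡a n)) (sym (density (a n) (Hs n)))

        density-limit : LimitExists (λ n → fromℚ (a n /∣ Hs n ∣))
        density-limit = Completeness.limit (λ n → fromℚ (a n /∣ Hs n ∣)) densities-cauchy
          where
          densities-cauchy : CauchySequence (λ n → fromℚ (a n /∣ Hs n ∣))
          densities-cauchy ε 0<ε = proj₁ (Scale.threshold (proj₁ small)) , λ m n N≤m N≤n → 0 , λ k _ →
            density-close (proj₁ small) ε (proj₂ small (proj₁ small) ℕₚ.≤-refl) m n N≤m N≤n
            where small = inv-vanishes (5 ℕ.* u) ε 0<ε

    -- Every approximation index `k` has its own parameter `θ k`. `Scale.threshold` is common to all
    -- of them and `U` bounds their units uniformly, so for fixed `m` and `n` the comparison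
    -- persists as `k` grows.
    module _ (x : ℕ → ℝ) (K₀ U : ℕ)
             (θ : ∀ k → K₀ ℕ.≤ k → GraphParameter ℚ≥1-orderedMonoid d)
             (θ-value : ∀ k K≤k n → proj₁ (whole (θ k K≤k) n) ≡ seq (x n) k)
             (θ-unit : ∀ k K≤k → proj₁ (GraphParameter.unit (θ k K≤k)) ≤ ι (suc U)) where

      private
        T K : ℕ → ℕ
        T n = proj₁ (eventually-bounded (x n))
        K n = K₀ ⊔ proj₁ (proj₂ (eventually-bounded (x n)))

        1≤x : ∀ n k → K n ℕ.≤ k → 1ℚ ≤ seq (x n) k
        1≤x n k K≤k = subst (1ℚ ≤_) (θ-value k K₀≤k n) (proj₂ (whole (θ k K₀≤k) n))
          where K₀≤k = ℕₚ.m⊔n≤o⇒m≤o K₀ _ K≤k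

        x≤T : ∀ n k → K n ℕ.≤ k → seq (x n) k ≤ ι (T n)
        x≤T n k K≤k = proj₂ (proj₂ (eventually-bounded (x n))) k (ℕₚ.m⊔n≤o⇒n≤o K₀ _ K≤k)

        module Log n = Logarithm (x n) (T n) (K n) (1≤x n) (x≤T n)

        power-· : ∀ n X → proj₁ (OrderedMonoid._·_ ℚ≥1-orderedMonoid n X) ≡ proj₁ X ^ℚ n
        power-· zero    X = refl
        power-· (suc n) X = cong (proj₁ X *_) (power-· n X)

        index-gap : ∀ q m n → proj₁ (Scale.threshold q) ℕ.≤ m → proj₁ (Scale.threshold q) ℕ.≤ n →
                    ∀ k → K m ℕ.≤ k → K n ℕ.≤ k →
                    suc q ℕ.* (Log.index m k ℕ.* order′ n) ℕ.≤
                    suc q ℕ.* (suc (Log.index n k) ℕ.* order′ m) ℕ.+ 5 ℕ.* (U ℕ.* suc k) ℕ.* (order′ m ℕ.* order′ n)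
        index-gap q m n N≤m N≤n k Km≤k Kn≤k =
          cancel-scale q (Scale.D q) (order′ m) (order′ n) (Log.index m k) (suc (Log.index n k)) (U ℕ.* suc k) (proj₁ compared)
            (Scale.1≤D q) (proj₁ (proj₂ compared))
            (exponent-compare {base k} {seq (x m) k} {seq (x n) k} {proj₁ u} {Log.index m k} {Log.index n k} {U ℕ.* suc k}
              (shift-< 1ℚ (inv-pos k) (ℚₚ.+-identityʳ 1ℚ) refl)
              (Log.index-lower m k Km≤k) (ℚₚ.≤-trans 0≤1 (1≤x n k Kn≤k)) (Log.index-upper n k Kn≤k)
              (ℚ≥1-nonneg u) (ℚₚ.≤-trans (θ-unit k K₀≤k) (ι≤base^ U k))
              (Scale.D q ℕ.* order′ n) (Scale.D q ℕ.* order′ m) (proj₁ compared)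
              (subst₂ _≤_ (trans (power-· (Scale.D q ℕ.* order′ n) (whole θₖ m)) (cong (_^ℚ (Scale.D q ℕ.* order′ n)) (θ-value k K₀≤k m)))
                (cong₂ _*_ (trans (power-· (Scale.D q ℕ.* order′ m) (whole θₖ n)) (cong (_^ℚ (Scale.D q ℕ.* order′ m)) (θ-value k K₀≤k n)))
                           (power-· (proj₁ compared) u))
                (proj₂ (proj₂ compared))))
          where
          K₀≤k : K₀ ℕ.≤ k
          K₀≤k = ℕₚ.m⊔n≤o⇒m≤o K₀ _ Km≤k
          θₖ = θ k K₀≤k
          u = GraphParameter.unit θₖ
          compared = Scale.combine q θₖ m n N≤m N≤n

        -- In base `base k` a unit has exponent `U * suc k`; multiplication by `inv k` makes its
        -- contribution independent of `k`. The rounding of the exponent leaves `inv k`.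
        approx-gap : ∀ q m n → proj₁ (Scale.threshold q) ℕ.≤ m → proj₁ (Scale.threshold q) ℕ.≤ n →
                     ∀ k → K m ℕ.≤ k → K n ℕ.≤ k →
                     recip (Hs m) * Log.approx m k ≤ recip (Hs n) * Log.approx n k + (inv k + ι (5 ℕ.* U) * inv q)
        approx-gap q m n N≤m N≤n k Km≤k Kn≤k = begin
          r * (ι i * inv k)
            ≡⟨ solve 3 (λ r i k → r :* (i :* k) := i :* r :* k) refl r (ι i) (inv k) ⟩
          ι i * r * inv k
            ≤⟨ *-monoʳ (inv k) (0≤inv k) (density-≤ q i (suc l) (5 ℕ.* (U ℕ.* suc k)) (Hs m) (Hs n)
                 (index-gap q m n N≤m N≤n k Km≤k Kn≤k)) ⟩
          (ι (suc l) * s + ι (5 ℕ.* (U ℕ.* suc k)) * inv q) * inv k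
            ≡⟨ cong₂ (λ a b → (a * s + b * inv q) * inv k) (ι-suc l)
                 (trans (cong ι (sym (ℕₚ.*-assoc 5 U (suc k)))) (ι-* (5 ℕ.* U) (suc k))) ⟩
          ((1ℚ + ι l) * s + ι (5 ℕ.* U) * ι (suc k) * inv q) * inv k
            ≡⟨ solve 6 (λ l s c M q k → ((con 1ℚ :+ l) :* s :+ c :* M :* q) :* k := s :* (l :* k) :+ (s :* k :+ c :* q :* (k :* M))) refl
                 (ι l) s (ι (5 ℕ.* U)) (ι (suc k)) (inv q) (inv k) ⟩
          s * (ι l * inv k) + (s * inv k + ι (5 ℕ.* U) * inv q * (inv k * ι (suc k)))
            ≤⟨ ℚₚ.+-monoʳ-≤ (s * (ι l * inv k)) (ℚₚ.+-mono-≤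
                 (ℚₚ.≤-trans (*-monoʳ (inv k) (0≤inv k) (recip-≤1 (Hs n))) (ℚₚ.≤-reflexive (ℚₚ.*-identityˡ (inv k))))
                 (ℚₚ.≤-reflexive (trans (cong (ι (5 ℕ.* U) * inv q *_) (inv-cancel k)) (ℚₚ.*-identityʳ _)))) ⟩
          s * (ι l * inv k) + (inv k + ι (5 ℕ.* U) * inv q) ∎
          where
          open ℚₚ.≤-Reasoning
          r s : ℚ
          r = recip (Hs m)
          s = recip (Hs n)
          i l : ℕ
          i = Log.index m k
          l = Log.index n k

      logDensity-limit : LogDensityLimitExists Hs x
      logDensity-limit = Log.logarithm , Log.logarithm-isLog ,
        Completeness.limit (λ n → fromℚ (1 /∣ Hs n ∣) *ᴿ Log.logarithm n) λ ε 0<ε →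
          let small  = inv-vanishes (5 ℕ.* U) (half ε) (half-pos 0<ε)
              small′ = small-inv (half ε) (half-pos 0<ε)
              q = proj₁ small
          in proj₁ (Scale.threshold q) , λ m n N≤m N≤n → K m ⊔ (K n ⊔ proj₁ small′) , λ k K≤k →
               subst₂ (λ r s → r * Log.approx m k < s * Log.approx n k + ε) (recip-def (Hs m)) (recip-def (Hs n))
                 (ℚₚ.≤-<-trans
                   (approx-gap q m n N≤m N≤n k (ℕₚ.m⊔n≤o⇒m≤o (K m) _ K≤k) (ℕₚ.m⊔n≤o⇒m≤o (K n) _ (ℕₚ.m⊔n≤o⇒n≤o (K m) _ K≤k)))
                   (ℚₚ.+-monoʳ-< (recip (Hs n) * Log.approx n k) (subst (inv k + ι (5 ℕ.* U) * inv q <_) (half+half ε)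
                     (ℚₚ.+-mono-< (ℚₚ.≤-<-trans (inv-anti (ℕₚ.m⊔n≤o⇒n≤o (K n) (proj₁ small′) (ℕₚ.m⊔n≤o⇒n≤o (K m) _ K≤k))) (proj₂ small′))
                                  (proj₂ small q ℕₚ.≤-refl)))))

    module _ (z : ℝ) (0<z : fromℚ 0ℚ <ᴿ z) where

      private
        Kz Zb K₀ : ℕ
        Kz = proj₁ (proj₂ (proj₂ 0<z))
        Zb = proj₁ (eventually-bounded z)
        K₀ = Kz ⊔ proj₁ (proj₂ (eventually-bounded z))

        0≤z : ∀ k → K₀ ℕ.≤ k → 0ℚ ≤ seq z k
        0≤z k K≤k = ℚₚ.<⇒≤ (ℚₚ.<-trans (proj₁ (proj₂ 0<z)) (subst (_< seq z k) (ℚₚ.+-identityˡ (proj₁ 0<z))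
          (proj₂ (proj₂ (proj₂ 0<z)) k (ℕₚ.m⊔n≤o⇒m≤o Kz _ K≤k))))

        cost-bound : ∀ k (K≤k : K₀ ℕ.≤ k) → proj₁ (Weight.cost (polynomialWeight (0≤z k K≤k))) ≤ ι (suc Zb)
        cost-bound k K≤k = subst (1ℚ + seq z k ≤_) (sym (ι-suc Zb))
          (ℚₚ.+-monoʳ-≤ 1ℚ (proj₂ (proj₂ (eventually-bounded z)) k (ℕₚ.m⊔n≤o⇒n≤o Kz _ K≤k)))

      independence-limit : LogDensityLimitExists Hs (λ n → πᴵ (Hs n) z)
      independence-limit = logDensity-limit (λ n → πᴵ (Hs n) z) K₀ Zb
        (λ k K≤k → independence (polynomialWeight (0≤z k K≤k)) d)
        (λ k K≤k n → πᴵ-value (Hs n) z k (0≤z k K≤k) d) cost-bound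

      matching-limit : LogDensityLimitExists Hs (λ n → πᴹ (Hs n) z)
      -- The unit for matchings is `d · cost`, here the `d`-th power of `1 + z`, and `1 + z` is at
      -- most `suc Zb`.
      matching-limit = logDensity-limit (λ n → πᴹ (Hs n) z) K₀ (suc Zb ℕ.^ d)
        (λ k K≤k → matching (polynomialWeight (0≤z k K≤k)) d)
        (λ k K≤k n → πᴹ-value (Hs n) z k (0≤z k K≤k) d)
        (λ k K≤k → ℚₚ.≤-trans (power-bound (Weight.cost (polynomialWeight (0≤z k K≤k))) (cost-bound k K≤k) d)
                               (ι-mono (ℕₚ.n≤1+n (suc Zb ℕ.^ d))))
        where
        power-bound : ∀ X → proj₁ X ≤ ι (suc Zb) → ∀ n → proj₁ (OrderedMonoid._·_ ℚ≥1-orderedMonoid n X) ≤ ι (suc Zb ℕ.^ n)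
        power-bound X X≤ zero    = ℚₚ.≤-reflexive (sym ι-1)
        power-bound X X≤ (suc n) = ℚₚ.≤-trans
          (*-mono (ℚ≥1-nonneg X) X≤ (ℚ≥1-nonneg (OrderedMonoid._·_ ℚ≥1-orderedMonoid n X)) (power-bound X X≤ n))
          (ℚₚ.≤-reflexive (sym (ι-* (suc Zb) (suc Zb ℕ.^ n))))

  unique-⊆-length : ∀ {X : Set} {xs ys : List X} → Unique xs → (∀ {x} → x ∈ xs → x ∈ ys) → length xs ℕ.≤ length ys
  unique-⊆-length {xs = xs} {ys} xs! xs⊆ys = Finₚ.injective⇒≤ {f = position} λ {i} {j} eq →
    lookup-injective xs! (trans (Anyₚ.lookup-index (xs⊆ys (∈-lookup i)))
      (trans (cong (lookup ys) eq) (sym (Anyₚ.lookup-index (xs⊆ys (∈-lookup j))))))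
    where
    position : Fin (length xs) → Fin (length ys)
    position i = index (xs⊆ys (∈-lookup i))

  module _ {V : Set} {G : Graph V} (S : FiniteVertexSet V) where
    open FiniteVertexSet S

    induced-dist : ∀ {r i j} → Dist≤ (graph (induced G S)) r i j → Dist≤ G r (vertex i) (vertex j)
    induced-dist here         = here
    induced-dist (step i~k p) = step i~k (induced-dist p)

    -- Walks in the induced subgraph are walks in `G`, so `vertex` maps its balls injectively into
    -- balls of `G`.
    induced-growth : ∀ {f} → Growth≤ G f → ∀ i r → 1 ℕ.≤ r → ‖ ball (graph (induced G S)) r i ‖ ℕ.≤ f r
    induced-growth {f} growth i r 1≤r with growth (vertex i) r 1≤r
    ... | m , (ys , _ , ys⇔ball , refl) , m≤f = ℕₚ.≤-trans (ℕₚ.≤-reflexive (sym size-≡))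
        (ℕₚ.≤-trans (unique-⊆-length (Uniqueₚ.map⁺ injective members!) image⊆) m≤f)
      where
      B? = dist? (graph (induced G S)) r i
      members = filter B? (allFin size)
      members! : Unique members
      members! = Uniqueₚ.filter⁺ B? (Uniqueₚ.allFin⁺ size)
      size-≡ : length (map vertex members) ≡ ‖ ball (graph (induced G S)) r i ‖
      size-≡ = trans (Listₚ.length-map vertex members) (trans (length-∑ members) (∑-filter B? (allFin size) (λ _ → 1)))
      image⊆ : ∀ {v} → v ∈ map vertex members → v ∈ ys
      image⊆ v∈ with ∈-map⁻ vertex {xs = members} v∈
      ... | j , j∈ , refl = Equivalence.from (ys⇔ball (vertex j)) (induced-dist (proj₂ (∈-filter⁻ B? {xs = allFin size} j∈)))

open Weights
open GraphParameters
open Comparisons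
open Limits

theorem5 : (f : ℕ → ℕ) → SubexponentialGrowth f →
    (V : Set) (G : Graph V) → Infinite V → Connected G → Growth≤ G f →
    (d : ℕ) → MaxDegree≤ G d → UPF d G →
    (F : ℕ → FiniteVertexSet V) → Følner G F →
    let Gₙ = induced G ∘ F in
    LimitExists (λ n → fromℚ (I (Gₙ n) /∣ Gₙ n ∣))
    × LimitExists (λ n → fromℚ (M (Gₙ n) /∣ Gₙ n ∣))
    × (∀ (z : ℝ) → fromℚ 0ℚ <ᴿ z → LogDensityLimitExists Gₙ (λ n → πᴵ (Gₙ n) z))
    × (∀ (z : ℝ) → fromℚ 0ℚ <ᴿ z → LogDensityLimitExists Gₙ (λ n → πᴹ (Gₙ n) z))
theorem5 f subexponential V G _ _ growth d _ upf F følner =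
  density-limit (independence sizeWeight d) (λ n → I (Gₙ n)) (λ n → I-value (Gₙ n) d) ,
  density-limit (matching sizeWeight d) (λ n → M (Gₙ n)) (λ n → M-value (Gₙ n) d) ,
  independence-limit ,
  matching-limit
  where
  Gₙ = induced G ∘ F
  -- UPF turns the Følner property into weak convergence, and the rest concerns only the finite
  -- graphs `Gₙ` and their growth bound `f`.
  open Densities {f} (subexponential-slow subexponential) {d} {Gₙ} (upf F følner) (λ n x i → induced-growth (F n) growth x i)
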